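{- For parameters $\alpha,\beta$ and variables $x_1,\dots,x_m$, $y_1,\dots,y_n$, $$\sum_{\lambda}G^{(-\alpha,-\beta)}_\lambda(x_1,\dots,x_m)\,g^{(\alpha,\beta)}_\lambda(y_1,\dots,y_n)=\prod_{1\le i\le m,\,1\le j\le n}\frac{1}{1-x_iy_j},$$ the sum running over all partitions $\lambda$ (an identity of formal power series).
   Context: Canonical Grothendieck polynomials: for $\mu\subseteq\lambda$, $\lambda/\mu$ is a horizontal strip if $\lambda_1\ge\mu_1\ge\lambda_2\ge\cdots$; $\bar\lambda=(\lambda_2,\lambda_3,\dots)$; $r(\kappa/\nu)$ is the number of $i$ with $\kappa_i>\nu_i$. $G^{(\alpha,\beta)}_\lambda()=\delta_{\lambda,\emptyset}$ (no variables) and $G^{(\alpha,\beta)}_\lambda(x_1,\dots,x_{n+1})=\sum_{\mu:\lambda/\mu\text{ horizontal strip}}G^{(\alpha,\beta)}_\mu(x_1,\dots,x_n)\big(\frac{x}{1-\alpha x}\big)^{|\lambda|-|\mu|}\big(\frac{1+\beta x}{1-\alpha x}\big)^{r(\mu/\bar\lambda)}$, $x=x_{n+1}$; $G^{(-\alpha,-\beta)}$ is obtained by replacing $(\alpha,\beta)$ with $(-\alpha,-\beta)$. Dual canonical Grothendieck polynomials: for $\mu\subseteq\lambda$ let $r,c,b$ be the numbers of nonempty rows, nonempty columns and edge-connected components of $\lambda/\mu$; $g^{(\alpha,\beta)}_\lambda()=\delta_{\lambda,\emptyset}$ and $g^{(\alpha,\beta)}_\lambda(x_1,\dots,x_{n+1})=\sum_{\mu\subseteq\lambda}g^{(\alpha,\beta)}_\mu(x_1,\dots,x_n)\beta^{r-b}(\alpha+\beta)^{|\lambda|-|\mu|-r-c+b}x_{n+1}^{b}(\alpha+x_{n+1})^{c-b}$.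 -}

module Defs where

open import Algebra.Bundles using (CommutativeRing)
open import Data.Nat using (ℕ; zero; suc; _+_; _∸_; _<ᵇ_; _≡ᵇ_; _⊓_)
open import Data.Bool using (Bool; true; false; _∧_; _∨_; not; if_then_else_)
open import Data.List using (List; []; _∷_; map; concatMap; foldr; length; replicate; upTo; allFin; filterᵇ)
open import Data.Nat.ListAction using (sum)
open import Data.Bool.ListAction using (any)
open import Data.Product using (_×_; _,_; proj₁; proj₂)
open import Data.Fin using (Fin; _↑ˡ_; _↑ʳ_; inject₁; fromℕ) renaming (zero to fz; suc to fs; _≟_ to _≟F_)
open import Relation.Nullary using (does)
open import Function using (_∘_)

-- Partitions are represented as lists of positive, weakly decreasing
-- naturals (λ₁ ≥ λ₂ ≥ ⋯ > 0).  All enumerations below only ever produce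
-- such lists.

-- λ_i (0-indexed), 0 beyond the length
at : List ℕ → ℕ → ℕ
at []       _       = 0
at (x ∷ xs) zero    = x
at (x ∷ xs) (suc i) = at xs i

countB : (ℕ → Bool) → ℕ → ℕ
countB p k = length (filterᵇ p (upTo k))

trim : List ℕ → List ℕ
trim [] = []
trim (x ∷ xs) with trim xs
... | []     = if x ≡ᵇ 0 then [] else x ∷ []
... | y ∷ ys = x ∷ y ∷ ys

range : ℕ → ℕ → List ℕ
range lo hi = map (lo +_) (upTo (suc (hi ∸ lo)))

headOr0 : List ℕ → ℕ
headOr0 []      = 0
headOr0 (x ∷ _) = x

-- all μ with λ/μ a horizontal strip: λ₁ ≥ μ₁ ≥ λ₂ ≥ μ₂ ≥ ⋯
hsRaw : List ℕ → List (List ℕ)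
hsRaw []       = [] ∷ []
hsRaw (l ∷ ls) = concatMap (λ t → map (t ∷_) (hsRaw ls)) (range (headOr0 ls) l)

horizontalStrips : List ℕ → List (List ℕ)
horizontalStrips lam = map trim (hsRaw lam)

subBounded : ℕ → List ℕ → List (List ℕ)
subBounded b []       = [] ∷ []
subBounded b (l ∷ ls) = [] ∷ concatMap (λ k → map (suc k ∷_) (subBounded (suc k) ls)) (upTo (b ⊓ l))

subPartitions : List ℕ → List (List ℕ)
subPartitions lam = subBounded (headOr0 lam) lam

_≤ᵇ_ : ℕ → ℕ → Bool
a ≤ᵇ b = a <ᵇ suc b

-- all partitions of size ≤ N (each has λ₁ ≤ N and at most N parts)
partitionsUpTo : ℕ → List (List ℕ)
partitionsUpTo N = filterᵇ (λ lam → sum lam ≤ᵇ N) (subBounded N (replicate N N))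

-- r(κ/ν) for ν = λ̄ = (λ₂, λ₃, …): number of i with μ_i > λ_{i+1}
rBar : List ℕ → List ℕ → ℕ
rBar mu lam = countB (λ i → at lam (suc i) <ᵇ at mu i) (length mu)

-- Skew shapes λ/μ as lists of cells (row, column), 0-indexed

skewCells : List ℕ → List ℕ → List (ℕ × ℕ)
skewCells lam mu = concatMap (λ i → map (λ t → (i , at mu i + t)) (upTo (at lam i ∸ at mu i))) (upTo (length lam))

adjacent : ℕ × ℕ → ℕ × ℕ → Bool
adjacent (i , j) (i' , j') =
  ((i ≡ᵇ i') ∧ ((suc j ≡ᵇ j') ∨ (suc j' ≡ᵇ j))) ∨ ((j ≡ᵇ j') ∧ ((suc i ≡ᵇ i') ∨ (suc i' ≡ᵇ i)))

sameCell : ℕ × ℕ → ℕ × ℕ → Bool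
sameCell (i , j) (i' , j') = (i ≡ᵇ i') ∧ (j ≡ᵇ j')

reach : ℕ → List (ℕ × ℕ) → ℕ × ℕ → ℕ × ℕ → Bool
reach zero    cs u v = sameCell u v
reach (suc t) cs u v = reach t cs u v ∨ any (λ w → reach t cs u w ∧ adjacent w v) cs

-- number of connected components of the graph on cs (edge-adjacency):
-- count the cells not reachable from any earlier cell
componentsAux : List (ℕ × ℕ) → List (ℕ × ℕ) → List (ℕ × ℕ) → ℕ
componentsAux cs seen []       = 0
componentsAux cs seen (v ∷ vs) =
  (if any (λ u → reach (length cs) cs u v) seen then 0 else 1) + componentsAux cs (v ∷ seen) vs

nRows nCols nComps : List ℕ → List ℕ → ℕ
nRows  lam mu = countB (λ i → any (λ x → proj₁ x ≡ᵇ i) (skewCells lam mu)) (length lam)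
nCols  lam mu = countB (λ j → any (λ x → proj₂ x ≡ᵇ j) (skewCells lam mu)) (headOr0 lam)
nComps lam mu = componentsAux (skewCells lam mu) [] (skewCells lam mu)

allZero : ∀ k → (Fin k → ℕ) → Bool
allZero zero    e = true
allZero (suc k) e = (e fz ≡ᵇ 0) ∧ allZero k (e ∘ fs)

cons : ∀ {k} → ℕ → (Fin k → ℕ) → Fin (suc k) → ℕ
cons t d fz     = t
cons t d (fs i) = d i

boxes : ∀ k → (Fin k → ℕ) → List (Fin k → ℕ)
boxes zero    e = (λ ()) ∷ []
boxes (suc k) e = concatMap (λ d → map (λ t → cons t d) (upTo (suc (e fz)))) (boxes k (e ∘ fs))

module Series {c ℓ} (R : CommutativeRing c ℓ) where
  open CommutativeRing R renaming (Carrier to A; _+_ to _+R_; _*_ to _*R_)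

  Σᴸ : List A → A
  Σᴸ = foldr _+R_ 0#

  pow : A → ℕ → A
  pow a zero    = 1#
  pow a (suc k) = a *R pow a k

  -- univariate power series: coefficient sequences
  U : Set c
  U = ℕ → A

  _·ᵘ_ : U → U → U
  (f ·ᵘ g) j = Σᴸ (map (λ i → f i *R g (j ∸ i)) (upTo (suc j)))

  constᵘ : A → U
  constᵘ a zero    = a
  constᵘ a (suc _) = 0#

  linᵘ : A → A → U
  linᵘ a b zero          = a
  linᵘ a b (suc zero)    = b
  linᵘ a b (suc (suc _)) = 0#

  Xᵘ : U
  Xᵘ = linᵘ 0# 1#

  -- 1 / (1 - a x) = Σ_j a^j x^j
  geoᵘ : A → U
  geoᵘ a j = pow a j

  powᵘ : U → ℕ → U
  powᵘ u zero    = constᵘ 1#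
  powᵘ u (suc k) = u ·ᵘ powᵘ u k

  -- power series in k variables: coefficient of x^e
  PS : ℕ → Set c
  PS k = (Fin k → ℕ) → A

  _⋆_ : ∀ {k} → PS k → PS k → PS k
  _⋆_ {k} f g e = Σᴸ (map (λ d → f d *R g (λ i → e i ∸ d i)) (boxes k e))

  oneS : ∀ {k} → PS k
  oneS {k} e = if allZero k e then 1# else 0#

  sumS : ∀ {k} → List (PS k) → PS k
  sumS ss e = Σᴸ (map (λ f → f e) ss)

  ext : ∀ {n} → PS n → PS (suc n)
  ext {n} f e = if e (fromℕ n) ≡ᵇ 0 then f (e ∘ inject₁) else 0#

  inLast : ∀ {n} → U → PS (suc n)
  inLast {n} u e = if allZero n (e ∘ inject₁) then u (e (fromℕ n)) else 0#

  Gr : A → A → ∀ n → List ℕ → PS n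
  Gr a b zero    []      e = 1#
  Gr a b zero    (_ ∷ _) e = 0#
  Gr a b (suc n) lam =
    sumS (map (λ mu → ext (Gr a b n mu) ⋆
                 inLast (powᵘ (Xᵘ ·ᵘ geoᵘ a) (sum lam ∸ sum mu)
                         ·ᵘ powᵘ (linᵘ 1# b ·ᵘ geoᵘ a) (rBar mu lam)))
              (horizontalStrips lam))

  gr : A → A → ∀ n → List ℕ → PS n
  gr α β zero    []      e = 1#
  gr α β zero    (_ ∷ _) e = 0#
  gr α β (suc n) lam =
    sumS (map (λ mu → let r = nRows lam mu ; cc = nCols lam mu ; b = nComps lam mu in
                 ext (gr α β n mu) ⋆
                 inLast (constᵘ (pow β (r ∸ b) *R pow (α +R β) ((sum lam ∸ sum mu + b) ∸ (r + cc)))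
                         ·ᵘ (powᵘ Xᵘ b ·ᵘ powᵘ (linᵘ α 1#) (cc ∸ b))))
              (subPartitions lam))

  embL : ∀ {m} n → PS m → PS (m + n)
  embL {m} n f e = if allZero n (λ j → e (m ↑ʳ j)) then f (λ i → e (i ↑ˡ n)) else 0#

  embR : ∀ m {n} → PS n → PS (m + n)
  embR m {n} f e = if allZero m (λ i → e (i ↑ˡ n)) then f (λ j → e (m ↑ʳ j)) else 0#

  lhsTrunc : A → A → ∀ m n → ℕ → PS (m + n)
  lhsTrunc α β m n N =
    sumS (map (λ lam → embL n (Gr (- α) (- β) m lam) ⋆ embR m (gr α β n lam)) (partitionsUpTo N))

  -- 1/(1 - x_i y_j) = Σ_t x_i^t y_j^t, as a series in (x, y)
  geoPair : ∀ {k} → Fin k → Fin k → PS k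
  geoPair {k} p q e =
    if (e p ≡ᵇ e q) ∧ allZero k (λ l → if does (l ≟F p) ∨ does (l ≟F q) then 0 else e l)
    then 1# else 0#

  cauchyProd : ∀ m n → PS (m + n)
  cauchyProd m n =
    foldr _⋆_ oneS (concatMap (λ i → map (λ j → geoPair (i ↑ˡ n) (m ↑ʳ j)) (allFin n)) (allFin m))

{-# OPTIONS --safe #-}
module Submission where

-- Write t = x/(1+αx), so that (1-βx)/(1+αx) = 1-(α+β)t.  With partitions padded by zeros to fixed
-- length, one variable x adds a row, with weight a(μ,λ) a product over rows, and so is the weight
-- b(λ,ν) of one variable y: the number of components, rows and columns of λ/ν are sums of local
-- contributions.  The heart is the one-variable skew Cauchy identity
--
--   (1 - xy) Σ_λ a(μ,λ) b(λ,ν) = Σ_κ b(μ,κ) a(κ,ν).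
--
-- For fixed μ and ν both sums factor into sums over single rows, and consecutive rows match up to
-- the telescoping factor h below, by geometric series.  The identity says that λ ↦ g_λ(y) is an
-- eigenvector of the operator that adds the variable x, with eigenvalue Π_j 1/(1 - x y_j); the
-- theorem follows by removing the x-variables one at a time.  All of this is carried out on
-- coefficients, so that every sum over λ is finite: x^i y^j only sees λ with |λ| - |μ| ≤ i.

open import Defs
open import Algebra.Bundles using (CommutativeRing)
import Algebra.Solver.Ring.NaturalCoefficients.Default
open import Data.Bool using (Bool; true; false; _∧_; _∨_; if_then_else_; T)
open import Data.Bool.ListAction using (any)
open import Data.Bool.Properties using (T-≡; T-∨; T-∧)
open import Data.Empty using (⊥-elim)
open import Data.Fin using (Fin; _↑ˡ_; _↑ʳ_; inject₁; fromℕ; opposite; splitAt) renaming (zero to fz; suc to fs; _≟_ to _≟F_)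
open import Data.Fin.Properties using (splitAt-↑ˡ; splitAt-↑ʳ; splitAt⁻¹-↑ˡ; splitAt⁻¹-↑ʳ; opposite-involutive; ↑ˡ-injective; ↑ʳ-injective)
open import Data.List using (List; []; _∷_; _++_; map; concatMap; foldr; length; replicate; upTo; applyUpTo; allFin; filterᵇ; _ʳ++_)
import Data.List as List
open import Data.List.Membership.Propositional using (_∈_)
open import Data.List.Membership.Propositional.Properties using (∈-map⁺; ∈-map⁻; ∈-upTo⁺; ∈-upTo⁻; ∈-concatMap⁺; ∈-concatMap⁻)
open import Data.List.Properties using (upTo-∷ʳ; concatMap-cong; concatMap-++; length-++; ++-identityʳ; map-concatMap; concatMap-map; map-∘; foldr-map; map-++)
open import Data.List.Relation.Binary.Permutation.Propositional using (_↭_)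
import Data.List.Relation.Binary.Permutation.Propositional as ↭
import Data.List.Relation.Binary.Permutation.Propositional.Properties as ↭ₚ
open import Data.List.Relation.Unary.Any using (Any; here; there)
open import Data.List.Relation.Unary.Any.Properties using (any⁺; any⁻)
open import Data.Nat using (ℕ; zero; suc; _+_; _∸_; _≤_; _<_; z≤n; s≤s; _⊔_; _⊓_; _<ᵇ_; _≡ᵇ_; _≤?_; _<?_; _≟_)
import Data.Nat as ℕ
open import Data.Nat.ListAction using (sum)
open import Data.Nat.Properties using (≤-refl; ≤-reflexive; ≤-trans; ≤-antisym; <⇒≤; ≰⇒>; ≮⇒≥; <⇒≱; <-irrefl; <-≤-trans; ≤-<-trans; n≤1+n; m≤m+n; m≤n+m; m+[n∸m]≡n; m∸n+n≡m; m+n∸m≡n; m+n∸n≡m; n∸n≡0; m∸n≤m; suc-injective)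
import Data.Nat.Properties as ℕₚ
open import Data.Product using (∃; _×_; _,_; proj₁; proj₂)
open import Data.Sum using (_⊎_; inj₁; inj₂)
open import Data.Unit using (⊤; tt)
open import Data.Vec using (Vec; []; _∷_; lookup; tabulate; toList; updateAt)
open import Data.Vec.Properties using (tabulate-cong; lookup∘tabulate)
open import Function using (_∘_; id)
open import Function.Bundles using (Equivalence)
import Level
import Relation.Binary.Reasoning.Setoid
open import Relation.Binary.PropositionalEquality as ≡ using (_≡_; _≢_; _≗_)
open import Relation.Nullary using (Dec; yes; no; does; ¬_)
open import Relation.Nullary.Decidable using (_×-dec_)

-- The obstacle is that the weight of a row of λ/ν depends on whether it touches the next row, so it
-- couples λ_i with λ_{i+1}. Interlacing with μ removes this: λ_{i+1} ≤ μ_i ≤ λ_i, so the row can be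
-- cut at column μ_i, and the cells beyond the cut lie in columns that no lower row reaches. The
-- factor 1 - xy is consumed entirely by the first row: multiplied by the sum over an unbounded λ_1
-- it gives h(μ_1, ν_1). Every later row only hands h on, from (μ_i, ν_i) to (μ_{i+1}, ν_{i+1}). At
-- the bottom h(0, n) = t^n is left, which is the weight of the last part n of ν, the one that has
-- no partner in κ. Nothing is ever inverted. The row identities are proved in an arbitrary ring
-- whose elements satisfy four relations, and only then read in R[[y]][[x]]. Cutting λ_1 off at N
-- costs a multiple of t^(N - μ_1), which the coefficients of small x-degree do not see.

-- Finite sums, indicators and powers in a commutative ring.

module Sums {c ℓ} (R : CommutativeRing c ℓ) where
  open CommutativeRing R public
    renaming (Carrier to A; _+_ to _+R_; _*_ to _*R_; -_ to -R_; _-_ to _-R_; zero to *-zero)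
  open Series R public using (Σᴸ; pow)
  open Relation.Binary.Reasoning.Setoid setoid public
  open import Algebra.Solver.Ring.NaturalCoefficients.Default commutativeSemiring public
    using (solve; _:=_; con) renaming (_:+_ to _⊕_; _:*_ to _⊗_)

  ∑ : ℕ → (ℕ → A) → A
  ∑ zero    f = 0#
  ∑ (suc n) f = f 0 +R ∑ n (λ i → f (suc i))

  I : ∀ {p} {P : Set p} → Dec P → A
  I d = if does d then 1# else 0#

  I-yes : ∀ {p} {P : Set p} (d : Dec P) → P → I d ≈ 1#
  I-yes (yes _) _ = refl
  I-yes (no ¬p) p = ⊥-elim (¬p p)

  I-no : ∀ {p} {P : Set p} (d : Dec P) → ¬ P → I d ≈ 0#
  I-no (yes p) ¬p = ⊥-elim (¬p p)
  I-no (no _)  _  = refl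

  I*-yes : ∀ {p} {P : Set p} (d : Dec P) {x} → P → I d *R x ≈ x
  I*-yes d p = trans (*-congʳ (I-yes d p)) (*-identityˡ _)

  I*-no : ∀ {p} {P : Set p} (d : Dec P) {x} → ¬ P → I d *R x ≈ 0#
  I*-no d p = trans (*-congʳ (I-no d p)) (zeroˡ _)

  *-zeroˡ : ∀ {x y} → x ≈ 0# → x *R y ≈ 0#
  *-zeroˡ e = trans (*-congʳ e) (zeroˡ _)

  *-zeroʳ : ∀ {x y} → y ≈ 0# → x *R y ≈ 0#
  *-zeroʳ e = trans (*-congˡ e) (zeroʳ _)

  ∑-cong< : ∀ n {f g : ℕ → A} → (∀ i → i < n → f i ≈ g i) → ∑ n f ≈ ∑ n g
  ∑-cong< zero    e = refl
  ∑-cong< (suc n) e = +-cong (e 0 (s≤s z≤n)) (∑-cong< n (λ i i<n → e (suc i) (s≤s i<n)))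

  ∑-cong : ∀ n {f g : ℕ → A} → (∀ i → f i ≈ g i) → ∑ n f ≈ ∑ n g
  ∑-cong n e = ∑-cong< n (λ i _ → e i)

  ∑-zero : ∀ n {f : ℕ → A} → (∀ i → i < n → f i ≈ 0#) → ∑ n f ≈ 0#
  ∑-zero zero    e = refl
  ∑-zero (suc n) e = trans (+-cong (e 0 (s≤s z≤n)) (∑-zero n (λ i i<n → e (suc i) (s≤s i<n)))) (+-identityˡ _)

  ∑-+ : ∀ n (f g : ℕ → A) → ∑ n (λ i → f i +R g i) ≈ ∑ n f +R ∑ n g
  ∑-+ zero    f g = sym (+-identityˡ _)
  ∑-+ (suc n) f g = trans (+-congˡ (∑-+ n _ _))
    (solve 4 (λ a b x y → (a ⊕ b) ⊕ (x ⊕ y) := (a ⊕ x) ⊕ (b ⊕ y)) refl _ _ _ _)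

  ∑-*ˡ : ∀ n x (f : ℕ → A) → x *R ∑ n f ≈ ∑ n (λ i → x *R f i)
  ∑-*ˡ zero    x f = zeroʳ x
  ∑-*ˡ (suc n) x f = trans (distribˡ _ _ _) (+-congˡ (∑-*ˡ n x _))

  ∑-*ʳ : ∀ n x (f : ℕ → A) → ∑ n f *R x ≈ ∑ n (λ i → f i *R x)
  ∑-*ʳ n x f = trans (*-comm _ _) (trans (∑-*ˡ n x f) (∑-cong n (λ i → *-comm _ _)))

  ∑-swap : ∀ m n (f : ℕ → ℕ → A) → ∑ m (λ i → ∑ n (f i)) ≈ ∑ n (λ j → ∑ m (λ i → f i j))
  ∑-swap zero    n f = sym (∑-zero n (λ _ _ → refl))
  ∑-swap (suc m) n f = trans (+-congˡ (∑-swap m n _)) (sym (∑-+ n _ _))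

  ∑-split : ∀ m n (f : ℕ → A) → ∑ (m + n) f ≈ ∑ m f +R ∑ n (λ j → f (m + j))
  ∑-split zero    n f = sym (+-identityˡ _)
  ∑-split (suc m) n f = trans (+-congˡ (∑-split m n _)) (sym (+-assoc _ _ _))

  ∑-last : ∀ n (f : ℕ → A) → ∑ (suc n) f ≈ ∑ n f +R f n
  ∑-last zero    f = trans (+-identityʳ _) (sym (+-identityˡ _))
  ∑-last (suc n) f = trans (+-congˡ (∑-last n _)) (sym (+-assoc _ _ _))

  ∑-reverse : ∀ n (f : ℕ → A) → ∑ (suc n) f ≈ ∑ (suc n) (λ i → f (n ∸ i))
  ∑-reverse zero    f = refl
  ∑-reverse (suc n) f = begin
    ∑ (suc (suc n)) f                              ≈⟨ ∑-last (suc n) f ⟩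
    ∑ (suc n) f +R f (suc n)                       ≈⟨ +-congʳ (∑-reverse n f) ⟩
    ∑ (suc n) (λ i → f (n ∸ i)) +R f (suc n)       ≈⟨ +-comm _ _ ⟩
    f (suc n) +R ∑ (suc n) (λ i → f (n ∸ i))       ∎

  ∑-single : ∀ n {f : ℕ → A} k → k < n → (∀ i → i < n → i ≢ k → f i ≈ 0#) → ∑ n f ≈ f k
  ∑-single (suc n) zero    _         e =
    trans (+-congˡ (∑-zero n (λ i i<n → e (suc i) (s≤s i<n) (λ ())))) (+-identityʳ _)
  ∑-single (suc n) (suc k) (s≤s k<n) e =
    trans (+-cong (e 0 (s≤s z≤n) (λ ()))
                  (∑-single n k k<n (λ i i<n i≢k → e (suc i) (s≤s i<n) (i≢k ∘ suc-injective))))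
          (+-identityˡ _)

  ∑-window : ∀ {N} lo d {f : ℕ → A} → lo + d ≤ N → (∀ i → i < lo → f i ≈ 0#) →
             (∀ i → lo + d ≤ i → f i ≈ 0#) → ∑ N f ≈ ∑ d (λ j → f (lo + j))
  ∑-window {N} lo d {f} le below above = begin
    ∑ N f                                                      ≡⟨ ≡.cong (λ z → ∑ z f) (m+[n∸m]≡n le) ⟨
    ∑ (lo + d + r) f                                           ≈⟨ ∑-split (lo + d) r f ⟩
    ∑ (lo + d) f +R ∑ r (λ j → f (lo + d + j))                 ≈⟨ +-cong (∑-split lo d f) (∑-zero r (λ j _ → above _ (m≤m+n _ j))) ⟩
    (∑ lo f +R ∑ d (λ j → f (lo + j))) +R 0#                   ≈⟨ +-identityʳ _ ⟩
    ∑ lo f +R ∑ d (λ j → f (lo + j))                           ≈⟨ +-congʳ (∑-zero lo below) ⟩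
    0# +R ∑ d (λ j → f (lo + j))                               ≈⟨ +-identityˡ _ ⟩
    ∑ d (λ j → f (lo + j))                                     ∎
    where
    r = N ∸ (lo + d)

  ∑-from : ∀ {N} lo {d} {f : ℕ → A} → N ≡ lo + d → (∀ i → i < lo → f i ≈ 0#) → ∑ N f ≈ ∑ d (λ j → f (lo + j))
  ∑-from lo {d} {f} ≡.refl below =
    trans (∑-split lo d f) (trans (+-congʳ (∑-zero lo below)) (+-identityˡ _))

  ∑-upTo : ∀ n (f : ℕ → A) (g : ℕ → ℕ) → Σᴸ (map f (applyUpTo g n)) ≈ ∑ n (f ∘ g)
  ∑-upTo zero    f g = refl
  ∑-upTo (suc n) f g = +-congˡ (∑-upTo n f (g ∘ suc))

  Σᴸ-cong : ∀ {b} {B : Set b} (xs : List B) {f g : B → A} → (∀ x → f x ≈ g x) → Σᴸ (map f xs) ≈ Σᴸ (map g xs)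
  Σᴸ-cong []       e = refl
  Σᴸ-cong (x ∷ xs) e = +-cong (e x) (Σᴸ-cong xs e)

  Σᴸ-map : ∀ {b d} {B : Set b} {D : Set d} (xs : List B) (f : D → A) (g : B → D) →
           Σᴸ (map f (map g xs)) ≈ Σᴸ (map (f ∘ g) xs)
  Σᴸ-map []       f g = refl
  Σᴸ-map (x ∷ xs) f g = +-congˡ (Σᴸ-map xs f g)

  Σᴸ-++ : ∀ {b} {B : Set b} (xs ys : List B) (f : B → A) →
          Σᴸ (map f (xs ++ ys)) ≈ Σᴸ (map f xs) +R Σᴸ (map f ys)
  Σᴸ-++ []       ys f = sym (+-identityˡ _)
  Σᴸ-++ (x ∷ xs) ys f = trans (+-congˡ (Σᴸ-++ xs ys f)) (sym (+-assoc _ _ _))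

  Σᴸ-concatMap : ∀ {b d} {B : Set b} {D : Set d} (xs : List B) (f : D → A) (g : B → List D) →
                 Σᴸ (map f (concatMap g xs)) ≈ Σᴸ (map (λ x → Σᴸ (map f (g x))) xs)
  Σᴸ-concatMap []       f g = refl
  Σᴸ-concatMap (x ∷ xs) f g = trans (Σᴸ-++ (g x) _ f) (+-congˡ (Σᴸ-concatMap xs f g))

  pow-+ : ∀ x m n → pow x (m + n) ≈ pow x m *R pow x n
  pow-+ x zero    n = sym (*-identityˡ _)
  pow-+ x (suc m) n = trans (*-congˡ (pow-+ x m n)) (sym (*-assoc _ _ _))

  pow-* : ∀ x y n → pow (x *R y) n ≈ pow x n *R pow y n
  pow-* x y zero    = sym (*-identityˡ _)
  pow-* x y (suc n) = trans (*-congˡ (pow-* x y n))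
    (solve 4 (λ a b u v → (a ⊗ b) ⊗ (u ⊗ v) := (a ⊗ u) ⊗ (b ⊗ v)) refl _ _ _ _)

-- Sums over integer vectors with bounded entries.

module Cubes {c ℓ} (R : CommutativeRing c ℓ) (N : ℕ) where
  open Sums R

  -- Sums over partitions are written as sums over all vectors with entries below `N`: vectors that
  -- are not partitions are killed by the weights or by `g` and `G`. Thus no summation range depends
  -- on another index, and sums interchange freely.
  cube : ∀ n → (Vec ℕ n → A) → A
  cube zero    F = F []
  cube (suc n) F = ∑ N (λ k → cube n (λ v → F (k ∷ v)))

  Bounded : ∀ {n} → Vec ℕ n → Set
  Bounded []      = ⊤
  Bounded (k ∷ v) = k < N × Bounded v

  cube-cong< : ∀ n {F G : Vec ℕ n → A} → (∀ v → Bounded v → F v ≈ G v) → cube n F ≈ cube n G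
  cube-cong< zero    e = e [] tt
  cube-cong< (suc n) e = ∑-cong< N (λ k k<N → cube-cong< n (λ v bv → e (k ∷ v) (k<N , bv)))

  cube-cong : ∀ n {F G : Vec ℕ n → A} → (∀ v → F v ≈ G v) → cube n F ≈ cube n G
  cube-cong n e = cube-cong< n (λ v _ → e v)

  cube-zero : ∀ n {F : Vec ℕ n → A} → (∀ v → F v ≈ 0#) → cube n F ≈ 0#
  cube-zero zero    e = e []
  cube-zero (suc n) e = ∑-zero N (λ k _ → cube-zero n (λ v → e (k ∷ v)))

  cube-+ : ∀ n (F G : Vec ℕ n → A) → cube n (λ v → F v +R G v) ≈ cube n F +R cube n G
  cube-+ zero    F G = refl
  cube-+ (suc n) F G = trans (∑-cong N (λ k → cube-+ n _ _)) (∑-+ N _ _)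

  cube-*ˡ : ∀ n x (F : Vec ℕ n → A) → x *R cube n F ≈ cube n (λ v → x *R F v)
  cube-*ˡ zero    x F = refl
  cube-*ˡ (suc n) x F = trans (∑-*ˡ N x _) (∑-cong N (λ k → cube-*ˡ n x _))

  cube-*ʳ : ∀ n x (F : Vec ℕ n → A) → cube n F *R x ≈ cube n (λ v → F v *R x)
  cube-*ʳ n x F = trans (*-comm _ _) (trans (cube-*ˡ n x F) (cube-cong n (λ v → *-comm _ _)))

  ∑-cube : ∀ k n (F : ℕ → Vec ℕ n → A) → ∑ k (λ i → cube n (F i)) ≈ cube n (λ v → ∑ k (λ i → F i v))
  ∑-cube k zero    F = refl
  ∑-cube k (suc n) F = trans (∑-swap k N _) (∑-cong N (λ j → ∑-cube k n _))

  cube-swap : ∀ m n (F : Vec ℕ m → Vec ℕ n → A) →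
              cube m (λ u → cube n (F u)) ≈ cube n (λ v → cube m (λ u → F u v))
  cube-swap zero    n F = refl
  cube-swap (suc m) n F = trans (∑-cong N (λ k → cube-swap m n _)) (∑-cube N n _)

  -- Associativity of a product of matrices indexed by vectors; it regroups the weights of
  -- successive variables in `eigen` and `vec-cauchy`.
  cube-assoc : ∀ m k (x : Vec ℕ m → A) (y : Vec ℕ m → Vec ℕ k → A) (z : Vec ℕ k → A) →
               cube m (λ u → x u *R cube k (λ v → y u v *R z v)) ≈ cube k (λ v → cube m (λ u → x u *R y u v) *R z v)
  cube-assoc m k x y z = begin
    cube m (λ u → x u *R cube k (λ v → y u v *R z v))
      ≈⟨ cube-cong m (λ u → trans (cube-*ˡ k (x u) _) (cube-cong k (λ v → sym (*-assoc _ _ _)))) ⟩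
    cube m (λ u → cube k (λ v → (x u *R y u v) *R z v))
      ≈⟨ cube-swap m k _ ⟩
    cube k (λ v → cube m (λ u → (x u *R y u v) *R z v))
      ≈⟨ cube-cong k (λ v → sym (cube-*ʳ m (z v) _)) ⟩
    cube k (λ v → cube m (λ u → x u *R y u v) *R z v) ∎

-- The default 0 is the part that follows the last one, so the bottom row obeys the same formulas as
-- the others.
hd : ∀ {n} → Vec ℕ n → ℕ
hd []      = 0
hd (x ∷ _) = x

Decr : ∀ {n} → Vec ℕ n → Set
Decr []      = ⊤
Decr (x ∷ v) = hd v ≤ x × Decr v

∸-from : ∀ {n} k {x} → n ≡ k + x → n ∸ k ≡ x
∸-from k {x} ≡.refl = m+n∸m≡n k x

split≤ : ∀ {m n} → m ≤ n → ∃ λ d → n ≡ m + d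
split≤ {m} {n} le = n ∸ m , ≡.sym (m+[n∸m]≡n le)

split< : ∀ {m n} → m < n → ∃ λ d → n ≡ m + suc d
split< {m} {n} lt with split≤ lt
... | d , e = d , ≡.trans e (≡.sym (ℕₚ.+-suc m d))

-- Weights of one variable, row by row.

module StripWeight {c ℓ} (R : CommutativeRing c ℓ) (t ρ : CommutativeRing.Carrier R) where
  open Sums R

  rp : ℕ → A
  rp zero    = 1#
  rp (suc _) = ρ

  -- l, m, l' are λ_i, μ_i and λ_{i+1}.
  strip : ℕ → ℕ → ℕ → A
  strip l m l' = I (m ≤? l) *R (I (l' ≤? m) *R (pow t (l ∸ m) *R rp (m ∸ l')))

  -- One variable of G can create one new part, hence the extra entry of the second vector. In the
  -- new row the part of μ is 0, so it adds nothing to r and no factor `ρ` occurs.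
  a : ∀ {n} → Vec ℕ n → Vec ℕ (suc n) → A
  a []      (l ∷ []) = pow t l
  a (m ∷ μ) (l ∷ κ)  = strip l m (hd κ) *R a μ κ

module SkewWeight {c ℓ} (R : CommutativeRing c ℓ) (β q p y : CommutativeRing.Carrier R) where
  open Sums R

  -- The weight of a row that closes its component: one of its columns pays `y` for the component,
  -- each of the others pays `p`, which will be α + y.
  u : ℕ → A
  u zero    = 1#
  u (suc n) = y *R pow p n

  -- The weight of a row with end l, start m and next row ending at l' (connected to it iff m < l').
  row : ℕ → ℕ → ℕ → A
  row l m l' = if does (l' ≤? m) then u (l ∸ m) else β *R (pow q (l' ∸ suc m) *R pow p (l ∸ l'))

  -- The test `l' ≤ l` builds the condition that λ is weakly decreasing into `b`; in `a` the
  -- interlacing conditions play this part.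
  w : ℕ → ℕ → ℕ → A
  w l m l' = I (m ≤? l) *R (I (l' ≤? l) *R row l m l')

  b : ∀ {n} → Vec ℕ n → Vec ℕ n → A
  b []      []      = 1#
  b (l ∷ κ) (m ∷ ν) = w l m (hd κ) *R b κ ν

-- Instantiated with s = 1/(1+αx), σ = 1+αx, t = xs, ρ = (1-βx)s and D = 1-xy.
record Parameters {c ℓ} (R : CommutativeRing c ℓ) : Set (c Level.⊔ ℓ) where
  open CommutativeRing R using (Carrier; _≈_; 1#) renaming (_+_ to _+R_; _*_ to _*R_)
  field
    α β y t ρ s σ D : Carrier
    s+αt  : (s +R (α *R t)) ≈ 1#
    ρ+βt  : (ρ +R (β *R t)) ≈ s
    σs    : (σ *R s) ≈ 1#
    Ds+ty : ((D *R s) +R (t *R y)) ≈ s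

-- Geometric series behind the row identities.

module SkewCauchy {c ℓ} (R : CommutativeRing c ℓ) (P : Parameters R) (N : ℕ) where
  open Parameters P
  open Sums R
  open Cubes R N
  p q z : A
  p = α +R y
  q = α +R β
  z = t *R p
  open StripWeight R t ρ
  open SkewWeight R β q p y

  ρ+tq : ρ +R (t *R q) ≈ 1#
  ρ+tq = begin
    ρ +R (t *R (α +R β))         ≈⟨ solve 4 (λ r x a b → r ⊕ (x ⊗ (a ⊕ b)) := (r ⊕ (b ⊗ x)) ⊕ (a ⊗ x)) refl ρ t α β ⟩
    (ρ +R (β *R t)) +R (α *R t)  ≈⟨ +-congʳ ρ+βt ⟩
    s +R (α *R t)                ≈⟨ s+αt ⟩
    1#                           ∎

  1+ty : 1# +R (t *R y) ≈ s +R z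
  1+ty = begin
    1# +R (t *R y)               ≈⟨ +-congʳ s+αt ⟨
    (s +R (α *R t)) +R (t *R y)  ≈⟨ solve 4 (λ s a t y → (s ⊕ (a ⊗ t)) ⊕ (t ⊗ y) := s ⊕ (t ⊗ (a ⊕ y))) refl s α t y ⟩
    s +R z                       ∎

  Ds+z : (D *R s) +R z ≈ 1#
  Ds+z = begin
    (D *R s) +R (t *R (α +R y))            ≈⟨ solve 4 (λ d t a y → d ⊕ (t ⊗ (a ⊕ y)) := (d ⊕ (t ⊗ y)) ⊕ (a ⊗ t)) refl _ t α y ⟩
    ((D *R s) +R (t *R y)) +R (α *R t)     ≈⟨ +-congʳ Ds+ty ⟩
    s +R (α *R t)                          ≈⟨ s+αt ⟩
    1#                                     ∎

  -- Since `ρ` is 1 - tq, the sum is ρ times a geometric series plus the final power of tq, where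
  -- `rp 0` is 1 instead of `ρ`; that last term is exactly the remainder.
  telescope : ∀ c → ∑ (suc c) (λ k → pow (t *R q) k *R rp (c ∸ k)) ≈ 1#
  telescope zero    = trans (+-identityʳ _) (*-identityˡ _)
  telescope (suc c) = begin
    (1# *R ρ) +R ∑ (suc c) (λ k → ((t *R q) *R pow (t *R q) k) *R rp (c ∸ k))
      ≈⟨ +-cong (*-identityˡ ρ) (∑-cong (suc c) (λ k → *-assoc (t *R q) (pow (t *R q) k) (rp (c ∸ k)))) ⟩
    ρ +R ∑ (suc c) (λ k → (t *R q) *R (pow (t *R q) k *R rp (c ∸ k)))
      ≈⟨ +-congˡ (∑-*ˡ (suc c) (t *R q) (λ k → pow (t *R q) k *R rp (c ∸ k))) ⟨
    ρ +R ((t *R q) *R ∑ (suc c) (λ k → pow (t *R q) k *R rp (c ∸ k)))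
      ≈⟨ +-congˡ (trans (*-congˡ (telescope c)) (*-identityʳ _)) ⟩
    ρ +R (t *R q)
      ≈⟨ ρ+tq ⟩
    1# ∎

  geo : ℕ → A
  geo n = ∑ n (pow z)

  geo-suc : ∀ n → geo (suc n) ≈ 1# +R (z *R geo n)
  geo-suc n = +-congˡ (sym (∑-*ˡ n z (pow z)))

  -- The finite geometric series with 1 - z equal to D s. The remainder stays as a summand because 1
  -- - z is not assumed invertible.
  geo-sum : ∀ n → ((D *R s) *R geo n) +R pow z n ≈ 1#
  geo-sum zero    = trans (+-congʳ (zeroʳ _)) (+-identityˡ _)
  geo-sum (suc n) = begin
    ((D *R s) *R geo (suc n)) +R (z *R pow z n)        ≈⟨ +-congʳ (*-congˡ (geo-suc n)) ⟩
    ((D *R s) *R (1# +R (z *R geo n))) +R (z *R pow z n)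
      ≈⟨ solve 4 (λ d z g x → (d ⊗ (con 1 ⊕ (z ⊗ g))) ⊕ (z ⊗ x) := d ⊕ (z ⊗ ((d ⊗ g) ⊕ x))) refl (D *R s) z (geo n) (pow z n) ⟩
    (D *R s) +R (z *R (((D *R s) *R geo n) +R pow z n)) ≈⟨ +-congˡ (trans (*-congˡ (geo-sum n)) (*-identityʳ z)) ⟩
    (D *R s) +R z                                       ≈⟨ Ds+z ⟩
    1#                                                  ∎

  U : ℕ → A
  U n = ∑ (suc n) (λ j → pow t j *R u j)

  U-geo : ∀ n → U n ≈ 1# +R ((t *R y) *R geo n)
  U-geo n = +-cong (*-identityˡ 1#) (trans (∑-cong n step) (sym (∑-*ˡ n (t *R y) (pow z))))
    where
    step : ∀ j → (t *R pow t j) *R (y *R pow p j) ≈ (t *R y) *R pow z j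
    step j = trans (solve 4 (λ t x y w → (t ⊗ x) ⊗ (y ⊗ w) := (t ⊗ y) ⊗ (x ⊗ w)) refl t _ y _)
                   (*-congˡ (sym (pow-* t p j)))

  Q : ℕ → A
  Q n = ∑ (suc n) (λ i → pow z i *R rp (n ∸ i))

  Q-suc : ∀ n → Q (suc n) ≈ ρ +R (z *R Q n)
  Q-suc n = +-cong (*-identityˡ ρ)
    (trans (∑-cong (suc n) (λ k → *-assoc z (pow z k) (rp (n ∸ k)))) (sym (∑-*ˡ (suc n) z (λ i → pow z i *R rp (n ∸ i)))))

  -- Both sides start at s and satisfy X(n+1) = s ρ + z X(n); the left side does so because 1 + ty =
  -- s + z. It is applied when exactly one of the two row sums breaks into a connected and a
  -- disconnected range: that sum gives the left side, the unbroken one gives `Q`.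
  U-Q : ∀ n → (ρ *R U n) +R (β *R (t *R pow z n)) ≈ s *R Q n
  U-Q n = trans (+-congʳ (*-congˡ (U-geo n))) (go n)
    where
    go : ∀ n → (ρ *R (1# +R ((t *R y) *R geo n))) +R (β *R (t *R pow z n)) ≈ s *R Q n
    go zero = begin
      (ρ *R (1# +R ((t *R y) *R 0#))) +R (β *R (t *R 1#))
        ≈⟨ solve 4 (λ r x b t → (r ⊗ (con 1 ⊕ (x ⊗ con 0))) ⊕ (b ⊗ (t ⊗ con 1)) := r ⊕ (b ⊗ t)) refl ρ (t *R y) β t ⟩
      ρ +R (β *R t)  ≈⟨ ρ+βt ⟩
      s              ≈⟨ solve 1 (λ s → s := s ⊗ ((con 1 ⊗ con 1) ⊕ con 0)) refl s ⟩
      s *R Q 0       ∎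
    go (suc n) = begin
      (ρ *R (1# +R ((t *R y) *R geo (suc n)))) +R (β *R (t *R (z *R pow z n)))
        ≈⟨ +-congʳ (*-congˡ (+-congˡ (*-congˡ (geo-suc n)))) ⟩
      (ρ *R (1# +R ((t *R y) *R (1# +R (z *R geo n))))) +R (β *R (t *R (z *R pow z n)))
        ≈⟨ solve 7 (λ r x z g b t w → (r ⊗ (con 1 ⊕ (x ⊗ (con 1 ⊕ (z ⊗ g))))) ⊕ (b ⊗ (t ⊗ (z ⊗ w)))
                      := (r ⊗ (con 1 ⊕ x)) ⊕ (z ⊗ ((r ⊗ (x ⊗ g)) ⊕ (b ⊗ (t ⊗ w))))) refl ρ (t *R y) z (geo n) β t (pow z n) ⟩
      (ρ *R (1# +R (t *R y))) +R (z *R ((ρ *R ((t *R y) *R geo n)) +R (β *R (t *R pow z n))))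
        ≈⟨ +-congʳ (*-congˡ 1+ty) ⟩
      (ρ *R (s +R z)) +R (z *R ((ρ *R ((t *R y) *R geo n)) +R (β *R (t *R pow z n))))
        ≈⟨ solve 7 (λ r x z g b v s → (r ⊗ (s ⊕ z)) ⊕ (z ⊗ ((r ⊗ (x ⊗ g)) ⊕ (b ⊗ v)))
                      := (s ⊗ r) ⊕ (z ⊗ ((r ⊗ (con 1 ⊕ (x ⊗ g))) ⊕ (b ⊗ v)))) refl ρ (t *R y) z (geo n) β (t *R pow z n) s ⟩
      (s *R ρ) +R (z *R ((ρ *R (1# +R ((t *R y) *R geo n))) +R (β *R (t *R pow z n))))
        ≈⟨ +-congˡ (*-congˡ (go n)) ⟩
      (s *R ρ) +R (z *R (s *R Q n))
        ≈⟨ solve 4 (λ s r z Q → (s ⊗ r) ⊕ (z ⊗ (s ⊗ Q)) := s ⊗ (r ⊕ (z ⊗ Q))) refl s ρ z (Q n) ⟩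
      s *R (ρ +R (z *R Q n))
        ≈⟨ *-congˡ (Q-suc n) ⟨
      s *R Q (suc n) ∎

-- Exchange of a single row.

module RowIdentity {c ℓ} (R : CommutativeRing c ℓ) (P : Parameters R) (N : ℕ) where
  open Parameters P
  open Sums R
  open SkewCauchy R P N public
  open StripWeight R t ρ public
  open SkewWeight R β q p y public

  -- With m = μ_i, n = ν_i and l = λ_i, this is the part of the row weight that depends on λ_i. If m
  -- ≤ n the row ends its component, since λ_{i+1} ≤ m; otherwise only the cells beyond column m
  -- count here, and each opens a new column of weight `p`.
  v : ℕ → ℕ → ℕ → A
  v m n l = if does (m ≤? n) then u (l ∸ n) else pow p (l ∸ m)

  -- Whenever l' ≤ m ≤ l, row l n l' = v m n l * zz m n l': once μ is given, the weight of a row of λ/ν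
  -- no longer couples λ_i and λ_{i+1}.
  zz : ℕ → ℕ → ℕ → A
  zz m n l = if does (m ≤? n) then 1# else row m n l

  -- For a part k of λ, `upper` collects the factors coming from the row above it, with the parts of
  -- μ and ν there, and `lower` those coming from its own row. `Lsum` therefore sums over one part
  -- of λ, squeezed between two successive rows.
  upper lower : ℕ → ℕ → ℕ → A
  upper m n k = I (k ≤? m) *R (rp (m ∸ k) *R zz m n k)
  lower m n k = I (m ≤? k) *R (I (n ≤? k) *R (pow t (k ∸ m) *R v m n k))

  Lsum Rsum : ℕ → ℕ → ℕ → ℕ → A
  Lsum m n m' n' = ∑ N (λ k → upper m n k *R lower m' n' k)
  Rsum m n m' n' = ∑ N (λ k → w m k m' *R strip n k n')

  -- The value that D times the sum of `lower m n k` over all k would have without the cutoff N. For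
  -- n < m the sum is the full geometric series in z, and D / (D s) is `σ`; for m ≤ n one gets t^(n
  -- - m) times (D s + ty) / s, and the fraction is 1.
  h : ℕ → ℕ → A
  h m n = if does (m ≤? n) then pow t (n ∸ m) else σ

  if-yes : ∀ {P : Set} {x x' : A} (d : Dec P) → P → (if does d then x else x') ≈ x
  if-yes (yes _) _ = refl
  if-yes (no ¬p) p = ⊥-elim (¬p p)

  if-no : ∀ {P : Set} {x x' : A} (d : Dec P) → ¬ P → (if does d then x else x') ≈ x'
  if-no (yes p) ¬p = ⊥-elim (¬p p)
  if-no (no _)  _  = refl

  reindex : ∀ (f : ℕ → A) {i j} → i ≡ j → f i ≈ f j
  reindex f ≡.refl = refl

  row-low : ∀ {l m l' i} → l' ≤ m → l ≡ m + i → row l m l' ≈ u i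
  row-low {l} {m} {l'} le e = trans (if-yes (l' ≤? m) le) (reindex u (∸-from m e))

  row-high : ∀ {l m l' i d} → l' ≡ m + suc i → l ≡ l' + d → row l m l' ≈ β *R (pow q i *R pow p d)
  row-high {l} {m} {l'} {i} e e' =
    trans (if-no (l' ≤? m) (<⇒≱ m<l'))
      (*-congˡ (*-cong (reindex (pow q) (∸-from (suc m) (≡.trans e (ℕₚ.+-suc m i)))) (reindex (pow p) (∸-from l' e'))))
    where
    m<l' : m < l'
    m<l' = ≤-trans (m≤m+n (suc m) i) (≤-reflexive (≡.trans (≡.sym (ℕₚ.+-suc m i)) (≡.sym e)))

  w-low : ∀ {l m l' i} → l' ≤ m → l ≡ m + i → w l m l' ≈ u i
  w-low {l} {m} {l'} {i} le e = trans (I*-yes (m ≤? l) m≤l) (trans (I*-yes (l' ≤? l) (≤-trans le m≤l)) (row-low le e))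
    where
    m≤l : m ≤ l
    m≤l = ≤-trans (m≤m+n m i) (≤-reflexive (≡.sym e))

  w-high : ∀ {l m l' i d} → l' ≡ m + suc i → l ≡ l' + d → w l m l' ≈ β *R (pow q i *R pow p d)
  w-high {l} {m} {l'} {i} {d} e e' =
    trans (I*-yes (m ≤? l) (≤-trans (≤-trans (m≤m+n m (suc i)) (≤-reflexive (≡.sym e))) l'≤l))
          (trans (I*-yes (l' ≤? l) l'≤l) (row-high e e'))
    where
    l'≤l : l' ≤ l
    l'≤l = ≤-trans (m≤m+n l' d) (≤-reflexive (≡.sym e'))

  strip-eval : ∀ {n k n' i j} → n ≡ k + i → k ≡ n' + j → strip n k n' ≈ pow t i *R rp j
  strip-eval {n} {k} {n'} {i} {j} e e' =
    trans (I*-yes (k ≤? n) (≤-trans (m≤m+n k i) (≤-reflexive (≡.sym e))))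
   (trans (I*-yes (n' ≤? k) (≤-trans (m≤m+n n' j) (≤-reflexive (≡.sym e'))))
          (*-cong (reindex (pow t) (∸-from k e)) (reindex rp (∸-from n' e'))))

  lower-≤ : ∀ {m n k a j} → n ≡ m + a → k ≡ n + j → lower m n k ≈ pow t (a + j) *R u j
  lower-≤ {m} {n} {k} {a} {j} e e' =
    trans (I*-yes (m ≤? k) (≤-trans m≤n n≤k)) (trans (I*-yes (n ≤? k) n≤k)
      (*-cong (reindex (pow t) (∸-from m (≡.trans e' (≡.trans (≡.cong (_+ j) e) (ℕₚ.+-assoc m a j)))))
              (trans (if-yes (m ≤? n) m≤n) (reindex u (∸-from n e')))))
    where
    m≤n : m ≤ n
    m≤n = ≤-trans (m≤m+n m a) (≤-reflexive (≡.sym e))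
    n≤k : n ≤ k
    n≤k = ≤-trans (m≤m+n n j) (≤-reflexive (≡.sym e'))

  lower-> : ∀ {m n k j} → n < m → k ≡ m + j → lower m n k ≈ pow t j *R pow p j
  lower-> {m} {n} {k} {j} lt e' =
    trans (I*-yes (m ≤? k) m≤k) (trans (I*-yes (n ≤? k) (≤-trans (<⇒≤ lt) m≤k))
      (*-cong (reindex (pow t) (∸-from m e')) (trans (if-no (m ≤? n) (<⇒≱ lt)) (reindex (pow p) (∸-from m e')))))
    where
    m≤k : m ≤ k
    m≤k = ≤-trans (m≤m+n m j) (≤-reflexive (≡.sym e'))

  upper-≤ : ∀ {m n k i} → m ≤ n → m ≡ k + i → upper m n k ≈ rp i
  upper-≤ {m} {n} {k} {i} le e =
    trans (I*-yes (k ≤? m) (≤-trans (m≤m+n k i) (≤-reflexive (≡.sym e))))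
          (trans (*-cong (reindex rp (∸-from k e)) (if-yes (m ≤? n) le)) (*-identityʳ _))

  upper-> : ∀ {m n k i} → n < m → m ≡ k + i → upper m n k ≈ rp i *R row m n k
  upper-> {m} {n} {k} {i} lt e =
    trans (I*-yes (k ≤? m) (≤-trans (m≤m+n k i) (≤-reflexive (≡.sym e))))
          (*-cong (reindex rp (∸-from k e)) (if-no (m ≤? n) (<⇒≱ lt)))

  upper-above : ∀ {m n k} → m < k → upper m n k ≈ 0#
  upper-above {m} {n} {k} lt = I*-no (k ≤? m) (<⇒≱ lt)

  lower-below₁ : ∀ {m n k} → k < m → lower m n k ≈ 0#
  lower-below₁ {m} {n} {k} lt = I*-no (m ≤? k) (<⇒≱ lt)

  lower-below₂ : ∀ {m n k} → k < n → lower m n k ≈ 0#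
  lower-below₂ {m} {n} {k} lt = *-zeroʳ (I*-no (n ≤? k) (<⇒≱ lt))

  w-above : ∀ {m k m'} → m < k → w m k m' ≈ 0#
  w-above {m} {k} {m'} lt = I*-no (k ≤? m) (<⇒≱ lt)

  strip-above : ∀ {n k n'} → n < k → strip n k n' ≈ 0#
  strip-above {n} {k} {n'} lt = I*-no (k ≤? n) (<⇒≱ lt)

  strip-below : ∀ {n k n'} → k < n' → strip n k n' ≈ 0#
  strip-below {n} {k} {n'} lt = *-zeroʳ (I*-no (n' ≤? k) (<⇒≱ lt))

  interval : ∀ lo {d hi} {f : ℕ → A} → hi ≡ lo + d → hi < N → (∀ i → i < lo → f i ≈ 0#) →
             (∀ i → hi < i → f i ≈ 0#) → ∑ N f ≈ ∑ (suc d) (λ j → f (lo + j))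
  interval lo {d} ≡.refl hi<N below above =
    ∑-window lo (suc d) (≤-trans (≤-reflexive (ℕₚ.+-suc lo d)) hi<N) below
      (λ i le → above i (≤-trans (≤-reflexive (≡.sym (ℕₚ.+-suc lo d))) le))

  -- Reads an interval from its top end. The distances of k from both ends are handed over as
  -- witnesses, so that summands can be evaluated without computing truncated subtractions.
  interval↓ : ∀ lo {d hi} {f g : ℕ → A} → hi ≡ lo + d → hi < N → (∀ i → i < lo → f i ≈ 0#) →
              (∀ i → hi < i → f i ≈ 0#) → (∀ k i j → hi ≡ k + i → k ≡ lo + j → d ≡ i + j → f k ≈ g i) →
              ∑ N f ≈ ∑ (suc d) g
  interval↓ lo {d} {hi} {f} {g} e hi<N below above step = begin
    ∑ N f                               ≈⟨ interval lo e hi<N below above ⟩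
    ∑ (suc d) (λ j → f (lo + j))        ≈⟨ ∑-reverse d (λ j → f (lo + j)) ⟩
    ∑ (suc d) (λ j → f (lo + (d ∸ j)))  ≈⟨ ∑-cong< (suc d) (λ { i (s≤s i≤d) → step (lo + (d ∸ i)) i (d ∸ i) (eq i i≤d) ≡.refl (≡.sym (m+[n∸m]≡n i≤d)) }) ⟩
    ∑ (suc d) g                         ∎
    where
    eq : ∀ i → i ≤ d → hi ≡ lo + (d ∸ i) + i
    eq i i≤d = ≡.trans e (≡.trans (≡.cong (lo +_) (≡.sym (m∸n+n≡m i≤d))) (≡.sym (ℕₚ.+-assoc lo (d ∸ i) i)))

  h-≤ : ∀ {m n a} → n ≡ m + a → h m n ≈ pow t a
  h-≤ {m} {n} {a} e = trans (if-yes (m ≤? n) (≤-trans (m≤m+n m a) (≤-reflexive (≡.sym e)))) (reindex (pow t) (∸-from m e))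

  h-> : ∀ {m n} → n < m → h m n ≈ σ
  h-> {m} {n} lt = if-no (m ≤? n) (<⇒≱ lt)

  σs* : ∀ x → σ *R (s *R x) ≈ x
  σs* x = trans (sym (*-assoc σ s x)) (trans (*-congʳ σs) (*-identityˡ x))

  disjoint : ∀ {m n m' n'} → m < n' → (h m n *R Lsum m n m' n') ≈ (h m' n' *R Rsum m n m' n')
  disjoint {m} {n} {m'} {n'} lt = trans (*-zeroʳ (∑-zero N (λ k _ → left k))) (sym (*-zeroʳ (∑-zero N (λ k _ → right k))))
    where
    left : ∀ k → upper m n k *R lower m' n' k ≈ 0#
    left k with k ≤? m
    ... | yes k≤m = *-zeroʳ (lower-below₂ {m'} {n'} (≤-trans (s≤s k≤m) lt))
    ... | no  k≰m = *-zeroˡ (upper-above (≰⇒> k≰m))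
    right : ∀ k → w m k m' *R strip n k n' ≈ 0#
    right k with k ≤? m
    ... | yes k≤m = *-zeroʳ (strip-below {n} {k} (≤-trans (s≤s k≤m) lt))
    ... | no  k≰m = *-zeroˡ (w-above {m} {k} {m'} (≰⇒> k≰m))

  -- The order m' ≤ n' ≤ m ≤ n. Both sums run over n' ≤ k ≤ m and are exchanged by the reflection of
  -- this interval: `u` measures the distance from n' on the left and from m on the right. The
  -- leftover powers of t are the two values of `h`.
  case₁ : ∀ {m n m' n' a d c} → n' ≡ m' + a → m ≡ n' + d → n ≡ m + c → m < N →
          (h m n *R Lsum m n m' n') ≈ (h m' n' *R Rsum m n m' n')
  case₁ {m} {n} {m'} {n'} {a} {d} {c} e₁ e₂ e₃ m<N = begin
    h m n *R Lsum m n m' n'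
      ≈⟨ *-cong (h-≤ {m} e₃) (interval n' e₂ m<N (λ i lt → *-zeroʳ (lower-below₂ {m'} lt)) (λ i lt → *-zeroˡ (upper-above lt))) ⟩
    pow t c *R ∑ (suc d) (λ j → upper m n (n' + j) *R lower m' n' (n' + j))
      ≈⟨ *-congˡ (∑-cong< (suc d) (λ { j (s≤s j≤d) → term j j≤d })) ⟩
    pow t c *R ∑ (suc d) (λ j → pow t a *R (pow t j *R (u j *R rp (d ∸ j))))
      ≈⟨ *-congˡ (∑-*ˡ (suc d) (pow t a) F) ⟨
    pow t c *R (pow t a *R ∑ (suc d) F)
      ≈⟨ solve 3 (λ x y z → x ⊗ (y ⊗ z) := y ⊗ (x ⊗ z)) refl _ _ _ ⟩
    pow t a *R (pow t c *R ∑ (suc d) F)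
      ≈⟨ *-congˡ (∑-*ˡ (suc d) (pow t c) F) ⟩
    pow t a *R ∑ (suc d) (λ i → pow t c *R (pow t i *R (u i *R rp (d ∸ i))))
      ≈⟨ *-cong (h-≤ {m'} e₁) (interval↓ n' e₂ m<N (λ i lt → *-zeroʳ (strip-below {n} lt)) (λ i lt → *-zeroˡ (w-above {m} {i} {m'} lt)) rterm) ⟨
    h m' n' *R Rsum m n m' n' ∎
    where
    F : ℕ → A
    F j = pow t j *R (u j *R rp (d ∸ j))
    m≤n : m ≤ n
    m≤n = ≤-trans (m≤m+n m c) (≤-reflexive (≡.sym e₃))
    m'≤n' : m' ≤ n'
    m'≤n' = ≤-trans (m≤m+n m' a) (≤-reflexive (≡.sym e₁))
    term : ∀ j → j ≤ d → upper m n (n' + j) *R lower m' n' (n' + j) ≈ pow t a *R (pow t j *R (u j *R rp (d ∸ j)))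
    term j j≤d = begin
      upper m n (n' + j) *R lower m' n' (n' + j)
        ≈⟨ *-cong (upper-≤ {i = d ∸ j} m≤n (≡.trans e₂ (≡.trans (≡.cong (n' +_) (≡.sym (m+[n∸m]≡n j≤d))) (≡.sym (ℕₚ.+-assoc n' j _)))))
                  (trans (lower-≤ {m'} {n'} {a = a} {j} e₁ ≡.refl) (*-congʳ (pow-+ t a j))) ⟩
      rp (d ∸ j) *R ((pow t a *R pow t j) *R u j)
        ≈⟨ solve 4 (λ r a j u → r ⊗ ((a ⊗ j) ⊗ u) := a ⊗ (j ⊗ (u ⊗ r))) refl _ _ _ _ ⟩
      pow t a *R (pow t j *R (u j *R rp (d ∸ j))) ∎
    rterm : ∀ k i j → m ≡ k + i → k ≡ n' + j → d ≡ i + j →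
            w m k m' *R strip n k n' ≈ pow t c *R (pow t i *R (u i *R rp (d ∸ i)))
    rterm k i j f₁ f₂ f₃ = begin
      w m k m' *R strip n k n'
        ≈⟨ *-cong (w-low {i = i} (≤-trans m'≤n' (≤-trans (m≤m+n n' j) (≤-reflexive (≡.sym f₂)))) f₁)
                  (trans (strip-eval {i = i + c} {j} (≡.trans e₃ (≡.trans (≡.cong (_+ c) f₁) (ℕₚ.+-assoc k i c))) f₂)
                         (*-cong (pow-+ t i c) (reindex rp (≡.sym (∸-from i f₃))))) ⟩
      u i *R ((pow t i *R pow t c) *R rp (d ∸ i))
        ≈⟨ solve 4 (λ u i c r → u ⊗ ((i ⊗ c) ⊗ r) := c ⊗ (i ⊗ (u ⊗ r))) refl _ _ _ _ ⟩
      pow t c *R (pow t i *R (u i *R rp (d ∸ i))) ∎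

chain : ∀ {m n a b} l → m ≡ n + b → n ≡ l + a → m ≡ l + (a + b)
chain {a = a} {b} l e e' = ≡.trans e (≡.trans (≡.cong (_+ b) e') (ℕₚ.+-assoc l a b))

inside : ∀ {n lo a j} → n ≡ lo + a → j ≤ a → n ≡ (lo + j) + (a ∸ j)
inside {n} {lo} {a} {j} e le = ≡.trans e (≡.trans (≡.cong (lo +_) (≡.sym (m+[n∸m]≡n le))) (≡.sym (ℕₚ.+-assoc lo j (a ∸ j))))

beyond : ∀ {n lo a} i → n ≡ lo + a → lo + (suc a + i) ≡ n + suc i
beyond {n} {lo} {a} i e =
  ≡.trans (≡.cong (lo +_) (≡.sym (ℕₚ.+-suc a i))) (≡.trans (≡.sym (ℕₚ.+-assoc lo a (suc i))) (≡.cong (_+ suc i) (≡.sym e)))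

down₁ : ∀ {hi m d i} → hi ≡ m + d → i ≤ d → hi ≡ (hi ∸ i) + i × hi ∸ i ≡ m + (d ∸ i)
down₁ {hi} {m} {d} {i} e le =
  ≡.sym (m∸n+n≡m (≤-trans le (≤-trans (m≤n+m d m) (≤-reflexive (≡.sym e))))) ,
  ≡.trans (≡.cong (_∸ i) e) (ℕₚ.+-∸-assoc m le)

down₂ : ∀ {hi m n b d i} → m ≡ n + suc b → hi ≡ m + d → i ≤ b →
        (hi ∸ (suc d + i) ≡ n + (b ∸ i)) × (m ≡ (hi ∸ (suc d + i)) + suc i) × (hi ≡ (hi ∸ (suc d + i)) + (suc i + d))
down₂ {hi} {m} {n} {b} {d} {i} e e' le = k≡ , m≡ , chain (hi ∸ (suc d + i)) e' m≡
  where
  m≡n : m ≡ (n + (b ∸ i)) + suc i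
  m≡n = ≡.trans e (≡.trans (≡.cong (n +_) (≡.sym (≡.trans (ℕₚ.+-suc (b ∸ i) i) (≡.cong suc (m∸n+n≡m le))))) (≡.sym (ℕₚ.+-assoc n (b ∸ i) (suc i))))
  k≡ : hi ∸ (suc d + i) ≡ n + (b ∸ i)
  k≡ = ≡.trans (≡.cong (_∸ (suc d + i)) (≡.trans (chain (n + (b ∸ i)) e' m≡n) (≡.cong (λ x → n + (b ∸ i) + suc x) (ℕₚ.+-comm i d)))) (m+n∸n≡m (n + (b ∸ i)) (suc d + i))
  m≡ : m ≡ (hi ∸ (suc d + i)) + suc i
  m≡ = ≡.trans m≡n (≡.cong (_+ suc i) (≡.sym k≡))

module RowCases {c ℓ} (R : CommutativeRing c ℓ) (P : Parameters R) (N : ℕ) where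
  open Parameters P
  open Sums R
  open RowIdentity R P N public

  interval⁻ : ∀ lo {d hi} {f : ℕ → A} → hi ≡ lo + d → hi < N → (∀ i → i < lo → f i ≈ 0#) →
              (∀ i → hi < i → f i ≈ 0#) → ∑ N f ≈ ∑ (suc d) (λ i → f (hi ∸ i))
  interval⁻ lo {d} {hi} {f} e hi<N below above = interval↓ lo e hi<N below above
    (λ k i j f₁ _ _ → reindex f (≡.sym (≡.trans (≡.cong (_∸ i) f₁) (m+n∸n≡m k i))))

  <-of : ∀ {m n b} → m ≡ n + suc b → n < m
  <-of {m} {n} {b} e = ≤-trans (m≤m+n (suc n) b) (≤-reflexive (≡.trans (≡.sym (ℕₚ.+-suc n b)) (≡.sym e)))

  ≤-of : ∀ {m n b} → m ≡ n + b → n ≤ m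
  ≤-of {m} {n} {b} e = ≤-trans (m≤m+n n b) (≤-reflexive (≡.sym e))

  pow-split : ∀ x {i b} → i ≤ b → pow x b ≈ pow x i *R pow x (b ∸ i)
  pow-split x {i} {b} le = trans (reindex (pow x) (≡.sym (m+[n∸m]≡n le))) (pow-+ x i (b ∸ i))

  upper-low : ∀ {m n lo a b j} → n ≡ lo + a → m ≡ n + suc b → j ≤ a → upper m n (lo + j) ≈ ρ *R (y *R pow p b)
  upper-low {m} {n} {lo} {a} {b} {j} e e' le =
    trans (upper-> {m} {n} {lo + j} {suc ((a ∸ j) + b)} (<-of e') (≡.trans (chain (lo + j) e' n≡) (≡.cong (lo + j +_) (ℕₚ.+-suc (a ∸ j) b))))
          (*-congˡ (row-low {m} {n} {lo + j} {suc b} (≤-of n≡) e'))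
    where
    n≡ : n ≡ (lo + j) + (a ∸ j)
    n≡ = inside e le

  upper-high : ∀ {m n lo a b i} → n ≡ lo + a → m ≡ n + suc b → i ≤ b →
               upper m n (lo + (suc a + i)) ≈ rp (b ∸ i) *R (β *R (pow q i *R pow p (b ∸ i)))
  upper-high {m} {n} {lo} {a} {b} {i} e e' le =
    trans (upper-> {m} {n} {lo + (suc a + i)} {b ∸ i} (<-of e') m≡)
          (*-congˡ (row-high {m} {n} {lo + (suc a + i)} {i} {b ∸ i} (beyond i e) m≡))
    where
    m≡ : m ≡ lo + (suc a + i) + (b ∸ i)
    m≡ = ≡.trans (inside e' (s≤s le)) (≡.cong (_+ (b ∸ i)) (≡.sym (beyond i e)))

  ∑-pull : ∀ n x {f} (g : ℕ → A) → (∀ i → i < n → f i ≈ x *R g i) → ∑ n f ≈ x *R ∑ n g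
  ∑-pull n x g e = trans (∑-cong< n e) (sym (∑-*ˡ n x g))

  ∑-telescope : ∀ n x {f} → (∀ i → i < suc n → f i ≈ x *R (pow (t *R q) i *R rp (n ∸ i))) → ∑ (suc n) f ≈ x
  ∑-telescope n x e = trans (∑-pull (suc n) x _ e) (trans (*-congˡ (telescope n)) (*-identityʳ x))

  -- The order m' ≤ n' ≤ n < m. The left range from n' to m breaks at n, beyond which row i of λ/ν
  -- is connected to the next one. The disconnected half gives `U`, the connected half telescopes to
  -- one term, and `U-Q` joins them; the resulting s cancels against `h m n`, which is `σ`.
  case₂ : ∀ {m n m' n' e a b} → n' ≡ m' + e → n ≡ n' + a → m ≡ n + suc b → m < N →
          (h m n *R Lsum m n m' n') ≈ (h m' n' *R Rsum m n m' n')
  case₂ {m} {n} {m'} {n'} {e} {a} {b} e₁ e₂ e₃ m<N = begin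
    h m n *R Lsum m n m' n'
      ≈⟨ *-cong (h-> (<-of e₃)) (trans (interval n' {a + suc b} (chain n' e₃ e₂) m<N (λ i lt → *-zeroʳ (lower-below₂ {m'} lt)) (λ i lt → *-zeroˡ (upper-above lt)))
                                (∑-split (suc a) (suc b) F)) ⟩
    σ *R (∑ (suc a) F +R ∑ (suc b) (λ i → F (suc a + i)))
      ≈⟨ *-congˡ (+-cong (∑-pull (suc a) (ρ *R C) (λ j → pow t j *R u j) low) (∑-telescope b (C *R (β *R (t *R pow z a))) high)) ⟩
    σ *R (((ρ *R C) *R U a) +R (C *R (β *R (t *R pow z a))))
      ≈⟨ *-congˡ (solve 4 (λ r c u x → ((r ⊗ c) ⊗ u) ⊕ (c ⊗ x) := c ⊗ ((r ⊗ u) ⊕ x)) refl ρ C (U a) _) ⟩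
    σ *R (C *R ((ρ *R U a) +R (β *R (t *R pow z a))))
      ≈⟨ *-congˡ (*-congˡ (U-Q a)) ⟩
    σ *R (C *R (s *R Q a))
      ≈⟨ solve 4 (λ σ c s q → σ ⊗ (c ⊗ (s ⊗ q)) := σ ⊗ (s ⊗ (c ⊗ q))) refl σ C s (Q a) ⟩
    σ *R (s *R (C *R Q a))
      ≈⟨ σs* _ ⟩
    C *R Q a
      ≈⟨ *-assoc _ _ _ ⟩
    pow t e *R ((y *R pow p b) *R Q a)
      ≈⟨ *-cong (h-≤ {m'} e₁) (trans (interval↓ n' e₂ n<N (λ i lt → *-zeroʳ (strip-below {n} lt)) (λ i lt → *-zeroʳ (strip-above {n} {i} {n'} lt)) rterm)
                                 (sym (∑-*ˡ (suc a) (y *R pow p b) (λ i → pow z i *R rp (a ∸ i))))) ⟨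
    h m' n' *R Rsum m n m' n' ∎
    where
    n<N : n < N
    n<N = ≤-trans (<-of e₃) (<⇒≤ m<N)
    C : A
    C = pow t e *R (y *R pow p b)
    F : ℕ → A
    F j = upper m n (n' + j) *R lower m' n' (n' + j)
    low : ∀ j → j < suc a → F j ≈ (ρ *R C) *R (pow t j *R u j)
    low j (s≤s j≤a) = begin
      F j ≈⟨ *-cong (upper-low {lo = n'} e₂ e₃ j≤a) (trans (lower-≤ {m'} {n'} {a = e} {j} e₁ ≡.refl) (*-congʳ (pow-+ t e j))) ⟩
      (ρ *R (y *R pow p b)) *R ((pow t e *R pow t j) *R u j)
        ≈⟨ solve 5 (λ r k e j u → (r ⊗ k) ⊗ ((e ⊗ j) ⊗ u) := (r ⊗ (e ⊗ k)) ⊗ (j ⊗ u)) refl ρ _ _ _ _ ⟩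
      (ρ *R C) *R (pow t j *R u j) ∎
    high : ∀ i → i < suc b → F (suc a + i) ≈ (C *R (β *R (t *R pow z a))) *R (pow (t *R q) i *R rp (b ∸ i))
    high i (s≤s i≤b) = begin
      F (suc a + i)
        ≈⟨ *-cong (upper-high {lo = n'} e₂ e₃ i≤b) (trans (lower-≤ {m'} {n'} {a = e} {suc a + i} e₁ ≡.refl)
             (*-cong (trans (pow-+ t e (suc a + i)) (*-congˡ (pow-+ t (suc a) i))) (*-congˡ (pow-+ p a i)))) ⟩
      (rp (b ∸ i) *R (β *R (pow q i *R pow p (b ∸ i)))) *R ((pow t e *R ((t *R pow t a) *R pow t i)) *R (y *R (pow p a *R pow p i)))
        ≈⟨ solve 11 (λ r β qi pb te t ta ti y pa pi → (r ⊗ (β ⊗ (qi ⊗ pb))) ⊗ ((te ⊗ ((t ⊗ ta) ⊗ ti)) ⊗ (y ⊗ (pa ⊗ pi)))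
              := ((te ⊗ (y ⊗ (pi ⊗ pb))) ⊗ (β ⊗ (t ⊗ (ta ⊗ pa)))) ⊗ ((ti ⊗ qi) ⊗ r)) refl (rp (b ∸ i)) β (pow q i) (pow p (b ∸ i)) (pow t e) t (pow t a) (pow t i) y (pow p a) (pow p i) ⟩
      ((pow t e *R (y *R (pow p i *R pow p (b ∸ i)))) *R (β *R (t *R (pow t a *R pow p a)))) *R ((pow t i *R pow q i) *R rp (b ∸ i))
        ≈⟨ *-cong (*-cong (*-congˡ (*-congˡ (pow-split p i≤b))) (*-congˡ (*-congˡ (pow-* t p a)))) (*-congʳ (pow-* t q i)) ⟨
      (C *R (β *R (t *R pow z a))) *R (pow (t *R q) i *R rp (b ∸ i)) ∎
    rterm : ∀ k i j → n ≡ k + i → k ≡ n' + j → a ≡ i + j →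
            w m k m' *R strip n k n' ≈ (y *R pow p b) *R (pow z i *R rp (a ∸ i))
    rterm k i j f₁ f₂ f₃ = begin
      w m k m' *R strip n k n'
        ≈⟨ *-cong (trans (w-low {l' = m'} {suc (i + b)} (≤-trans (≤-of e₁) (≤-of f₂)) (≡.trans (chain k e₃ f₁) (≡.cong (k +_) (ℕₚ.+-suc i b)))) (*-congˡ (pow-+ p i b)))
                  (trans (strip-eval {i = i} {j} f₁ f₂) (*-congˡ (reindex rp (≡.sym (∸-from i f₃))))) ⟩
      (y *R (pow p i *R pow p b)) *R (pow t i *R rp (a ∸ i))
        ≈⟨ solve 5 (λ y pi pb ti r → (y ⊗ (pi ⊗ pb)) ⊗ (ti ⊗ r) := (y ⊗ pb) ⊗ ((ti ⊗ pi) ⊗ r)) refl _ _ _ _ _ ⟩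
      (y *R pow p b) *R ((pow t i *R pow p i) *R rp (a ∸ i))
        ≈⟨ *-congˡ (*-congʳ (pow-* t p i)) ⟨
      (y *R pow p b) *R (pow z i *R rp (a ∸ i)) ∎

  -- The mirror image of `case₂`, for n' < m' ≤ m ≤ n: now the right range, from n' to m, breaks at
  -- m', below which the row of μ/κ is connected to the next one. Reading it from the top puts the
  -- disconnected half first.
  case₃ : ∀ {m n m' n' b d c} → m' ≡ n' + suc b → m ≡ m' + d → n ≡ m + c → m < N →
          (h m n *R Lsum m n m' n') ≈ (h m' n' *R Rsum m n m' n')
  case₃ {m} {n} {m'} {n'} {b} {d} {c} e₁ e₂ e₃ m<N = sym (begin
    h m' n' *R Rsum m n m' n'
      ≈⟨ *-cong (h-> (<-of e₁)) (trans (interval⁻ n' {suc b + d} (chain n' e₂ e₁) m<N (λ i lt → *-zeroʳ (strip-below {n} lt)) (λ i lt → *-zeroˡ (w-above {m} {i} {m'} lt)))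
           (trans (reindex (λ x → ∑ (suc x) F) (ℕₚ.+-comm (suc b) d)) (∑-split (suc d) (suc b) F))) ⟩
    σ *R (∑ (suc d) F +R ∑ (suc b) (λ i → F (suc d + i)))
      ≈⟨ *-congˡ (+-cong (∑-pull (suc d) (ρ *R pow t c) (λ j → pow t j *R u j) low) (∑-telescope b (pow t c *R (β *R (t *R pow z d))) high)) ⟩
    σ *R (((ρ *R pow t c) *R U d) +R (pow t c *R (β *R (t *R pow z d))))
      ≈⟨ *-congˡ (solve 4 (λ r c u x → ((r ⊗ c) ⊗ u) ⊕ (c ⊗ x) := c ⊗ ((r ⊗ u) ⊕ x)) refl ρ (pow t c) (U d) _) ⟩
    σ *R (pow t c *R ((ρ *R U d) +R (β *R (t *R pow z d))))
      ≈⟨ *-congˡ (*-congˡ (U-Q d)) ⟩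
    σ *R (pow t c *R (s *R Q d))
      ≈⟨ solve 4 (λ σ c s q → σ ⊗ (c ⊗ (s ⊗ q)) := σ ⊗ (s ⊗ (c ⊗ q))) refl σ (pow t c) s (Q d) ⟩
    σ *R (s *R (pow t c *R Q d))
      ≈⟨ σs* _ ⟩
    pow t c *R Q d
      ≈⟨ *-cong (h-≤ {m} e₃) (trans (interval m' e₂ m<N (λ i lt → *-zeroʳ (lower-below₁ lt)) (λ i lt → *-zeroˡ (upper-above lt)))
                                (∑-cong< (suc d) lterm)) ⟨
    h m n *R Lsum m n m' n' ∎)
    where
    F : ℕ → A
    F i = w m (m ∸ i) m' *R strip n (m ∸ i) n'
    low : ∀ i → i < suc d → F i ≈ (ρ *R pow t c) *R (pow t i *R u i)
    low i (s≤s i≤d) with down₁ e₂ i≤d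
    ... | f₁ , f₂ = begin
      F i ≈⟨ *-cong (w-low {l' = m'} {i} (≤-of f₂) f₁)
                    (trans (strip-eval {n' = n'} {i + c} {suc b + (d ∸ i)} (chain (m ∸ i) e₃ f₁) (chain n' f₂ e₁)) (*-congʳ (pow-+ t i c))) ⟩
      u i *R ((pow t i *R pow t c) *R ρ)
        ≈⟨ solve 4 (λ u i c r → u ⊗ ((i ⊗ c) ⊗ r) := (r ⊗ c) ⊗ (i ⊗ u)) refl _ _ _ _ ⟩
      (ρ *R pow t c) *R (pow t i *R u i) ∎
    high : ∀ i → i < suc b → F (suc d + i) ≈ (pow t c *R (β *R (t *R pow z d))) *R (pow (t *R q) i *R rp (b ∸ i))
    high i (s≤s i≤b) with down₂ e₁ e₂ i≤b
    ... | f₁ , f₂ , f₃ = begin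
      F (suc d + i)
        ≈⟨ *-cong (w-high {i = i} {d} f₂ e₂) (trans (strip-eval {i = (suc i + d) + c} {b ∸ i} (chain (m ∸ (suc d + i)) e₃ f₃) f₁)
             (*-congʳ (trans (pow-+ t (suc i + d) c) (*-congʳ (pow-+ t (suc i) d))))) ⟩
      (β *R (pow q i *R pow p d)) *R ((((t *R pow t i) *R pow t d) *R pow t c) *R rp (b ∸ i))
        ≈⟨ solve 8 (λ β qi pd t ti td tc r → (β ⊗ (qi ⊗ pd)) ⊗ ((((t ⊗ ti) ⊗ td) ⊗ tc) ⊗ r)
              := (tc ⊗ (β ⊗ (t ⊗ (td ⊗ pd)))) ⊗ ((ti ⊗ qi) ⊗ r)) refl β (pow q i) (pow p d) t (pow t i) (pow t d) (pow t c) (rp (b ∸ i)) ⟩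
      (pow t c *R (β *R (t *R (pow t d *R pow p d)))) *R ((pow t i *R pow q i) *R rp (b ∸ i))
        ≈⟨ *-cong (*-congˡ (*-congˡ (*-congˡ (pow-* t p d)))) (*-congʳ (pow-* t q i)) ⟨
      (pow t c *R (β *R (t *R pow z d))) *R (pow (t *R q) i *R rp (b ∸ i)) ∎
    lterm : ∀ j → j < suc d → upper m n (m' + j) *R lower m' n' (m' + j) ≈ pow z j *R rp (d ∸ j)
    lterm j (s≤s j≤d) = begin
      upper m n (m' + j) *R lower m' n' (m' + j)
        ≈⟨ *-cong (upper-≤ {i = d ∸ j} (≤-of e₃) (inside e₂ j≤d)) (lower-> {m'} {n'} {j = j} (<-of e₁) ≡.refl) ⟩
      rp (d ∸ j) *R (pow t j *R pow p j)   ≈⟨ *-comm _ _ ⟩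
      (pow t j *R pow p j) *R rp (d ∸ j)   ≈⟨ *-congʳ (pow-* t p j) ⟨
      pow z j *R rp (d ∸ j) ∎

  -- The order n' < m' ≤ n < m, where both ranges break. The disconnected halves run over m' ≤ k ≤ n
  -- on both sides and agree after reflecting this interval; the connected halves have different
  -- lengths but telescope to the same value. Both values of `h` are `σ`.
  case₄ : ∀ {m n m' n' c a b} → m' ≡ n' + suc c → n ≡ m' + a → m ≡ n + suc b → m < N →
          (h m n *R Lsum m n m' n') ≈ (h m' n' *R Rsum m n m' n')
  case₄ {m} {n} {m'} {n'} {c} {a} {b} e₁ e₂ e₃ m<N = *-cong (trans (h-> (<-of e₃)) (sym (h-> (<-of e₁)))) (begin
    Lsum m n m' n'
      ≈⟨ trans (interval m' {a + suc b} (chain m' e₃ e₂) m<N (λ i lt → *-zeroʳ (lower-below₁ lt)) (λ i lt → *-zeroˡ (upper-above lt))) (∑-split (suc a) (suc b) F) ⟩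
    ∑ (suc a) F +R ∑ (suc b) (λ i → F (suc a + i))
      ≈⟨ +-cong (∑-cong< (suc a) low) (∑-telescope b K high) ⟩
    ∑ (suc a) E +R K
      ≈⟨ +-cong (∑-cong< (suc a) low′) (∑-telescope c K high′) ⟨
    ∑ (suc a) G +R ∑ (suc c) (λ i → G (suc a + i))
      ≈⟨ trans (interval⁻ n' {suc c + a} (chain n' e₂ e₁) (≤-trans (<-of e₃) (<⇒≤ m<N)) (λ i lt → *-zeroʳ (strip-below {n} lt)) (λ i lt → *-zeroʳ (strip-above {n} {i} {n'} lt)))
           (trans (reindex (λ x → ∑ (suc x) G) (ℕₚ.+-comm (suc c) a)) (∑-split (suc a) (suc c) G)) ⟨
    Rsum m n m' n' ∎)
    where
    F G E : ℕ → A
    F j = upper m n (m' + j) *R lower m' n' (m' + j)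
    G i = w m (n ∸ i) m' *R strip n (n ∸ i) n'
    E j = (ρ *R (y *R pow p b)) *R (pow t j *R pow p j)
    -- The summand next to the breakpoint, at k = n + 1 on the left and k = m' - 1 on the right,
    -- stripped of its factor `rp`.
    K : A
    K = β *R ((t *R pow t a) *R pow p (a + suc b))
    low : ∀ j → j < suc a → F j ≈ E j
    low j (s≤s j≤a) = *-cong (upper-low {lo = m'} e₂ e₃ j≤a) (lower-> {m'} {n'} {j = j} (<-of e₁) ≡.refl)
    high : ∀ i → i < suc b → F (suc a + i) ≈ K *R (pow (t *R q) i *R rp (b ∸ i))
    high i (s≤s i≤b) = begin
      F (suc a + i)
        ≈⟨ *-cong (upper-high {lo = m'} e₂ e₃ i≤b) (trans (lower-> {m'} {n'} {j = suc a + i} (<-of e₁) ≡.refl)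
             (*-cong (pow-+ t (suc a) i) (*-congˡ (pow-+ p a i)))) ⟩
      (rp (b ∸ i) *R (β *R (pow q i *R pow p (b ∸ i)))) *R (((t *R pow t a) *R pow t i) *R (p *R (pow p a *R pow p i)))
        ≈⟨ solve 9 (λ r β qi pb ta ti p pa pi → (r ⊗ (β ⊗ (qi ⊗ pb))) ⊗ ((ta ⊗ ti) ⊗ (p ⊗ (pa ⊗ pi)))
              := (β ⊗ (ta ⊗ (pa ⊗ (p ⊗ (pi ⊗ pb))))) ⊗ ((ti ⊗ qi) ⊗ r)) refl (rp (b ∸ i)) β (pow q i) (pow p (b ∸ i)) (t *R pow t a) (pow t i) p (pow p a) (pow p i) ⟩
      (β *R ((t *R pow t a) *R (pow p a *R (p *R (pow p i *R pow p (b ∸ i)))))) *R ((pow t i *R pow q i) *R rp (b ∸ i))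
        ≈⟨ *-cong (*-congˡ (*-congˡ (trans (pow-+ p a (suc b)) (*-congˡ (*-congˡ (pow-split p i≤b)))))) (*-congʳ (pow-* t q i)) ⟨
      K *R (pow (t *R q) i *R rp (b ∸ i)) ∎
    low′ : ∀ i → i < suc a → G i ≈ E i
    low′ i (s≤s i≤a) with down₁ e₂ i≤a
    ... | f₁ , f₂ = begin
      G i ≈⟨ *-cong (trans (w-low {l' = m'} {suc (i + b)} (≤-of f₂) (≡.trans (chain (n ∸ i) e₃ f₁) (≡.cong (n ∸ i +_) (ℕₚ.+-suc i b)))) (*-congˡ (pow-+ p i b)))
                    (strip-eval {n' = n'} {i} {suc c + (a ∸ i)} f₁ (chain n' f₂ e₁)) ⟩
      (y *R (pow p i *R pow p b)) *R (pow t i *R ρ)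
        ≈⟨ solve 5 (λ y pi pb ti r → (y ⊗ (pi ⊗ pb)) ⊗ (ti ⊗ r) := (r ⊗ (y ⊗ pb)) ⊗ (ti ⊗ pi)) refl _ _ _ _ _ ⟩
      E i ∎
    high′ : ∀ i → i < suc c → G (suc a + i) ≈ K *R (pow (t *R q) i *R rp (c ∸ i))
    high′ i (s≤s i≤c) with down₂ e₁ e₂ i≤c
    ... | f₁ , f₂ , f₃ = begin
      G (suc a + i)
        ≈⟨ *-cong (w-high {i = i} {a + suc b} f₂ (chain m' e₃ e₂)) (trans (strip-eval {i = suc i + a} {c ∸ i} f₃ f₁) (*-congʳ (pow-+ t (suc i) a))) ⟩
      (β *R (pow q i *R pow p (a + suc b))) *R (((t *R pow t i) *R pow t a) *R rp (c ∸ i))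
        ≈⟨ solve 7 (λ β qi pa t ti ta r → (β ⊗ (qi ⊗ pa)) ⊗ (((t ⊗ ti) ⊗ ta) ⊗ r) := (β ⊗ ((t ⊗ ta) ⊗ pa)) ⊗ ((ti ⊗ qi) ⊗ r)) refl β (pow q i) (pow p (a + suc b)) t (pow t i) (pow t a) (rp (c ∸ i)) ⟩
      K *R ((pow t i *R pow q i) *R rp (c ∸ i))
        ≈⟨ *-congˡ (*-congʳ (pow-* t q i)) ⟨
      K *R (pow (t *R q) i *R rp (c ∸ i)) ∎

  -- The order n' ≤ n < m' ≤ m. On both sides every k makes the row connected to the next one, so
  -- both sums telescope, to the same value, although their ranges are disjoint.
  case₅ : ∀ {m n m' n' a e d} → n ≡ n' + a → m' ≡ n + suc e → m ≡ m' + d → m < N →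
          (h m n *R Lsum m n m' n') ≈ (h m' n' *R Rsum m n m' n')
  case₅ {m} {n} {m'} {n'} {a} {e} {d} e₁ e₂ e₃ m<N = *-cong (trans (h-> n<m) (sym (h-> n'<m'))) (begin
    Lsum m n m' n'
      ≈⟨ interval m' e₃ m<N (λ i lt → *-zeroʳ (lower-below₁ lt)) (λ i lt → *-zeroˡ (upper-above lt)) ⟩
    ∑ (suc d) (λ j → upper m n (m' + j) *R lower m' n' (m' + j))
      ≈⟨ ∑-telescope d K lterm ⟩
    K
      ≈⟨ ∑-telescope a K (λ i _ → refl) ⟨
    ∑ (suc a) (λ i → K *R (pow (t *R q) i *R rp (a ∸ i)))
      ≈⟨ interval↓ n' e₁ (≤-trans n<m (<⇒≤ m<N)) (λ i lt → *-zeroʳ (strip-below {n} lt)) (λ i lt → *-zeroʳ (strip-above {n} {i} {n'} lt)) rterm ⟨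
    Rsum m n m' n' ∎)
    where
    n<m : n < m
    n<m = ≤-trans (<-of e₂) (≤-of e₃)
    n'<m' : n' < m'
    n'<m' = ≤-trans (s≤s (≤-of e₁)) (<-of e₂)
    K : A
    K = β *R (pow q e *R pow p d)
    lterm : ∀ j → j < suc d → upper m n (m' + j) *R lower m' n' (m' + j) ≈ K *R (pow (t *R q) j *R rp (d ∸ j))
    lterm j (s≤s j≤d) = begin
      upper m n (m' + j) *R lower m' n' (m' + j)
        ≈⟨ *-cong (trans (upper-> {i = d ∸ j} n<m m≡) (*-congˡ (trans (row-high {m} {n} {m' + j} {e + j} {d ∸ j} (≡.trans (≡.cong (_+ j) e₂) (ℕₚ.+-assoc n (suc e) j)) m≡)
                     (*-congˡ (*-congʳ (pow-+ q e j)))))) (lower-> {m'} {n'} {j = j} n'<m' ≡.refl) ⟩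
      (rp (d ∸ j) *R (β *R ((pow q e *R pow q j) *R pow p (d ∸ j)))) *R (pow t j *R pow p j)
        ≈⟨ solve 7 (λ r β qe qj pd tj pj → (r ⊗ (β ⊗ ((qe ⊗ qj) ⊗ pd))) ⊗ (tj ⊗ pj) := (β ⊗ (qe ⊗ (pj ⊗ pd))) ⊗ ((tj ⊗ qj) ⊗ r)) refl (rp (d ∸ j)) β (pow q e) (pow q j) (pow p (d ∸ j)) (pow t j) (pow p j) ⟩
      (β *R (pow q e *R (pow p j *R pow p (d ∸ j)))) *R ((pow t j *R pow q j) *R rp (d ∸ j))
        ≈⟨ *-cong (*-congˡ (*-congˡ (pow-split p j≤d))) (*-congʳ (pow-* t q j)) ⟨
      K *R (pow (t *R q) j *R rp (d ∸ j)) ∎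
      where
      m≡ : m ≡ m' + j + (d ∸ j)
      m≡ = inside e₃ j≤d
    rterm : ∀ k i j → n ≡ k + i → k ≡ n' + j → a ≡ i + j → w m k m' *R strip n k n' ≈ K *R (pow (t *R q) i *R rp (a ∸ i))
    rterm k i j f₁ f₂ f₃ = begin
      w m k m' *R strip n k n'
        ≈⟨ *-cong (trans (w-high {i = i + e} {d} (≡.trans (chain k e₂ f₁) (≡.cong (k +_) (ℕₚ.+-suc i e))) e₃) (*-congˡ (*-congʳ (pow-+ q i e))))
                  (trans (strip-eval {i = i} {j} f₁ f₂) (*-congˡ (reindex rp (≡.sym (∸-from i f₃))))) ⟩
      (β *R ((pow q i *R pow q e) *R pow p d)) *R (pow t i *R rp (a ∸ i))
        ≈⟨ solve 6 (λ β qi qe pd ti r → (β ⊗ ((qi ⊗ qe) ⊗ pd)) ⊗ (ti ⊗ r) := (β ⊗ (qe ⊗ pd)) ⊗ ((ti ⊗ qi) ⊗ r)) refl β (pow q i) (pow q e) (pow p d) (pow t i) (rp (a ∸ i)) ⟩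
      K *R ((pow t i *R pow q i) *R rp (a ∸ i))
        ≈⟨ *-congˡ (*-congʳ (pow-* t q i)) ⟨
      K *R (pow (t *R q) i *R rp (a ∸ i)) ∎

  -- If m < n' both sums are empty. Otherwise the shape of the two sums is decided by comparing m
  -- with n and m' with n', and, when both comparisons fail, also m' with n.
  row-exchange : ∀ {m n m' n'} → m' ≤ m → n' ≤ n → m < N → (h m n *R Lsum m n m' n') ≈ (h m' n' *R Rsum m n m' n')
  row-exchange {m} {n} {m'} {n'} m'≤m n'≤n m<N with n' ≤? m | m ≤? n | m' ≤? n'
  ... | no n'≰m  | _       | _         = disjoint {m} {n} {m'} {n'} (≰⇒> n'≰m)
  ... | yes n'≤m | yes m≤n | yes m'≤n' = case₁ {m} {n} {m'} {n'} (proj₂ (split≤ m'≤n')) (proj₂ (split≤ n'≤m)) (proj₂ (split≤ m≤n)) m<N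
  ... | yes n'≤m | no m≰n  | yes m'≤n' = case₂ {m} {n} {m'} {n'} (proj₂ (split≤ m'≤n')) (proj₂ (split≤ n'≤n)) (proj₂ (split< (≰⇒> m≰n))) m<N
  ... | yes n'≤m | yes m≤n | no m'≰n'  = case₃ {m} {n} {m'} {n'} (proj₂ (split< (≰⇒> m'≰n'))) (proj₂ (split≤ m'≤m)) (proj₂ (split≤ m≤n)) m<N
  ... | yes n'≤m | no m≰n  | no m'≰n' with m' ≤? n
  ... | yes m'≤n = case₄ {m} {n} {m'} {n'} (proj₂ (split< (≰⇒> m'≰n'))) (proj₂ (split≤ m'≤n)) (proj₂ (split< (≰⇒> m≰n))) m<N
  ... | no m'≰n  = case₅ {m} {n} {m'} {n'} (proj₂ (split≤ n'≤n)) (proj₂ (split< (≰⇒> m'≰n))) (proj₂ (split≤ m'≤m)) m<N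

-- The skew Cauchy identity with a truncated first row.

module SkewCauchyIdentity {c ℓ} (R : CommutativeRing c ℓ) (P : Parameters R) (N : ℕ) where
  open Parameters P
  open Sums R
  open Cubes R N
  open RowCases R P N

  -- If n < m, cut the row at column m. As l' ≤ m, the cells from m to l contribute l - m new
  -- columns and neither a component nor an overlap, that is a factor `p` each, whether or not the
  -- row is connected below.
  decouple : ∀ {l m n l'} → m ≤ l → l' ≤ m → n ≤ l → row l n l' ≈ v m n l *R zz m n l'
  decouple {l} {m} {n} {l'} m≤l l'≤m n≤l with m ≤? n | l' ≤? n
  ... | yes m≤n | _ = begin
    row l n l'             ≈⟨ if-yes (l' ≤? n) (≤-trans l'≤m m≤n) ⟩
    u (l ∸ n)              ≈⟨ *-identityʳ _ ⟨
    u (l ∸ n) *R 1#        ≈⟨ *-cong (if-yes (m ≤? n) m≤n) (if-yes (m ≤? n) m≤n) ⟨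
    v m n l *R zz m n l'   ∎
  ... | no m≰n | yes l'≤n with split< (≰⇒> m≰n) | split≤ m≤l
  ...   | b , e | d , e' = begin
    row l n l'                         ≈⟨ row-low {i = suc b + d} l'≤n (chain n e' e) ⟩
    y *R pow p (b + d)                 ≈⟨ *-congˡ (pow-+ p b d) ⟩
    y *R (pow p b *R pow p d)          ≈⟨ solve 3 (λ y b d → y ⊗ (b ⊗ d) := d ⊗ (y ⊗ b)) refl y _ _ ⟩
    pow p d *R (y *R pow p b)          ≈⟨ *-cong (trans (if-no (m ≤? n) m≰n) (reindex (pow p) (∸-from m e')))
                                                 (trans (if-no (m ≤? n) m≰n) (row-low {i = suc b} l'≤n e)) ⟨
    v m n l *R zz m n l'               ∎
  decouple {l} {m} {n} {l'} m≤l l'≤m n≤l | no m≰n | no l'≰n with split≤ l'≤m | split≤ m≤l | split< (≰⇒> l'≰n)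
  ...   | b , e | d , e' | i , e'' = begin
    row l n l'                                        ≈⟨ row-high {i = i} {b + d} e'' (chain l' e' e) ⟩
    β *R (pow q i *R pow p (b + d))                   ≈⟨ *-congˡ (*-congˡ (pow-+ p b d)) ⟩
    β *R (pow q i *R (pow p b *R pow p d))            ≈⟨ solve 4 (λ y q b d → y ⊗ (q ⊗ (b ⊗ d)) := d ⊗ (y ⊗ (q ⊗ b))) refl β _ _ _ ⟩
    pow p d *R (β *R (pow q i *R pow p b))            ≈⟨ *-cong (trans (if-no (m ≤? n) m≰n) (reindex (pow p) (∸-from m e')))
                                                                (trans (if-no (m ≤? n) m≰n) (row-high {i = i} {b} e'' e)) ⟨
    v m n l *R zz m n l'                              ∎

  strip-w : ∀ l m n l' → strip l m l' *R w l n l' ≈ lower m n l *R upper m n l'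
  strip-w l m n l' = begin
    (I (m ≤? l) *R (I (l' ≤? m) *R (pow t (l ∸ m) *R rp (m ∸ l')))) *R (I (n ≤? l) *R (I (l' ≤? l) *R row l n l'))
      ≈⟨ solve 7 (λ a b x y c d z → (a ⊗ (b ⊗ (x ⊗ y))) ⊗ (c ⊗ (d ⊗ z)) := (a ⊗ (b ⊗ (c ⊗ (d ⊗ z)))) ⊗ (x ⊗ y)) refl _ _ _ _ _ _ _ ⟩
    (I (m ≤? l) *R (I (l' ≤? m) *R (I (n ≤? l) *R (I (l' ≤? l) *R row l n l')))) *R (pow t (l ∸ m) *R rp (m ∸ l'))
      ≈⟨ *-congʳ key ⟩
    (I (m ≤? l) *R (I (l' ≤? m) *R (I (n ≤? l) *R (v m n l *R zz m n l')))) *R (pow t (l ∸ m) *R rp (m ∸ l'))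
      ≈⟨ solve 7 (λ a b c v z t r → (a ⊗ (b ⊗ (c ⊗ (v ⊗ z)))) ⊗ (t ⊗ r) := (a ⊗ (c ⊗ (t ⊗ v))) ⊗ (b ⊗ (r ⊗ z))) refl _ _ _ _ _ _ _ ⟩
    lower m n l *R upper m n l' ∎
    where
    key : I (m ≤? l) *R (I (l' ≤? m) *R (I (n ≤? l) *R (I (l' ≤? l) *R row l n l'))) ≈
          I (m ≤? l) *R (I (l' ≤? m) *R (I (n ≤? l) *R (v m n l *R zz m n l')))
    key with m ≤? l | l' ≤? m | n ≤? l
    ... | no m≰l  | _        | _       = trans (I*-no (m ≤? l) m≰l) (sym (I*-no (m ≤? l) m≰l))
    ... | yes _   | no l'≰m  | _       = *-congˡ (trans (I*-no (l' ≤? m) l'≰m) (sym (I*-no (l' ≤? m) l'≰m)))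
    ... | yes _   | yes _    | no n≰l  = *-congˡ (*-congˡ (trans (I*-no (n ≤? l) n≰l) (sym (I*-no (n ≤? l) n≰l))))
    ... | yes m≤l | yes l'≤m | yes n≤l = *-congˡ (*-congˡ (*-congˡ (trans (I*-yes (l' ≤? l) (≤-trans l'≤m m≤l)) (decouple m≤l l'≤m n≤l))))

  pow-w : ∀ l n → pow t l *R w l n 0 ≈ lower 0 n l
  pow-w l n = begin
    pow t l *R (I (n ≤? l) *R (1# *R u (l ∸ n)))     ≈⟨ solve 3 (λ t i u → t ⊗ (i ⊗ (con 1 ⊗ u)) := con 1 ⊗ (i ⊗ (t ⊗ u))) refl _ _ _ ⟩
    1# *R (I (n ≤? l) *R (pow t l *R u (l ∸ n)))     ∎

  ∑-cube-product : ∀ n (f : ℕ → A) (F : Vec ℕ n → A) → ∑ N (λ k → cube n (λ κ → f k *R F κ)) ≈ ∑ N f *R cube n F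
  ∑-cube-product n f F = trans (∑-cong N (λ k → sym (cube-*ˡ n (f k) F))) (sym (∑-*ʳ N (cube n F) f))

  -- The sum over the parts of λ below a given row. The factor `upper` is all that this row still
  -- contributes.
  Below : ∀ {n} → ℕ → ℕ → Vec ℕ n → Vec ℕ (suc n) → A
  Below {n} m₀ n₀ μ ν = cube (suc n) (λ κ → upper m₀ n₀ (hd κ) *R (a μ κ *R b κ ν))

  below-step : ∀ {n} m₀ n₀ m n₁ (μ : Vec ℕ n) ν → Below m₀ n₀ (m ∷ μ) (n₁ ∷ ν) ≈ Lsum m₀ n₀ m n₁ *R Below m n₁ μ ν
  below-step {n} m₀ n₀ m n₁ μ ν = trans (∑-cong N (λ l → cube-cong (suc n) (λ κ → term l κ)))
    (∑-cube-product (suc n) (λ l → upper m₀ n₀ l *R lower m n₁ l) (λ κ → upper m n₁ (hd κ) *R (a μ κ *R b κ ν)))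
    where
    term : ∀ l κ → upper m₀ n₀ l *R ((strip l m (hd κ) *R a μ κ) *R (w l n₁ (hd κ) *R b κ ν)) ≈
                   (upper m₀ n₀ l *R lower m n₁ l) *R (upper m n₁ (hd κ) *R (a μ κ *R b κ ν))
    term l κ = begin
      upper m₀ n₀ l *R ((strip l m (hd κ) *R a μ κ) *R (w l n₁ (hd κ) *R b κ ν))
        ≈⟨ solve 5 (λ x s a w b → x ⊗ ((s ⊗ a) ⊗ (w ⊗ b)) := (x ⊗ (s ⊗ w)) ⊗ (a ⊗ b)) refl _ _ _ _ _ ⟩
      (upper m₀ n₀ l *R (strip l m (hd κ) *R w l n₁ (hd κ))) *R (a μ κ *R b κ ν)
        ≈⟨ *-congʳ (*-congˡ (strip-w l m n₁ (hd κ))) ⟩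
      (upper m₀ n₀ l *R (lower m n₁ l *R upper m n₁ (hd κ))) *R (a μ κ *R b κ ν)
        ≈⟨ solve 5 (λ x l u a b → (x ⊗ (l ⊗ u)) ⊗ (a ⊗ b) := (x ⊗ l) ⊗ (u ⊗ (a ⊗ b))) refl _ _ _ _ _ ⟩
      (upper m₀ n₀ l *R lower m n₁ l) *R (upper m n₁ (hd κ) *R (a μ κ *R b κ ν)) ∎

  right-step : ∀ {n} m₀ n₀ (μ : Vec ℕ n) (ν : Vec ℕ (suc n)) →
    cube (suc n) (λ κ → b (m₀ ∷ μ) κ *R a κ (n₀ ∷ ν)) ≈ Rsum m₀ n₀ (hd μ) (hd ν) *R cube n (λ κ → b μ κ *R a κ ν)
  right-step {n} m₀ n₀ μ ν = trans
    (∑-cong N (λ k → cube-cong n (λ κ → solve 4 (λ w b s a → (w ⊗ b) ⊗ (s ⊗ a) := (w ⊗ s) ⊗ (b ⊗ a)) refl _ _ _ _)))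
    (∑-cube-product n (λ k → w m₀ k (hd μ) *R strip n₀ k (hd ν)) (λ κ → b μ κ *R a κ ν))

  -- Each use of `row-exchange` turns one factor `Lsum` into `Rsum` and moves `h` one row down. At
  -- the bottom `h 0 n` is t^n, the weight that `a` gives to the last part of ν.
  exchange : ∀ {n} m₀ n₀ (μ : Vec ℕ n) (ν : Vec ℕ (suc n)) → Decr (m₀ ∷ μ) → Decr (n₀ ∷ ν) → Bounded (m₀ ∷ μ) →
             (h m₀ n₀ *R Below m₀ n₀ μ ν) ≈ cube (suc n) (λ κ → b (m₀ ∷ μ) κ *R a κ (n₀ ∷ ν))
  exchange m₀ n₀ [] (n ∷ []) (m≤ , _) (n≤ , _) (m₀<N , _) = begin
    h m₀ n₀ *R Below m₀ n₀ [] (n ∷ [])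
      ≈⟨ *-congˡ (∑-cong N (λ l → *-congˡ (trans (*-congˡ (*-identityʳ _)) (pow-w l n)))) ⟩
    h m₀ n₀ *R Lsum m₀ n₀ 0 n
      ≈⟨ row-exchange {m₀} {n₀} {0} {n} m≤ n≤ m₀<N ⟩
    h 0 n *R Rsum m₀ n₀ 0 n
      ≈⟨ trans (*-congʳ (sym (*-identityˡ (pow t n)))) (*-comm _ _) ⟩
    Rsum m₀ n₀ 0 n *R (1# *R pow t n)
      ≈⟨ right-step m₀ n₀ [] (n ∷ []) ⟨
    cube 1 (λ κ → b (m₀ ∷ []) κ *R a κ (n₀ ∷ n ∷ [])) ∎
  exchange m₀ n₀ (m ∷ μ) (n ∷ ν) (m≤ , dm) (n≤ , dn) (m₀<N , bm) = begin
    h m₀ n₀ *R Below m₀ n₀ (m ∷ μ) (n ∷ ν)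
      ≈⟨ *-congˡ (below-step m₀ n₀ m n μ ν) ⟩
    h m₀ n₀ *R (Lsum m₀ n₀ m n *R Below m n μ ν)
      ≈⟨ *-assoc _ _ _ ⟨
    (h m₀ n₀ *R Lsum m₀ n₀ m n) *R Below m n μ ν
      ≈⟨ *-congʳ (row-exchange {m₀} {n₀} {m} {n} m≤ n≤ m₀<N) ⟩
    (h m n *R Rsum m₀ n₀ m n) *R Below m n μ ν
      ≈⟨ solve 3 (λ h r b → (h ⊗ r) ⊗ b := r ⊗ (h ⊗ b)) refl _ _ _ ⟩
    Rsum m₀ n₀ m n *R (h m n *R Below m n μ ν)
      ≈⟨ *-congˡ (exchange m n μ ν dm dn bm) ⟩
    Rsum m₀ n₀ m n *R cube _ (λ κ → b (m ∷ μ) κ *R a κ (n ∷ ν))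
      ≈⟨ right-step m₀ n₀ (m ∷ μ) (n ∷ ν) ⟨
    cube _ (λ κ → b (m₀ ∷ m ∷ μ) κ *R a κ (n₀ ∷ n ∷ ν)) ∎

  -- λ₁ is unbounded: cutting it off at N leaves an error divisible by t^(N - μ₁).
  first-row : ∀ {m} n → m < N → ∃ λ J → ((D *R ∑ N (lower m n)) +R (pow t (N ∸ m) *R J)) ≈ h m n
  first-row {m} n m<N with m ≤? n | n <? N
  ... | yes m≤n | no n≮N with split≤ m≤n | split≤ (≮⇒≥ n≮N)
  ...   | a , e | b , e' = pow t b , (begin
    (D *R ∑ N (lower m n)) +R (pow t (N ∸ m) *R pow t b)
      ≈⟨ +-cong (*-zeroʳ (∑-zero N (λ k k<N → lower-below₂ {m} {n} (≤-trans k<N (≮⇒≥ n≮N))))) (sym (pow-+ t (N ∸ m) b)) ⟩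
    0# +R pow t ((N ∸ m) + b)
      ≈⟨ +-identityˡ _ ⟩
    pow t ((N ∸ m) + b)
      ≈⟨ h-≤ {m} (chain m e' (≡.sym (m+[n∸m]≡n (<⇒≤ m<N)))) ⟨
    h m n ∎)
  first-row {m} n m<N | yes m≤n | yes n<N with split≤ m≤n | split< n<N
  ...   | a , e | K , e' = σ *R (y *R pow p K) , (begin
    (D *R ∑ N (lower m n)) +R (pow t (N ∸ m) *R (σ *R (y *R pow p K)))
      ≈⟨ +-cong (*-congˡ (trans (∑-from n e' (λ i lt → lower-below₂ {m} lt))
                  (trans (∑-cong (suc K) (λ j → trans (lower-≤ {m} {n} {a = a} {j} e ≡.refl) (trans (*-congʳ (pow-+ t a j)) (*-assoc _ _ _)))) (sym (∑-*ˡ (suc K) (pow t a) (λ j → pow t j *R u j))))))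
           (*-congʳ (trans (reindex (pow t) (∸-from m (chain m e' e))) (pow-+ t a (suc K)))) ⟩
    (D *R (pow t a *R U K)) +R ((pow t a *R (t *R pow t K)) *R (σ *R (y *R pow p K)))
      ≈⟨ +-congʳ (trans (sym (σs* _)) (*-congˡ (*-congˡ (*-congˡ (*-congˡ (U-geo K)))))) ⟩
    (σ *R (s *R (D *R (pow t a *R (1# +R ((t *R y) *R geo K)))))) +R ((pow t a *R (t *R pow t K)) *R (σ *R (y *R pow p K)))
      ≈⟨ solve 9 (λ σ s D ta t y g tK pK → (σ ⊗ (s ⊗ (D ⊗ (ta ⊗ (con 1 ⊕ ((t ⊗ y) ⊗ g)))))) ⊕ ((ta ⊗ (t ⊗ tK)) ⊗ (σ ⊗ (y ⊗ pK)))
            := (ta ⊗ σ) ⊗ ((D ⊗ s) ⊕ ((t ⊗ y) ⊗ (((D ⊗ s) ⊗ g) ⊕ (tK ⊗ pK))))) refl σ s D (pow t a) t y (geo K) (pow t K) (pow p K) ⟩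
    (pow t a *R σ) *R ((D *R s) +R ((t *R y) *R (((D *R s) *R geo K) +R (pow t K *R pow p K))))
      ≈⟨ *-congˡ (+-congˡ (trans (*-congˡ (trans (+-congˡ (sym (pow-* t p K))) (geo-sum K))) (*-identityʳ _))) ⟩
    (pow t a *R σ) *R ((D *R s) +R (t *R y))
      ≈⟨ *-congˡ Ds+ty ⟩
    (pow t a *R σ) *R s
      ≈⟨ trans (*-assoc _ _ _) (trans (*-congˡ σs) (*-identityʳ _)) ⟩
    pow t a
      ≈⟨ h-≤ {m} e ⟨
    h m n ∎)
  first-row {m} n m<N | no m≰n | _ with split< m<N
  ...   | K , e' = σ *R pow p (suc K) , (begin
    (D *R ∑ N (lower m n)) +R (pow t (N ∸ m) *R (σ *R pow p (suc K)))
      ≈⟨ +-cong (*-congˡ (trans (∑-from m e' (λ i lt → lower-below₁ lt))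
                  (∑-cong (suc K) (λ j → trans (lower-> {m} {n} {j = j} (≰⇒> m≰n) ≡.refl) (sym (pow-* t p j))))))
           (*-congʳ (reindex (pow t) (∸-from m e'))) ⟩
    (D *R geo (suc K)) +R (pow t (suc K) *R (σ *R pow p (suc K)))
      ≈⟨ +-congʳ (sym (σs* _)) ⟩
    (σ *R (s *R (D *R geo (suc K)))) +R (pow t (suc K) *R (σ *R pow p (suc K)))
      ≈⟨ solve 6 (λ σ s D g t p → (σ ⊗ (s ⊗ (D ⊗ g))) ⊕ (t ⊗ (σ ⊗ p)) := σ ⊗ (((D ⊗ s) ⊗ g) ⊕ (t ⊗ p))) refl σ s D (geo (suc K)) (pow t (suc K)) (pow p (suc K)) ⟩
    σ *R (((D *R s) *R geo (suc K)) +R (pow t (suc K) *R pow p (suc K)))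
      ≈⟨ *-congˡ (trans (+-congˡ (sym (pow-* t p (suc K)))) (geo-sum (suc K))) ⟩
    σ *R 1#
      ≈⟨ *-identityʳ σ ⟩
    σ
      ≈⟨ h-> (≰⇒> m≰n) ⟨
    h m n ∎)

  total-step : ∀ {n} m n₁ (μ : Vec ℕ n) ν →
    cube (suc (suc n)) (λ κ → a (m ∷ μ) κ *R b κ (n₁ ∷ ν)) ≈ ∑ N (lower m n₁) *R Below m n₁ μ ν
  total-step {n} m n₁ μ ν = trans (∑-cong N (λ l → cube-cong (suc n) (λ κ → term l κ)))
    (∑-cube-product (suc n) (lower m n₁) (λ κ → upper m n₁ (hd κ) *R (a μ κ *R b κ ν)))
    where
    term : ∀ l κ → (strip l m (hd κ) *R a μ κ) *R (w l n₁ (hd κ) *R b κ ν) ≈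
                   lower m n₁ l *R (upper m n₁ (hd κ) *R (a μ κ *R b κ ν))
    term l κ = begin
      (strip l m (hd κ) *R a μ κ) *R (w l n₁ (hd κ) *R b κ ν)
        ≈⟨ solve 4 (λ s a w b → (s ⊗ a) ⊗ (w ⊗ b) := (s ⊗ w) ⊗ (a ⊗ b)) refl _ _ _ _ ⟩
      (strip l m (hd κ) *R w l n₁ (hd κ)) *R (a μ κ *R b κ ν)
        ≈⟨ *-congʳ (strip-w l m n₁ (hd κ)) ⟩
      (lower m n₁ l *R upper m n₁ (hd κ)) *R (a μ κ *R b κ ν)
        ≈⟨ *-assoc _ _ _ ⟩
      lower m n₁ l *R (upper m n₁ (hd κ) *R (a μ κ *R b κ ν)) ∎

  -- The sum over λ_1 splits off and `first-row` evaluates it, producing the initial `h` together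
  -- with the cutoff error; the other rows follow by `exchange`. For empty μ the initial `h` is
  -- already the final one.
  skew-cauchy : ∀ {n} (μ : Vec ℕ n) (ν : Vec ℕ (suc n)) → Decr μ → Decr ν → Bounded μ → hd μ < N →
    ∃ λ J → ((D *R cube (suc n) (λ κ → a μ κ *R b κ ν)) +R (pow t (N ∸ hd μ) *R J)) ≈ cube n (λ κ → b μ κ *R a κ ν)
  skew-cauchy [] (n ∷ []) _ _ _ 0<N with first-row {0} n 0<N
  ... | J , e = J , (begin
    (D *R ∑ N (λ l → pow t l *R (w l n 0 *R 1#))) +R (pow t N *R J)
      ≈⟨ +-congʳ (*-congˡ (∑-cong N (λ l → trans (*-congˡ (*-identityʳ _)) (pow-w l n)))) ⟩
    (D *R ∑ N (lower 0 n)) +R (pow t N *R J)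
      ≈⟨ e ⟩
    pow t n
      ≈⟨ *-identityˡ _ ⟨
    1# *R pow t n ∎)
  skew-cauchy {suc n'} (m ∷ μ) (n ∷ ν) dm dn bm m<N with first-row {m} n m<N
  ... | J , e = J *R B , (begin
    (D *R cube (suc (suc n')) (λ κ → a (m ∷ μ) κ *R b κ (n ∷ ν))) +R (pow t (N ∸ m) *R (J *R B))
      ≈⟨ +-congʳ (*-congˡ (total-step m n μ ν)) ⟩
    (D *R (∑ N (lower m n) *R B)) +R (pow t (N ∸ m) *R (J *R B))
      ≈⟨ solve 5 (λ d l b t j → (d ⊗ (l ⊗ b)) ⊕ (t ⊗ (j ⊗ b)) := ((d ⊗ l) ⊕ (t ⊗ j)) ⊗ b) refl D (∑ N (lower m n)) B (pow t (N ∸ m)) J ⟩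
    ((D *R ∑ N (lower m n)) +R (pow t (N ∸ m) *R J)) *R B
      ≈⟨ *-congʳ e ⟩
    h m n *R B
      ≈⟨ exchange m n μ ν dm dn bm ⟩
    cube (suc n') (λ κ → b (m ∷ μ) κ *R a κ (n ∷ ν)) ∎)
    where
    B : A
    B = Below m n μ ν

-- The ring of univariate power series.

module PowerSeries {c ℓ} (R : CommutativeRing c ℓ) where
  open Sums R
  open Series R public hiding (Σᴸ; pow)

  _≈ᵘ_ : U → U → Set ℓ
  f ≈ᵘ g = ∀ i → f i ≈ g i

  _+ᵘ_ : U → U → U
  (f +ᵘ g) i = f i +R g i

  ·ᵘ-∑ : ∀ f g j → (f ·ᵘ g) j ≈ ∑ (suc j) (λ i → f i *R g (j ∸ i))
  ·ᵘ-∑ f g j = ∑-upTo (suc j) (λ i → f i *R g (j ∸ i)) id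

  ·ᵘ-zero : ∀ f g → (f ·ᵘ g) 0 ≈ f 0 *R g 0
  ·ᵘ-zero f g = +-identityʳ _

  ·ᵘ-suc : ∀ f g n → (f ·ᵘ g) (suc n) ≈ (f 0 *R g (suc n)) +R ((f ∘ suc) ·ᵘ g) n
  ·ᵘ-suc f g n = trans (·ᵘ-∑ f g (suc n)) (+-congˡ (sym (·ᵘ-∑ (f ∘ suc) g n)))

  ·ᵘ-cong : ∀ {f f' g g'} → f ≈ᵘ f' → g ≈ᵘ g' → (f ·ᵘ g) ≈ᵘ (f' ·ᵘ g')
  ·ᵘ-cong e e' j = Σᴸ-cong (upTo (suc j)) (λ i → *-cong (e i) (e' (j ∸ i)))

  ·ᵘ-scale : ∀ x f g n → ((λ i → x *R f i) ·ᵘ g) n ≈ x *R (f ·ᵘ g) n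
  ·ᵘ-scale x f g n = begin
    ((λ i → x *R f i) ·ᵘ g) n                        ≈⟨ ·ᵘ-∑ _ g n ⟩
    ∑ (suc n) (λ i → (x *R f i) *R g (n ∸ i))        ≈⟨ ∑-cong (suc n) (λ i → *-assoc x (f i) (g (n ∸ i))) ⟩
    ∑ (suc n) (λ i → x *R (f i *R g (n ∸ i)))        ≈⟨ ∑-*ˡ (suc n) x (λ i → f i *R g (n ∸ i)) ⟨
    x *R ∑ (suc n) (λ i → f i *R g (n ∸ i))          ≈⟨ *-congˡ (·ᵘ-∑ f g n) ⟨
    x *R (f ·ᵘ g) n                                  ∎

  ·ᵘ-distribʳ : ∀ g f f' n → ((f +ᵘ f') ·ᵘ g) n ≈ (f ·ᵘ g) n +R (f' ·ᵘ g) n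
  ·ᵘ-distribʳ g f f' n = begin
    ((f +ᵘ f') ·ᵘ g) n                                                                   ≈⟨ ·ᵘ-∑ _ g n ⟩
    ∑ (suc n) (λ i → (f i +R f' i) *R g (n ∸ i))                                         ≈⟨ ∑-cong (suc n) (λ i → distribʳ (g (n ∸ i)) (f i) (f' i)) ⟩
    ∑ (suc n) (λ i → (f i *R g (n ∸ i)) +R (f' i *R g (n ∸ i)))                          ≈⟨ ∑-+ (suc n) (λ i → f i *R g (n ∸ i)) (λ i → f' i *R g (n ∸ i)) ⟩
    ∑ (suc n) (λ i → f i *R g (n ∸ i)) +R ∑ (suc n) (λ i → f' i *R g (n ∸ i))            ≈⟨ +-cong (·ᵘ-∑ f g n) (·ᵘ-∑ f' g n) ⟨
    (f ·ᵘ g) n +R (f' ·ᵘ g) n                                                            ∎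

  -- Mirror of `·ᵘ-suc`. Matching the two recursions proves commutativity by induction on the
  -- degree, with no reversal of a convolution sum.
  ·ᵘ-sucʳ : ∀ f g n → (f ·ᵘ g) (suc n) ≈ (f (suc n) *R g 0) +R (f ·ᵘ (g ∘ suc)) n
  ·ᵘ-sucʳ f g zero = begin
    (f ·ᵘ g) 1                                ≈⟨ ·ᵘ-suc f g 0 ⟩
    (f 0 *R g 1) +R ((f ∘ suc) ·ᵘ g) 0        ≈⟨ +-cong (sym (·ᵘ-zero f (g ∘ suc))) (·ᵘ-zero (f ∘ suc) g) ⟩
    (f ·ᵘ (g ∘ suc)) 0 +R (f 1 *R g 0)        ≈⟨ +-comm _ _ ⟩
    (f 1 *R g 0) +R (f ·ᵘ (g ∘ suc)) 0        ∎
  ·ᵘ-sucʳ f g (suc n) = begin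
    (f ·ᵘ g) (suc (suc n))
      ≈⟨ ·ᵘ-suc f g (suc n) ⟩
    (f 0 *R g (suc (suc n))) +R ((f ∘ suc) ·ᵘ g) (suc n)
      ≈⟨ +-congˡ (·ᵘ-sucʳ (f ∘ suc) g n) ⟩
    (f 0 *R g (suc (suc n))) +R ((f (suc (suc n)) *R g 0) +R ((f ∘ suc) ·ᵘ (g ∘ suc)) n)
      ≈⟨ solve 3 (λ x y z → x ⊕ (y ⊕ z) := y ⊕ (x ⊕ z)) refl _ _ _ ⟩
    (f (suc (suc n)) *R g 0) +R ((f 0 *R g (suc (suc n))) +R ((f ∘ suc) ·ᵘ (g ∘ suc)) n)
      ≈⟨ +-congˡ (·ᵘ-suc f (g ∘ suc) n) ⟨
    (f (suc (suc n)) *R g 0) +R (f ·ᵘ (g ∘ suc)) (suc n) ∎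

  ·ᵘ-comm : ∀ f g → (f ·ᵘ g) ≈ᵘ (g ·ᵘ f)
  ·ᵘ-comm f g zero    = trans (·ᵘ-zero f g) (trans (*-comm _ _) (sym (·ᵘ-zero g f)))
  ·ᵘ-comm f g (suc n) = begin
    (f ·ᵘ g) (suc n)                             ≈⟨ ·ᵘ-suc f g n ⟩
    (f 0 *R g (suc n)) +R ((f ∘ suc) ·ᵘ g) n     ≈⟨ +-cong (*-comm _ _) (·ᵘ-comm (f ∘ suc) g n) ⟩
    (g (suc n) *R f 0) +R (g ·ᵘ (f ∘ suc)) n     ≈⟨ ·ᵘ-sucʳ g f n ⟨
    (g ·ᵘ f) (suc n)                             ∎

  ·ᵘ-assoc : ∀ f g k → ((f ·ᵘ g) ·ᵘ k) ≈ᵘ (f ·ᵘ (g ·ᵘ k))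
  ·ᵘ-assoc f g k zero = begin
    ((f ·ᵘ g) ·ᵘ k) 0          ≈⟨ trans (·ᵘ-zero (f ·ᵘ g) k) (*-congʳ (·ᵘ-zero f g)) ⟩
    (f 0 *R g 0) *R k 0        ≈⟨ *-assoc _ _ _ ⟩
    f 0 *R (g 0 *R k 0)        ≈⟨ trans (·ᵘ-zero f (g ·ᵘ k)) (*-congˡ (·ᵘ-zero g k)) ⟨
    (f ·ᵘ (g ·ᵘ k)) 0          ∎
  ·ᵘ-assoc f g k (suc n) = begin
    ((f ·ᵘ g) ·ᵘ k) (suc n)
      ≈⟨ ·ᵘ-suc (f ·ᵘ g) k n ⟩
    ((f ·ᵘ g) 0 *R k (suc n)) +R (((f ·ᵘ g) ∘ suc) ·ᵘ k) n
      ≈⟨ +-cong (*-congʳ (·ᵘ-zero f g)) (trans (·ᵘ-cong {g = k} (·ᵘ-suc f g) (λ _ → refl) n)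
           (·ᵘ-distribʳ k (λ i → f 0 *R g (suc i)) ((f ∘ suc) ·ᵘ g) n)) ⟩
    ((f 0 *R g 0) *R k (suc n)) +R (((λ i → f 0 *R g (suc i)) ·ᵘ k) n +R (((f ∘ suc) ·ᵘ g) ·ᵘ k) n)
      ≈⟨ +-congˡ (+-cong (·ᵘ-scale (f 0) (g ∘ suc) k n) (·ᵘ-assoc (f ∘ suc) g k n)) ⟩
    ((f 0 *R g 0) *R k (suc n)) +R ((f 0 *R ((g ∘ suc) ·ᵘ k) n) +R ((f ∘ suc) ·ᵘ (g ·ᵘ k)) n)
      ≈⟨ solve 5 (λ a b c d e → ((a ⊗ b) ⊗ c) ⊕ ((a ⊗ d) ⊕ e) := (a ⊗ ((b ⊗ c) ⊕ d)) ⊕ e) refl _ _ _ _ _ ⟩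
    (f 0 *R ((g 0 *R k (suc n)) +R ((g ∘ suc) ·ᵘ k) n)) +R ((f ∘ suc) ·ᵘ (g ·ᵘ k)) n
      ≈⟨ +-congʳ (*-congˡ (·ᵘ-suc g k n)) ⟨
    (f 0 *R (g ·ᵘ k) (suc n)) +R ((f ∘ suc) ·ᵘ (g ·ᵘ k)) n
      ≈⟨ ·ᵘ-suc f (g ·ᵘ k) n ⟨
    (f ·ᵘ (g ·ᵘ k)) (suc n) ∎

  ·ᵘ-zeroˡ : ∀ f g n → (∀ i → i ≤ n → g i ≈ 0#) → (f ·ᵘ g) n ≈ 0#
  ·ᵘ-zeroˡ f g n e = trans (·ᵘ-∑ f g n) (∑-zero (suc n) (λ i _ → *-zeroʳ {f i} (e (n ∸ i) (m∸n≤m n i))))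

  const-· : ∀ x f → (constᵘ x ·ᵘ f) ≈ᵘ (λ i → x *R f i)
  const-· x f zero    = ·ᵘ-zero (constᵘ x) f
  const-· x f (suc n) = trans (·ᵘ-suc (constᵘ x) f n)
    (trans (+-congˡ (trans (·ᵘ-comm (constᵘ x ∘ suc) f n) (·ᵘ-zeroˡ f (constᵘ x ∘ suc) n (λ _ _ → refl)))) (+-identityʳ _))

  ·-const : ∀ f x → (f ·ᵘ constᵘ x) ≈ᵘ (λ i → f i *R x)
  ·-const f x i = trans (·ᵘ-comm f (constᵘ x) i) (trans (const-· x f i) (*-comm _ _))

  lin-·-suc : ∀ a b f n → (linᵘ a b ·ᵘ f) (suc n) ≈ (a *R f (suc n)) +R (b *R f n)
  lin-·-suc a b f n = trans (·ᵘ-suc (linᵘ a b) f n) (+-congˡ (trans (·ᵘ-cong {g = f} eq (λ _ → refl) n) (const-· b f n)))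
    where
    eq : (linᵘ a b ∘ suc) ≈ᵘ constᵘ b
    eq zero    = refl
    eq (suc _) = refl

  X-·-zero : ∀ f → (Xᵘ ·ᵘ f) 0 ≈ 0#
  X-·-zero f = trans (·ᵘ-zero Xᵘ f) (zeroˡ _)

  X-·-suc : ∀ f n → (Xᵘ ·ᵘ f) (suc n) ≈ f n
  X-·-suc f n = trans (lin-·-suc 0# 1# f n) (trans (+-cong (zeroˡ _) (*-identityˡ _)) (+-identityˡ _))

  -- As a ring, series can serve as coefficients again: iterating gives R[[y]][[x]] for the skew
  -- identity, and the induction on the number of variables in `⋆-left-comm`.
  series : CommutativeRing c ℓ
  series = record
    { Carrier = U ; _≈_ = _≈ᵘ_ ; _+_ = _+ᵘ_ ; _*_ = _·ᵘ_ ; -_ = λ f i → -R f i ; 0# = λ _ → 0# ; 1# = constᵘ 1#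
    ; isCommutativeRing = record
      { isRing = record
        { +-isAbelianGroup = record
          { isGroup = record
            { isMonoid = record
              { isSemigroup = record
                { isMagma = record
                  { isEquivalence = record
                    { refl = λ _ → refl ; sym = λ e i → sym (e i) ; trans = λ e e' i → trans (e i) (e' i) }
                  ; ∙-cong = λ e e' i → +-cong (e i) (e' i) }
                ; assoc = λ f g k i → +-assoc (f i) (g i) (k i) }
              ; identity = (λ f i → +-identityˡ (f i)) , (λ f i → +-identityʳ (f i)) }
            ; inverse = (λ f i → -‿inverseˡ (f i)) , (λ f i → -‿inverseʳ (f i))
            ; ⁻¹-cong = λ e i → -‿cong (e i) }
          ; comm = λ f g i → +-comm (f i) (g i) }
        ; *-cong = ·ᵘ-cong
        ; *-assoc = ·ᵘ-assoc
        ; *-identity = (λ f i → trans (const-· 1# f i) (*-identityˡ _)) , (λ f i → trans (·-const f 1# i) (*-identityʳ _))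
        ; distrib = (λ f g k i → trans (·ᵘ-comm f (g +ᵘ k) i) (trans (·ᵘ-distribʳ f g k i) (+-cong (·ᵘ-comm g f i) (·ᵘ-comm k f i))))
                  , ·ᵘ-distribʳ }
      ; *-comm = ·ᵘ-comm } }

  private module 𝕌 = Sums series

  coeff-∑ : ∀ n (f : ℕ → U) i → 𝕌.∑ n f i ≈ ∑ n (λ k → f k i)
  coeff-∑ zero    f i = refl
  coeff-∑ (suc n) f i = +-congˡ (coeff-∑ n (f ∘ suc) i)

  coeff-Σᴸ : ∀ {b} {B : Set b} (xs : List B) (f : B → U) i → 𝕌.Σᴸ (map f xs) i ≈ Σᴸ (map (λ x → f x i) xs)
  coeff-Σᴸ []       f i = refl
  coeff-Σᴸ (x ∷ xs) f i = +-congˡ (coeff-Σᴸ xs f i)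

  coeff-cube : ∀ N n (F : Vec ℕ n → U) i → Cubes.cube series N n F i ≈ Cubes.cube R N n (λ v → F v i)
  coeff-cube N zero    F i = refl
  coeff-cube N (suc n) F i = trans (coeff-∑ N _ i) (∑-cong N (λ k → coeff-cube N n (λ v → F (k ∷ v)) i))

  powᵘ-pow : ∀ f k → powᵘ f k ≈ᵘ 𝕌.pow f k
  powᵘ-pow f zero    = λ _ → refl
  powᵘ-pow f (suc k) = ·ᵘ-cong {f} {f} (λ _ → refl) (powᵘ-pow f k)

  -- Each factor without constant term raises the order by one. This hides the cutoff error in low
  -- degree and bounds the size of the partitions seen by a given monomial.
  order-pow : ∀ f k g → f 0 ≈ 0# → ∀ i → i < k → (𝕌.pow f k ·ᵘ g) i ≈ 0#
  order-pow f k g f0 i i<k = trans (·ᵘ-comm (𝕌.pow f k) g i) (·ᵘ-zeroˡ g (𝕌.pow f k) i (λ j j≤i → low k j (≤-<-trans j≤i i<k)))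
    where
    low : ∀ k j → j < k → 𝕌.pow f k j ≈ 0#
    low (suc k) zero    _         = trans (·ᵘ-zero f (𝕌.pow f k)) (*-zeroˡ f0)
    low (suc k) (suc j) (s≤s j<k) = trans (·ᵘ-suc f (𝕌.pow f k) j)
      (trans (+-cong (*-zeroˡ f0) (·ᵘ-zeroˡ (f ∘ suc) (𝕌.pow f k) j (λ i i≤j → low k i (≤-<-trans i≤j j<k)))) (+-identityˡ _))

-- Ring homomorphisms and transport of the weights.

record Homomorphism {c ℓ} (R S : CommutativeRing c ℓ) : Set (c Level.⊔ ℓ) where
  open CommutativeRing R using () renaming (Carrier to A; _≈_ to _≈₁_; _+_ to _+₁_; _*_ to _*₁_; 0# to 0₁; 1# to 1₁)
  open CommutativeRing S using () renaming (Carrier to B; _≈_ to _≈₂_; _+_ to _+₂_; _*_ to _*₂_; 0# to 0₂; 1# to 1₂)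
  field
    φ      : A → B
    φ-cong : ∀ {x y} → x ≈₁ y → φ x ≈₂ φ y
    φ-+    : ∀ x y → φ (x +₁ y) ≈₂ (φ x +₂ φ y)
    φ-*    : ∀ x y → φ (x *₁ y) ≈₂ (φ x *₂ φ y)
    φ-0    : φ 0₁ ≈₂ 0₂
    φ-1    : φ 1₁ ≈₂ 1₂

module HomLemmas {c ℓ} {R S : CommutativeRing c ℓ} (H : Homomorphism R S) where
  open Homomorphism H
  private
    module R = Sums R
    module S = Sums S
  open S using (_≈_; _*R_; trans; *-cong; *-congʳ; *-congˡ; refl)

  φ-pow : ∀ {x x'} k → φ x ≈ x' → φ (R.pow x k) ≈ S.pow x' k
  φ-pow zero    e = φ-1
  φ-pow (suc k) e = trans (φ-* _ _) (*-cong e (φ-pow k e))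

  φ-I : ∀ {P : Set} (d : Dec P) → φ (R.I d) ≈ S.I d
  φ-I d with does d
  ... | true  = φ-1
  ... | false = φ-0

  φ-*₂ : ∀ {x y x' y'} → φ x ≈ x' → φ y ≈ y' → φ (x R.*R y) ≈ x' *R y'
  φ-*₂ e e' = trans (φ-* _ _) (*-cong e e')

  -- The weights are built from their parameters by ring operations, so a homomorphism only has to
  -- be followed on the parameters.
  φ-a : ∀ {t ρ t' ρ'} → φ t ≈ t' → φ ρ ≈ ρ' → ∀ {n} (μ : Vec ℕ n) κ →
        φ (StripWeight.a R t ρ μ κ) ≈ StripWeight.a S t' ρ' μ κ
  φ-a {t} {ρ} {t'} {ρ'} et eρ = go
    where
    rp : ∀ k → φ (StripWeight.rp R t ρ k) ≈ StripWeight.rp S t' ρ' k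
    rp zero    = φ-1
    rp (suc _) = eρ
    go : ∀ {n} (μ : Vec ℕ n) κ → φ (StripWeight.a R t ρ μ κ) ≈ StripWeight.a S t' ρ' μ κ
    go []      (l ∷ []) = φ-pow l et
    go (m ∷ μ) (l ∷ κ)  = φ-*₂ (φ-*₂ (φ-I (m ≤? l)) (φ-*₂ (φ-I (hd κ ≤? m)) (φ-*₂ (φ-pow (l ∸ m) et) (rp (m ∸ hd κ))))) (go μ κ)

  φ-b : ∀ {β q p y β' q' p' y'} → φ β ≈ β' → φ q ≈ q' → φ p ≈ p' → φ y ≈ y' → ∀ {n} (κ ν : Vec ℕ n) →
        φ (SkewWeight.b R β q p y κ ν) ≈ SkewWeight.b S β' q' p' y' κ ν
  φ-b {β} {q} {p} {y} {β'} {q'} {p'} {y'} eβ eq ep ey = go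
    where
    u : ∀ k → φ (SkewWeight.u R β q p y k) ≈ SkewWeight.u S β' q' p' y' k
    u zero    = φ-1
    u (suc k) = φ-*₂ ey (φ-pow k ep)
    row : ∀ l m l' → φ (SkewWeight.row R β q p y l m l') ≈ SkewWeight.row S β' q' p' y' l m l'
    row l m l' with does (l' ≤? m)
    ... | true  = u (l ∸ m)
    ... | false = φ-*₂ eβ (φ-*₂ (φ-pow (l' ∸ suc m) eq) (φ-pow (l ∸ l') ep))
    go : ∀ {n} (κ ν : Vec ℕ n) → φ (SkewWeight.b R β q p y κ ν) ≈ SkewWeight.b S β' q' p' y' κ ν
    go []      []      = φ-1
    go (l ∷ κ) (m ∷ ν) = φ-*₂ (φ-*₂ (φ-I (m ≤? l)) (φ-*₂ (φ-I (hd κ ≤? l)) (row l m (hd κ)))) (go κ ν)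

module Embeddings {c ℓ} (R : CommutativeRing c ℓ) where
  open Sums R
  open PowerSeries R

  const-hom : Homomorphism R series
  const-hom = record
    { φ = constᵘ
    ; φ-cong = λ { e zero → e ; e (suc _) → refl }
    ; φ-+ = λ { x y zero → refl ; x y (suc _) → sym (+-identityˡ 0#) }
    ; φ-* = λ { x y zero → sym (const-· x (constᵘ y) 0) ; x y (suc i) → sym (trans (const-· x (constᵘ y) (suc i)) (zeroʳ x)) }
    ; φ-0 = λ { zero → refl ; (suc _) → refl }
    ; φ-1 = λ _ → refl }

  private
    module C = Homomorphism const-hom
    module 𝕌 = Sums series
    module 𝕊 = PowerSeries series

  const-∑ : ∀ n (f : ℕ → A) → constᵘ (∑ n f) ≈ᵘ 𝕌.∑ n (constᵘ ∘ f)
  const-∑ zero    f = C.φ-0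
  const-∑ (suc n) f = 𝕌.trans (C.φ-+ (f 0) (∑ n (f ∘ suc))) (𝕌.+-congˡ {constᵘ (f 0)} (const-∑ n (f ∘ suc)))

  -- In R[[y]][[x]], a series in x is embedded by this map and a series in y by const-hom.
  coefficientwise : Homomorphism series 𝕊.series
  coefficientwise = record
    { φ = λ f i → constᵘ (f i)
    ; φ-cong = λ e i → C.φ-cong (e i)
    ; φ-+ = λ f g i → C.φ-+ (f i) (g i)
    ; φ-* = λ f g i → 𝕌.trans (C.φ-cong (·ᵘ-∑ f g i)) (𝕌.trans (const-∑ (suc i) (λ k → f k *R g (i ∸ k)))
              (𝕌.trans (𝕌.∑-cong (suc i) (λ k → C.φ-* (f k) (g (i ∸ k)))) (𝕌.sym (𝕊.·ᵘ-∑ (λ k → constᵘ (f k)) (λ k → constᵘ (g k)) i))))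
    ; φ-0 = λ i → C.φ-0
    ; φ-1 = λ { zero → C.φ-1 ; (suc i) → C.φ-0 } }

-- Coefficients of the skew Cauchy identity.

module SkewCoefficients {c ℓ} (R : CommutativeRing c ℓ) (α β : CommutativeRing.Carrier R) (N : ℕ) where
  open Sums R
  open PowerSeries R
  open Embeddings R
  open Cubes R N
  private
    module 𝕌 = Sums series
    module 𝕊 = PowerSeries series
    module 𝕎 = Sums 𝕊.series
    module X = Homomorphism coefficientwise
    module Y = Homomorphism (Embeddings.const-hom series)
    module C = Homomorphism const-hom

  tᵘ ρᵘ sᵘ : U
  sᵘ = geoᵘ (-R α)
  tᵘ = Xᵘ ·ᵘ sᵘ
  ρᵘ = linᵘ 1# (-R β) ·ᵘ sᵘ

  open StripWeight series tᵘ ρᵘ public using (a)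
  open SkewWeight series (constᵘ β) (constᵘ (α +R β)) (linᵘ α 1#) Xᵘ public using (b)

  neg-cancel : ∀ x z → (-R x *R z) +R (x *R z) ≈ 0#
  neg-cancel x z = trans (sym (distribʳ z (-R x) x)) (*-zeroˡ (-‿inverseˡ x))

  s+αtᵘ : (sᵘ +ᵘ (constᵘ α ·ᵘ tᵘ)) ≈ᵘ constᵘ 1#
  s+αtᵘ zero    = trans (+-congˡ (trans (const-· α tᵘ 0) (*-zeroʳ (X-·-zero sᵘ)))) (+-identityʳ _)
  s+αtᵘ (suc i) = trans (+-congˡ (trans (const-· α tᵘ (suc i)) (*-congˡ (X-·-suc sᵘ i)))) (neg-cancel α (sᵘ i))

  ρ+βtᵘ : (ρᵘ +ᵘ (constᵘ β ·ᵘ tᵘ)) ≈ᵘ sᵘ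
  ρ+βtᵘ zero    = trans (+-cong (trans (·ᵘ-zero (linᵘ 1# (-R β)) sᵘ) (*-identityˡ _)) (trans (const-· β tᵘ 0) (*-zeroʳ (X-·-zero sᵘ)))) (+-identityʳ _)
  ρ+βtᵘ (suc i) = begin
    ρᵘ (suc i) +R (constᵘ β ·ᵘ tᵘ) (suc i)
      ≈⟨ +-cong (lin-·-suc 1# (-R β) sᵘ i) (trans (const-· β tᵘ (suc i)) (*-congˡ (X-·-suc sᵘ i))) ⟩
    ((1# *R sᵘ (suc i)) +R (-R β *R sᵘ i)) +R (β *R sᵘ i)
      ≈⟨ trans (+-assoc _ _ _) (+-cong (*-identityˡ _) (neg-cancel β (sᵘ i))) ⟩
    sᵘ (suc i) +R 0#
      ≈⟨ +-identityʳ _ ⟩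
    sᵘ (suc i) ∎

  σsᵘ : (linᵘ 1# α ·ᵘ sᵘ) ≈ᵘ constᵘ 1#
  σsᵘ zero    = trans (·ᵘ-zero (linᵘ 1# α) sᵘ) (*-identityˡ _)
  σsᵘ (suc i) = trans (lin-·-suc 1# α sᵘ i) (trans (+-congʳ (*-identityˡ _)) (neg-cancel α (sᵘ i)))

  xx yy Dxy : 𝕎.A
  xx  = X.φ Xᵘ
  yy  = Y.φ Xᵘ
  Dxy = 𝕎.1# 𝕎.+R (𝕎.-R (xx 𝕎.*R yy))

  D+xy : (Dxy 𝕎.+R (xx 𝕎.*R yy)) 𝕎.≈ 𝕎.1#
  D+xy = 𝕎.trans (𝕎.+-assoc _ _ _) (𝕎.trans (𝕎.+-congˡ {𝕎.1#} (𝕎.-‿inverseˡ (xx 𝕎.*R yy))) (𝕎.+-identityʳ _))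

  -- The two embeddings agree on scalars. The parameters α and β are placed on the y-side, whereas
  -- the relations involving s, t and ρ are proved for series in x.
  X-const : ∀ x → X.φ (constᵘ x) 𝕎.≈ Y.φ (constᵘ x)
  X-const x zero    = 𝕌.refl
  X-const x (suc i) = C.φ-0

  parameters : Parameters 𝕊.series
  parameters = record
    { α = Y.φ (constᵘ α) ; β = Y.φ (constᵘ β) ; y = yy ; t = X.φ tᵘ ; ρ = X.φ ρᵘ ; s = X.φ sᵘ ; σ = X.φ (linᵘ 1# α) ; D = Dxy
    ; s+αt  = 𝕎.trans (𝕎.+-congˡ {X.φ sᵘ} (𝕎.trans (𝕎.*-congʳ {X.φ tᵘ} (𝕎.sym (X-const α))) (𝕎.sym (X.φ-* (constᵘ α) tᵘ))))
             (𝕎.trans (𝕎.sym (X.φ-+ sᵘ (constᵘ α ·ᵘ tᵘ))) (𝕎.trans (X.φ-cong s+αtᵘ) X.φ-1))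
    ; ρ+βt  = 𝕎.trans (𝕎.+-congˡ {X.φ ρᵘ} (𝕎.trans (𝕎.*-congʳ {X.φ tᵘ} (𝕎.sym (X-const β))) (𝕎.sym (X.φ-* (constᵘ β) tᵘ))))
             (𝕎.trans (𝕎.sym (X.φ-+ ρᵘ (constᵘ β ·ᵘ tᵘ))) (X.φ-cong ρ+βtᵘ))
    ; σs    = 𝕎.trans (𝕎.sym (X.φ-* (linᵘ 1# α) sᵘ)) (𝕎.trans (X.φ-cong σsᵘ) X.φ-1)
    ; Ds+ty = D-eq }
    where
    D-eq : ((Dxy 𝕎.*R X.φ sᵘ) 𝕎.+R (X.φ tᵘ 𝕎.*R yy)) 𝕎.≈ X.φ sᵘ
    D-eq = 𝕎.begin
      (Dxy 𝕎.*R X.φ sᵘ) 𝕎.+R (X.φ tᵘ 𝕎.*R yy)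
        𝕎.≈⟨ 𝕎.+-congˡ {Dxy 𝕎.*R X.φ sᵘ} (𝕎.*-congʳ {yy} (X.φ-* Xᵘ sᵘ)) ⟩
      (Dxy 𝕎.*R X.φ sᵘ) 𝕎.+R ((xx 𝕎.*R X.φ sᵘ) 𝕎.*R yy)
        𝕎.≈⟨ 𝕎.solve 4 (λ d s x y → (d 𝕎.⊗ s) 𝕎.⊕ ((x 𝕎.⊗ s) 𝕎.⊗ y) 𝕎.:= (d 𝕎.⊕ (x 𝕎.⊗ y)) 𝕎.⊗ s) 𝕎.refl Dxy (X.φ sᵘ) xx yy ⟩
      (Dxy 𝕎.+R (xx 𝕎.*R yy)) 𝕎.*R X.φ sᵘ
        𝕎.≈⟨ 𝕎.trans (𝕎.*-congʳ {X.φ sᵘ} D+xy) (𝕎.*-identityˡ (X.φ sᵘ)) ⟩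
      X.φ sᵘ 𝕎.∎

  open Parameters parameters using (D)
  private
    module SC = SkewCauchyIdentity 𝕊.series parameters N
    module P = SkewCauchy 𝕊.series parameters N
    aS : ∀ {n} → Vec ℕ n → Vec ℕ (suc n) → 𝕎.A
    aS = StripWeight.a 𝕊.series (X.φ tᵘ) (X.φ ρᵘ)
    bS : ∀ {n} → Vec ℕ n → Vec ℕ n → 𝕎.A
    bS = SkewWeight.b 𝕊.series (Y.φ (constᵘ β)) P.q P.p yy

    a-lift : ∀ {n} (μ : Vec ℕ n) κ → X.φ (a μ κ) 𝕎.≈ aS μ κ
    a-lift = HomLemmas.φ-a coefficientwise {tᵘ} {ρᵘ} 𝕎.refl 𝕎.refl

    p-lift : Y.φ (linᵘ α 1#) 𝕎.≈ P.p
    p-lift = 𝕎.trans (Y.φ-cong eq) (Y.φ-+ (constᵘ α) Xᵘ)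
      where
      eq : linᵘ α 1# ≈ᵘ (constᵘ α +ᵘ Xᵘ)
      eq zero          = sym (+-identityʳ _)
      eq (suc zero)    = sym (+-identityˡ _)
      eq (suc (suc i)) = sym (+-identityˡ _)

    q-lift : Y.φ (constᵘ (α +R β)) 𝕎.≈ P.q
    q-lift = 𝕎.trans (Y.φ-cong (C.φ-+ α β)) (Y.φ-+ (constᵘ α) (constᵘ β))

    b-lift : ∀ {n} (κ ν : Vec ℕ n) → Y.φ (b κ ν) 𝕎.≈ bS κ ν
    b-lift = HomLemmas.φ-b (Embeddings.const-hom series) {constᵘ β} {constᵘ (α +R β)} {linᵘ α 1#} {Xᵘ} 𝕎.refl q-lift p-lift 𝕎.refl

    product-coeff : ∀ f g i j → (X.φ f 𝕎.*R Y.φ g) i j ≈ f i *R g j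
    product-coeff f g i j = trans (𝕊.·-const (X.φ f) g i j) (const-· (f i) g j)

    ab : ∀ {n} (μ : Vec ℕ n) κ ν i j → (aS μ κ 𝕎.*R bS κ ν) i j ≈ a μ κ i *R b κ ν j
    ab μ κ ν i j = trans (𝕎.sym {X.φ (a μ κ) 𝕎.*R Y.φ (b κ ν)} {aS μ κ 𝕎.*R bS κ ν} (𝕎.*-cong (a-lift μ κ) (b-lift κ ν)) i j)
                         (product-coeff (a μ κ) (b κ ν) i j)

    ba : ∀ {n} (μ κ : Vec ℕ n) ν i j → (bS μ κ 𝕎.*R aS κ ν) i j ≈ b μ κ j *R a κ ν i
    ba μ κ ν i j = trans (𝕎.*-comm (bS μ κ) (aS κ ν) i j)
      (trans (𝕎.sym {X.φ (a κ ν) 𝕎.*R Y.φ (b μ κ)} {aS κ ν 𝕎.*R bS μ κ} (𝕎.*-cong (a-lift κ ν) (b-lift μ κ)) i j)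
        (trans (product-coeff (a κ ν) (b μ κ) i j) (*-comm _ _)))

    cubeS : ∀ n (F : Vec ℕ n → 𝕎.A) i j → Cubes.cube 𝕊.series N n F i j ≈ cube n (λ v → F v i j)
    cubeS n F i j = trans (𝕊.coeff-cube N n F i j) (coeff-cube N n (λ v → F v i) j)

    xy-zero : ∀ F j → ((xx 𝕎.*R yy) 𝕎.*R F) 0 j ≈ 0#
    xy-zero F j = trans (𝕎.*-assoc xx yy F 0 j) (trans (𝕊.·ᵘ-zero xx (yy 𝕎.*R F) j) (𝕌.trans (𝕌.*-congʳ {(yy 𝕎.*R F) 0} C.φ-0) (𝕌.zeroˡ ((yy 𝕎.*R F) 0)) j))

    xx≈X : xx 𝕎.≈ 𝕊.Xᵘ
    xx≈X zero          = C.φ-0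
    xx≈X (suc zero)    = C.φ-1
    xx≈X (suc (suc i)) = C.φ-0

    xy-suc : ∀ F i → ((xx 𝕎.*R yy) 𝕎.*R F) (suc i) 𝕌.≈ (Xᵘ ·ᵘ F i)
    xy-suc F i = 𝕌.trans (𝕎.*-assoc xx yy F (suc i)) (𝕌.trans (𝕎.*-congʳ {yy 𝕎.*R F} xx≈X (suc i))
      (𝕌.trans (𝕊.X-·-suc (yy 𝕎.*R F) i) (𝕊.const-· Xᵘ F i)))

    -- This replaces division by D: with D F known, it determines F degree by degree, since the
    -- coefficients of xy F are those of F shifted diagonally.
    expand : ∀ F → F 𝕎.≈ ((D 𝕎.*R F) 𝕎.+R ((xx 𝕎.*R yy) 𝕎.*R F))
    expand F = 𝕎.trans (𝕎.sym (𝕎.*-identityˡ F)) (𝕎.trans (𝕎.*-congʳ {F} (𝕎.sym {Dxy 𝕎.+R (xx 𝕎.*R yy)} {𝕎.1#} D+xy)) (𝕎.distribʳ F Dxy (xx 𝕎.*R yy)))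

  left right : ∀ {n} (μ : Vec ℕ n) (ν : Vec ℕ (suc n)) → ℕ → ℕ → A
  left {n} μ ν i j = cube (suc n) (λ κ → a μ κ i *R b κ ν j)
  right {n} μ ν i j = cube n (λ κ → b μ κ j *R a κ ν i)

  module _ {n} (μ : Vec ℕ n) (ν : Vec ℕ (suc n)) (dμ : Decr μ) (dν : Decr ν) (bμ : Bounded μ) (hμ : hd μ < N) where
    private
      F : 𝕎.A
      F = Cubes.cube 𝕊.series N (suc n) (λ κ → aS μ κ 𝕎.*R bS κ ν)

      F≈ : ∀ i j → F i j ≈ left μ ν i j
      F≈ i j = trans (cubeS (suc n) (λ κ → aS μ κ 𝕎.*R bS κ ν) i j) (cube-cong (suc n) (λ κ → ab μ κ ν i j))

      -- The cutoff error is a multiple of t^(N - hd μ), and t has no constant term in x; hence the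
      -- error has no coefficient at x^i when i + hd μ < N.
      DF≈ : ∀ i j → i + hd μ < N → (D 𝕎.*R F) i j ≈ right μ ν i j
      DF≈ i j lt with SC.skew-cauchy μ ν dμ dν bμ hμ
      ... | J , e = begin
        (D 𝕎.*R F) i j
          ≈⟨ +-identityʳ _ ⟨
        (D 𝕎.*R F) i j +R 0#
          ≈⟨ +-congˡ (𝕊.order-pow (X.φ tᵘ) (N ∸ hd μ) J (𝕌.trans (C.φ-cong (X-·-zero sᵘ)) C.φ-0) i (ℕₚ.m+n≤o⇒m≤o∸n (suc i) lt) j) ⟨
        ((D 𝕎.*R F) 𝕎.+R (𝕎.pow (X.φ tᵘ) (N ∸ hd μ) 𝕎.*R J)) i j
          ≈⟨ e i j ⟩
        Cubes.cube 𝕊.series N n (λ κ → bS μ κ 𝕎.*R aS κ ν) i j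
          ≈⟨ trans (cubeS n (λ κ → bS μ κ 𝕎.*R aS κ ν) i j) (cube-cong n (λ κ → ba μ κ ν i j)) ⟩
        right μ ν i j ∎

    skew-0 : ∀ j → left μ ν 0 j ≈ right μ ν 0 j
    skew-0 j = begin
      left μ ν 0 j                                       ≈⟨ F≈ 0 j ⟨
      F 0 j                                              ≈⟨ expand F 0 j ⟩
      (D 𝕎.*R F) 0 j +R ((xx 𝕎.*R yy) 𝕎.*R F) 0 j        ≈⟨ +-cong (DF≈ 0 j hμ) (xy-zero F j) ⟩
      right μ ν 0 j +R 0#                                ≈⟨ +-identityʳ _ ⟩
      right μ ν 0 j                                      ∎

    skew-suc-0 : ∀ i → suc i + hd μ < N → left μ ν (suc i) 0 ≈ right μ ν (suc i) 0
    skew-suc-0 i lt = begin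
      left μ ν (suc i) 0                                             ≈⟨ F≈ (suc i) 0 ⟨
      F (suc i) 0                                                    ≈⟨ expand F (suc i) 0 ⟩
      (D 𝕎.*R F) (suc i) 0 +R ((xx 𝕎.*R yy) 𝕎.*R F) (suc i) 0        ≈⟨ +-cong (DF≈ (suc i) 0 lt) (trans (xy-suc F i 0) (X-·-zero (F i))) ⟩
      right μ ν (suc i) 0 +R 0#                                      ≈⟨ +-identityʳ _ ⟩
      right μ ν (suc i) 0                                            ∎

    -- The diagonal shift by xy is the recursive clause of `H`, so the factor 1/(1 - xy) builds up
    -- through this lemma in `eigen`.
    skew-suc-suc : ∀ i j → suc i + hd μ < N → left μ ν (suc i) (suc j) ≈ right μ ν (suc i) (suc j) +R left μ ν i j
    skew-suc-suc i j lt = begin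
      left μ ν (suc i) (suc j)
        ≈⟨ F≈ (suc i) (suc j) ⟨
      F (suc i) (suc j)
        ≈⟨ expand F (suc i) (suc j) ⟩
      (D 𝕎.*R F) (suc i) (suc j) +R ((xx 𝕎.*R yy) 𝕎.*R F) (suc i) (suc j)
        ≈⟨ +-cong (DF≈ (suc i) (suc j) lt) (trans (xy-suc F i (suc j)) (trans (X-·-suc (F i) j) (F≈ i j))) ⟩
      right μ ν (suc i) (suc j) +R left μ ν i j ∎

-- Supports of the weights: interlacing and containment.

sumV : ∀ {n} → Vec ℕ n → ℕ
sumV []      = 0
sumV (x ∷ v) = x + sumV v

hd≤sumV : ∀ {n} (v : Vec ℕ n) → hd v ≤ sumV v
hd≤sumV []      = z≤n
hd≤sumV (x ∷ v) = m≤m+n x (sumV v)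

zeros : ∀ n → Vec ℕ n
zeros zero    = []
zeros (suc n) = 0 ∷ zeros n

Decr? : ∀ {n} (v : Vec ℕ n) → Dec (Decr v)
Decr? []      = yes tt
Decr? (x ∷ v) = (hd v ≤? x) ×-dec Decr? v

-- The condition that κ/μ is a horizontal strip; it forces both vectors to be weakly decreasing.
Inter : ∀ {n} → Vec ℕ n → Vec ℕ (suc n) → Set
Inter []      (l ∷ []) = ⊤
Inter (m ∷ μ) (l ∷ κ)  = m ≤ l × hd κ ≤ m × Inter μ κ

Inter? : ∀ {n} (μ : Vec ℕ n) κ → Dec (Inter μ κ)
Inter? []      (l ∷ []) = yes tt
Inter? (m ∷ μ) (l ∷ κ)  = (m ≤? l) ×-dec ((hd κ ≤? m) ×-dec Inter? μ κ)

Inter-hd : ∀ {n} (μ : Vec ℕ n) κ → Inter μ κ → hd μ ≤ hd κ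
Inter-hd []      (l ∷ []) _           = z≤n
Inter-hd (m ∷ μ) (l ∷ κ)  (m≤l , _)   = m≤l

Inter-sum : ∀ {n} (μ : Vec ℕ n) κ → Inter μ κ → sumV μ ≤ sumV κ
Inter-sum []      (l ∷ []) _               = z≤n
Inter-sum (m ∷ μ) (l ∷ κ)  (m≤l , _ , i)   = ℕₚ.+-mono-≤ m≤l (Inter-sum μ κ i)

Inter⇒Decrˡ : ∀ {n} (μ : Vec ℕ n) κ → Inter μ κ → Decr μ
Inter⇒Decrˡ []      _        _             = tt
Inter⇒Decrˡ (m ∷ μ) (l ∷ κ)  (_ , h , i)   = ≤-trans (Inter-hd μ κ i) h , Inter⇒Decrˡ μ κ i

Inter⇒Decrʳ : ∀ {n} (μ : Vec ℕ n) κ → Inter μ κ → Decr κ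
Inter⇒Decrʳ []      (l ∷ []) _             = z≤n , tt
Inter⇒Decrʳ (m ∷ μ) (l ∷ κ)  (m≤l , h , i) = ≤-trans h m≤l , Inter⇒Decrʳ μ κ i

Sub : ∀ {n} → Vec ℕ n → Vec ℕ n → Set
Sub []      []      = ⊤
Sub (m ∷ ν) (l ∷ κ) = m ≤ l × Sub ν κ

Sub? : ∀ {n} (ν κ : Vec ℕ n) → Dec (Sub ν κ)
Sub? []      []      = yes tt
Sub? (m ∷ ν) (l ∷ κ) = (m ≤? l) ×-dec Sub? ν κ

Sub-hd : ∀ {n} (ν κ : Vec ℕ n) → Sub ν κ → hd ν ≤ hd κ
Sub-hd []      []      _         = z≤n
Sub-hd (m ∷ ν) (l ∷ κ) (m≤l , _) = m≤l

positive : ℕ → ℕ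
positive zero    = 0
positive (suc _) = 1

-- The statistic r of μ over λ without its first part, for padded vectors.
cornerCount : ∀ {n} → Vec ℕ n → Vec ℕ (suc n) → ℕ
cornerCount []      _       = 0
cornerCount (m ∷ μ) (l ∷ κ) = positive (m ∸ hd κ) + cornerCount μ κ

∸-+-∸ : ∀ {a b c d} → b ≤ a → d ≤ c → (a + c) ∸ (b + d) ≡ (a ∸ b) + (c ∸ d)
∸-+-∸ {a} {b} {c} {d} b≤a d≤c with split≤ b≤a | split≤ d≤c
... | x , ≡.refl | z , ≡.refl = ≡.trans (∸-from (b + d) eq) (≡.cong₂ _+_ (≡.sym (m+n∸m≡n b x)) (≡.sym (m+n∸m≡n d z)))
  where
  eq : b + x + (d + z) ≡ b + d + (x + z)
  eq = ≡.trans (ℕₚ.+-assoc b x (d + z)) (≡.trans (≡.cong (b +_) (≡.trans (≡.sym (ℕₚ.+-assoc x d z))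
         (≡.trans (≡.cong (_+ z) (ℕₚ.+-comm x d)) (ℕₚ.+-assoc d x z)))) (≡.sym (ℕₚ.+-assoc b d (x + z))))

module StripFacts {c ℓ} (R : CommutativeRing c ℓ) (t ρ : CommutativeRing.Carrier R) where
  open Sums R
  open StripWeight R t ρ

  a-no : ∀ {n} (μ : Vec ℕ n) κ → ¬ Inter μ κ → a μ κ ≈ 0#
  a-no []      (l ∷ []) ¬i = ⊥-elim (¬i tt)
  a-no (m ∷ μ) (l ∷ κ)  ¬i with m ≤? l | hd κ ≤? m
  ... | no m≰l  | _      = *-zeroˡ (I*-no (m ≤? l) m≰l)
  ... | yes _   | no h   = *-zeroˡ (*-zeroʳ (I*-no (hd κ ≤? m) h))
  ... | yes m≤l | yes h  = *-zeroʳ (a-no μ κ (λ i → ¬i (m≤l , h , i)))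

  rp-positive : ∀ k → rp k ≈ pow ρ (positive k)
  rp-positive zero    = refl
  rp-positive (suc _) = sym (*-identityʳ ρ)

  a-yes : ∀ {n} (μ : Vec ℕ n) κ → Inter μ κ → a μ κ ≈ pow t (sumV κ ∸ sumV μ) *R pow ρ (cornerCount μ κ)
  a-yes []      (l ∷ []) _             = trans (reflexive (≡.cong (pow t) (≡.sym (ℕₚ.+-identityʳ l)))) (sym (*-identityʳ _))
  a-yes (m ∷ μ) (l ∷ κ)  (m≤l , h , i) = begin
    strip l m (hd κ) *R a μ κ
      ≈⟨ *-cong (trans (I*-yes (m ≤? l) m≤l) (trans (I*-yes (hd κ ≤? m) h) (*-congˡ (rp-positive (m ∸ hd κ))))) (a-yes μ κ i) ⟩
    (pow t (l ∸ m) *R pow ρ (positive (m ∸ hd κ))) *R (pow t (sumV κ ∸ sumV μ) *R pow ρ (cornerCount μ κ))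
      ≈⟨ solve 4 (λ a b x y → (a ⊗ b) ⊗ (x ⊗ y) := (a ⊗ x) ⊗ (b ⊗ y)) refl _ _ _ _ ⟩
    (pow t (l ∸ m) *R pow t (sumV κ ∸ sumV μ)) *R (pow ρ (positive (m ∸ hd κ)) *R pow ρ (cornerCount μ κ))
      ≈⟨ *-cong (pow-+ t (l ∸ m) _) (pow-+ ρ (positive (m ∸ hd κ)) _) ⟨
    pow t ((l ∸ m) + (sumV κ ∸ sumV μ)) *R pow ρ (cornerCount (m ∷ μ) (l ∷ κ))
      ≡⟨ ≡.cong (λ x → pow t x *R pow ρ (cornerCount (m ∷ μ) (l ∷ κ))) (∸-+-∸ m≤l (Inter-sum μ κ i)) ⟨
    pow t ((l + sumV κ) ∸ (m + sumV μ)) *R pow ρ (cornerCount (m ∷ μ) (l ∷ κ)) ∎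

  a-zeros : ∀ {n} (μ : Vec ℕ n) → a μ (zeros (suc n)) ≈ I (Sub? μ (zeros n))
  a-zeros {zero}  []      = refl
  a-zeros {suc n} (zero ∷ μ)  = trans (*-congʳ (solve 0 (con 1 ⊗ (con 1 ⊗ (con 1 ⊗ con 1)) := con 1) refl)) (trans (*-identityˡ _) (a-zeros μ))
  a-zeros {suc n} (suc m ∷ μ) = *-zeroˡ (zeroˡ _)

module SkewFacts {c ℓ} (R : CommutativeRing c ℓ) (β q p y : CommutativeRing.Carrier R) where
  open Sums R
  open SkewWeight R β q p y

  b-no-Decr : ∀ {n} (κ ν : Vec ℕ n) → ¬ Decr κ → b κ ν ≈ 0#
  b-no-Decr []      []      ¬d = ⊥-elim (¬d tt)
  b-no-Decr (l ∷ κ) (m ∷ ν) ¬d with hd κ ≤? l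
  ... | no h  = *-zeroˡ (*-zeroʳ (I*-no (hd κ ≤? l) h))
  ... | yes h = *-zeroʳ (b-no-Decr κ ν (λ d → ¬d (h , d)))

  b-no-Sub : ∀ {n} (κ ν : Vec ℕ n) → ¬ Sub ν κ → b κ ν ≈ 0#
  b-no-Sub []      []      ¬s = ⊥-elim (¬s tt)
  b-no-Sub (l ∷ κ) (m ∷ ν) ¬s with m ≤? l
  ... | no h  = *-zeroˡ (I*-no (m ≤? l) h)
  ... | yes h = *-zeroʳ (b-no-Sub κ ν (λ s → ¬s (h , s)))

-- Complete homogeneous operators and the coefficients of the Cauchy kernel.

module Complete {c ℓ} (R : CommutativeRing c ℓ) where
  open Sums R

  -- (H i F)(e) = Σ F (e - k) over all k ≤ e of size i: the coefficient of x^i in the product of all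
  -- 1/(1 - x S_j), where S_j lowers the j-th exponent.
  H : ∀ {n} → ℕ → (Vec ℕ n → A) → Vec ℕ n → A
  H zero    F []          = F []
  H (suc i) F []          = 0#
  H zero    F (j ∷ e)     = H zero (λ e' → F (j ∷ e')) e
  H (suc i) F (zero ∷ e)  = H (suc i) (λ e' → F (0 ∷ e')) e
  H (suc i) F (suc j ∷ e) = H (suc i) (λ e' → F (suc j ∷ e')) e +R H i F (j ∷ e)

  H-cong : ∀ {n} i {F F' : Vec ℕ n → A} e → (∀ e → F e ≈ F' e) → H i F e ≈ H i F' e
  H-cong zero    []          eq = eq []
  H-cong (suc i) []          eq = refl
  H-cong zero    (j ∷ e)     eq = H-cong zero e (λ e' → eq (j ∷ e'))
  H-cong (suc i) (zero ∷ e)  eq = H-cong (suc i) e (λ e' → eq (0 ∷ e'))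
  H-cong (suc i) (suc j ∷ e) eq = +-cong (H-cong (suc i) e (λ e' → eq (suc j ∷ e'))) (H-cong i (j ∷ e) eq)

  H-zero : ∀ {n} i {F : Vec ℕ n → A} e → (∀ e → F e ≈ 0#) → H i F e ≈ 0#
  H-zero zero    []          eq = eq []
  H-zero (suc i) []          eq = refl
  H-zero zero    (j ∷ e)     eq = H-zero zero e (λ e' → eq (j ∷ e'))
  H-zero (suc i) (zero ∷ e)  eq = H-zero (suc i) e (λ e' → eq (0 ∷ e'))
  H-zero (suc i) (suc j ∷ e) eq = trans (+-cong (H-zero (suc i) e (λ e' → eq (suc j ∷ e'))) (H-zero i (j ∷ e) eq)) (+-identityˡ _)

  H-cube : ∀ N k {n} i (x : Vec ℕ k → A) (F : Vec ℕ k → Vec ℕ n → A) e →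
           H i (λ e → Cubes.cube R N k (λ κ → x κ *R F κ e)) e ≈ Cubes.cube R N k (λ κ → x κ *R H i (F κ) e)
  H-cube N k zero    x F []          = refl
  H-cube N k (suc i) x F []          = sym (Cubes.cube-zero R N k (λ κ → zeroʳ _))
  H-cube N k zero    x F (j ∷ e)     = H-cube N k zero x (λ κ e' → F κ (j ∷ e')) e
  H-cube N k (suc i) x F (zero ∷ e)  = H-cube N k (suc i) x (λ κ e' → F κ (0 ∷ e')) e
  H-cube N k (suc i) x F (suc j ∷ e) =
    trans (+-cong (H-cube N k (suc i) x (λ κ e' → F κ (suc j ∷ e')) e) (H-cube N k i x F (j ∷ e)))
   (trans (sym (Cubes.cube-+ R N k _ _)) (Cubes.cube-cong R N k (λ κ → sym (distribˡ (x κ) _ _))))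

  -- It has two uses: as a function of a partition it is the dual polynomial in no variables, and as
  -- a function of exponents it is the constant series 1.
  δ : ∀ {n} → Vec ℕ n → A
  δ {n} v = I (Sub? v (zeros n))

  cube-δ : ∀ N n (F : Vec ℕ n → A) → 0 < N → Cubes.cube R N n (λ v → F v *R δ v) ≈ F (zeros n)
  cube-δ N zero    F _   = *-identityʳ _
  cube-δ N (suc n) F 0<N = trans (∑-single N 0 0<N other) (cube-δ N n (λ v → F (0 ∷ v)) 0<N)
    where
    other : ∀ i → i < N → i ≢ 0 → Cubes.cube R N n (λ v → F (i ∷ v) *R δ (i ∷ v)) ≈ 0#
    other zero    _ ne = ⊥-elim (ne ≡.refl)
    other (suc i) _ _  = Cubes.cube-zero R N n (λ v → zeroʳ _)

  -- The coefficient of the monomial with x-exponents d and y-exponents e in the product of all 1/(1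
  -- - x_i y_j), with the factors grouped by x-variable.
  W : ∀ {m n} → Vec ℕ m → Vec ℕ n → A
  W []      e = δ e
  W (i ∷ d) e = H i (W d) e

-- The Cauchy identity for padded vectors.

module VecCauchy {c ℓ} (R : CommutativeRing c ℓ) (α β : CommutativeRing.Carrier R) (N : ℕ) where
  open Sums R
  open PowerSeries R
  open SkewCoefficients R α β N
  open Cubes R N
  open Complete R
  open StripFacts series tᵘ ρᵘ
  open SkewFacts series (constᵘ β) (constᵘ (α +R β)) (linᵘ α 1#) Xᵘ

  g : ∀ {n k} → Vec ℕ n → Vec ℕ k → A
  g κ []      = δ κ
  g κ (j ∷ e) = cube _ (λ ν → b κ ν j *R g ν e)

  -- The vector has as many entries as there are variables, because G vanishes on partitions with
  -- more parts than variables. For `g` there is no such bound, and the length of its vector is a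
  -- separate index.
  G : ∀ {k} → Vec ℕ k → Vec ℕ k → A
  G κ []      = 1#
  G κ (i ∷ d) = cube _ (λ μ → G μ d *R a μ κ i)

  Sub-zeros : ∀ {n} (v : Vec ℕ n) → Sub v (zeros n) → Decr v
  Sub-zeros []          _         = tt
  Sub-zeros {suc n} (zero ∷ v)  (_ , s) = ≤-trans (Sub-hd v (zeros n) s) (z n) , Sub-zeros v s
    where
    z : ∀ n → hd (zeros n) ≤ 0
    z zero    = z≤n
    z (suc _) = z≤n

  g-no-Decr : ∀ {n k} (κ : Vec ℕ n) (e : Vec ℕ k) → ¬ Decr κ → g κ e ≈ 0#
  g-no-Decr κ []      ¬d = I-no (Sub? κ (zeros _)) (λ s → ¬d (Sub-zeros κ s))
  g-no-Decr κ (j ∷ e) ¬d = cube-zero _ (λ ν → *-zeroˡ (b-no-Decr κ ν ¬d j))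

  G-no-Decr : ∀ {k} (κ d : Vec ℕ k) → ¬ Decr κ → G κ d ≈ 0#
  G-no-Decr []  [] ¬d = ⊥-elim (¬d tt)
  G-no-Decr κ (i ∷ d) ¬d = cube-zero _ (λ μ → *-zeroʳ (a-no μ κ (λ int → ¬d (Inter⇒Decrʳ μ κ int)) i))

  a-order : ∀ {n} (μ : Vec ℕ n) κ i → i < sumV κ ∸ sumV μ → a μ κ i ≈ 0#
  a-order μ κ i lt with Inter? μ κ
  ... | no ¬i  = a-no μ κ ¬i i
  ... | yes int = trans (a-yes μ κ int i) (order-pow tᵘ (sumV κ ∸ sumV μ) (Sums.pow series ρᵘ (cornerCount μ κ)) (X-·-zero sᵘ) i lt)

  -- The weight `a μ κ` has order at least |κ| - |μ| in its variable, so the total degree reached is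
  -- at least |κ|.
  G-order : ∀ {k} (κ d : Vec ℕ k) → sumV d < sumV κ → G κ d ≈ 0#
  G-order []  []      ()
  G-order κ (i ∷ d) lt = cube-zero _ term
    where
    term : ∀ μ → G μ d *R a μ κ i ≈ 0#
    term μ with sumV d <? sumV μ
    ... | yes lt' = *-zeroˡ (G-order μ d lt')
    ... | no ge   = *-zeroʳ (a-order μ κ i (ℕₚ.m+n≤o⇒m≤o∸n (suc i) (≤-trans (ℕₚ.+-monoʳ-≤ (suc i) (≮⇒≥ ge)) lt)))

  eigen-[] : ∀ {n} (μ : Vec ℕ n) i → 0 < N → cube (suc n) (λ κ → a μ κ i *R δ κ) ≈ H i (λ e → g μ e) []
  eigen-[] {n} μ i 0<N = trans (cube-δ N (suc n) (λ κ → a μ κ i) 0<N) (trans (a-zeros μ i) (last i))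
    where
    last : ∀ i → Sums.I series (Sub? μ (zeros n)) i ≈ H i (λ e → g μ e) []
    last zero with does (Sub? μ (zeros n))
    ... | true  = refl
    ... | false = refl
    last (suc i) with does (Sub? μ (zeros n))
    ... | true  = refl
    ... | false = refl

  -- Induction on the number of y-variables. Unfolding `g` once and regrouping gives the sum of
  -- `left μ ν i j` times `g ν e`; the skew identity trades `left` for `right`, and regrouping again
  -- exposes the same statement for `e` at partitions κ inside μ. Their first part is at most
  -- `hd μ`, so the bound on i persists.
  eigen : ∀ {n k} (e : Vec ℕ k) (μ : Vec ℕ n) i → Decr μ → Bounded μ → i + hd μ < N →
          cube (suc n) (λ κ → a μ κ i *R g κ e) ≈ H i (g μ) e
  eigen []      μ i dμ bμ lt = eigen-[] μ i (≤-<-trans z≤n lt)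
  eigen {n} {suc k} (j ∷ e) μ i dμ bμ lt = trans (to-left i j) (go i j lt)
    where
    L Rt : ℕ → ℕ → A
    L i j = cube (suc n) (λ ν → left μ ν i j *R g ν e)
    Rt i j = cube (suc n) (λ ν → right μ ν i j *R g ν e)

    to-left : ∀ i j → cube (suc n) (λ κ → a μ κ i *R g κ (j ∷ e)) ≈ L i j
    to-left i j = cube-assoc (suc n) (suc n) (λ κ → a μ κ i) (λ κ ν → b κ ν j) (λ ν → g ν e)

    -- The skew identity is available for weakly decreasing ν; at every other ν the factor `g ν e`
    -- is zero.
    on-Decr : ∀ {x x' : Vec ℕ (suc n) → A} → (∀ ν → Decr ν → x ν ≈ x' ν) →
              cube (suc n) (λ ν → x ν *R g ν e) ≈ cube (suc n) (λ ν → x' ν *R g ν e)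
    on-Decr eq = cube-cong (suc n) term
      where
      term : ∀ ν → _
      term ν with Decr? ν
      ... | yes d = *-congʳ (eq ν d)
      ... | no ¬d = trans (*-zeroʳ (g-no-Decr ν e ¬d)) (sym (*-zeroʳ (g-no-Decr ν e ¬d)))

    step : ∀ i j κ → Bounded κ → i + hd μ < N →
           b μ κ j *R cube (suc n) (λ ν → a κ ν i *R g ν e) ≈ b μ κ j *R H i (g κ) e
    step i j κ bκ lt with Sub? κ μ | Decr? κ
    ... | no ¬s | _     = trans (*-zeroˡ (b-no-Sub μ κ ¬s j)) (sym (*-zeroˡ (b-no-Sub μ κ ¬s j)))
    ... | yes s | yes d = *-congˡ (eigen e κ i d bκ (≤-<-trans (ℕₚ.+-monoʳ-≤ i (Sub-hd κ μ s)) lt))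
    ... | yes s | no ¬d = *-congˡ (trans (cube-zero (suc n) (λ ν → *-zeroˡ {y = g ν e} (a-no κ ν (λ int → ¬d (Inter⇒Decrˡ κ ν int)) i)))
                                         (sym (H-zero i e (λ e' → g-no-Decr κ e' ¬d))))

    to-right : ∀ i j → i + hd μ < N → Rt i j ≈ H i (λ e' → g μ (j ∷ e')) e
    to-right i j lt = begin
      Rt i j
        ≈⟨ cube-assoc n (suc n) (λ κ → b μ κ j) (λ κ ν → a κ ν i) (λ ν → g ν e) ⟨
      cube n (λ κ → b μ κ j *R cube (suc n) (λ ν → a κ ν i *R g ν e))
        ≈⟨ cube-cong< n (λ κ bκ → step i j κ bκ lt) ⟩
      cube n (λ κ → b μ κ j *R H i (g κ) e)
        ≈⟨ H-cube N n i (λ κ → b μ κ j) (λ κ e' → g κ e') e ⟨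
      H i (λ e' → g μ (j ∷ e')) e ∎

    hμ : ∀ i → i + hd μ < N → hd μ < N
    hμ i lt = ≤-<-trans (m≤n+m (hd μ) i) lt

    -- The clauses are those of `H` at `j ∷ e`; the third one calls itself at i and j for the
    -- diagonal term.
    go : ∀ i j → i + hd μ < N → L i j ≈ H i (g μ) (j ∷ e)
    go zero    j       lt = trans (on-Decr (λ ν dν → skew-0 μ ν dμ dν bμ lt j)) (to-right 0 j lt)
    go (suc i) zero    lt = trans (on-Decr (λ ν dν → skew-suc-0 μ ν dμ dν bμ (hμ (suc i) lt) i lt)) (to-right (suc i) 0 lt)
    go (suc i) (suc j) lt = begin
      L (suc i) (suc j)
        ≈⟨ on-Decr (λ ν dν → skew-suc-suc μ ν dμ dν bμ (hμ (suc i) lt) i j lt) ⟩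
      cube (suc n) (λ ν → (right μ ν (suc i) (suc j) +R left μ ν i j) *R g ν e)
        ≈⟨ cube-cong (suc n) (λ ν → distribʳ (g ν e) (right μ ν (suc i) (suc j)) (left μ ν i j)) ⟩
      cube (suc n) (λ ν → (right μ ν (suc i) (suc j) *R g ν e) +R (left μ ν i j *R g ν e))
        ≈⟨ cube-+ (suc n) (λ ν → right μ ν (suc i) (suc j) *R g ν e) (λ ν → left μ ν i j *R g ν e) ⟩
      Rt (suc i) (suc j) +R L i j
        ≈⟨ +-cong (to-right (suc i) (suc j) lt) (go i j (≤-trans (n≤1+n _) lt)) ⟩
      H (suc i) (g μ) (suc j ∷ e) ∎

  g-[] : ∀ {k} (e : Vec ℕ k) → g [] e ≈ δ e
  g-[] []          = refl
  g-[] (zero ∷ e)  = trans (*-identityˡ _) (g-[] e)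
  g-[] (suc j ∷ e) = zeroˡ _

  -- Exchanging the sums over μ and κ produces the left side of `eigen`; the operator `H i` that
  -- replaces it is linear and moves outside the sum over μ. By `G-order` only μ with |μ| ≤ |d|
  -- matter, and for these i + μ_1 ≤ i + |d| < N.
  vec-cauchy : ∀ {k n} (d : Vec ℕ k) (e : Vec ℕ n) → sumV d < N → cube k (λ κ → G κ d *R g κ e) ≈ W d e
  vec-cauchy []      e lt = trans (*-identityˡ _) (g-[] e)
  vec-cauchy {suc k} (i ∷ d) e lt = begin
    cube (suc k) (λ κ → G κ (i ∷ d) *R g κ e)
      ≈⟨ cube-assoc k (suc k) (λ μ → G μ d) (λ μ κ → a μ κ i) (λ κ → g κ e) ⟨
    cube k (λ μ → G μ d *R cube (suc k) (λ κ → a μ κ i *R g κ e))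
      ≈⟨ cube-cong< k term ⟩
    cube k (λ μ → G μ d *R H i (g μ) e)
      ≈⟨ H-cube N k i (λ μ → G μ d) (λ μ e' → g μ e') e ⟨
    H i (λ e' → cube k (λ μ → G μ d *R g μ e')) e
      ≈⟨ H-cong i e (λ e' → vec-cauchy d e' (≤-<-trans (m≤n+m (sumV d) i) lt)) ⟩
    H i (W d) e ∎
    where
    term : ∀ μ → Bounded μ → G μ d *R cube (suc k) (λ κ → a μ κ i *R g κ e) ≈ G μ d *R H i (g μ) e
    term μ bμ with Decr? μ | sumV d <? sumV μ
    ... | no ¬d | _      = trans (*-zeroˡ (G-no-Decr μ d ¬d)) (sym (*-zeroˡ (G-no-Decr μ d ¬d)))
    ... | yes _ | yes l  = trans (*-zeroˡ (G-order μ d l)) (sym (*-zeroˡ (G-order μ d l)))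
    ... | yes dμ | no ge = *-congˡ (eigen e μ i dμ bμ (≤-<-trans (ℕₚ.+-monoʳ-≤ i (≤-trans (hd≤sumV μ) (≮⇒≥ ge))) lt))

-- Counting rows and columns of a skew shape.

T⇒true : ∀ {x} → T x → x ≡ true
T⇒true {true} _ = ≡.refl

¬T⇒false : ∀ {x} → ¬ T x → x ≡ false
¬T⇒false {true}  ¬t = ⊥-elim (¬t tt)
¬T⇒false {false} _  = ≡.refl

T-ext : ∀ {x y} → (T x → T y) → (T y → T x) → x ≡ y
T-ext {true}  {true}  _ _ = ≡.refl
T-ext {true}  {false} f _ = ⊥-elim (f tt)
T-ext {false} {true}  _ g = ⊥-elim (g tt)
T-ext {false} {false} _ _ = ≡.refl

bit : Bool → ℕ
bit true  = 1
bit false = 0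

cnt : ℕ → (ℕ → Bool) → ℕ
cnt zero    p = 0
cnt (suc n) p = bit (p 0) + cnt n (p ∘ suc)

countB≡cnt : ∀ p n → countB p n ≡ cnt n p
countB≡cnt p n = go n id
  where
  go : ∀ n (f : ℕ → ℕ) → length (filterᵇ p (applyUpTo f n)) ≡ cnt n (p ∘ f)
  go zero    f = ≡.refl
  go (suc n) f with p (f 0)
  ... | true  = ≡.cong suc (go n (f ∘ suc))
  ... | false = go n (f ∘ suc)

cnt-cong : ∀ n {p q : ℕ → Bool} → (∀ i → i < n → p i ≡ q i) → cnt n p ≡ cnt n q
cnt-cong zero    e = ≡.refl
cnt-cong (suc n) e = ≡.cong₂ _+_ (≡.cong bit (e 0 (s≤s z≤n))) (cnt-cong n (λ i lt → e (suc i) (s≤s lt)))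

cnt-extend : ∀ {K L} {p : ℕ → Bool} → K ≤ L → (∀ i → K ≤ i → p i ≡ false) → cnt K p ≡ cnt L p
cnt-extend {L = zero}  z≤n     e = ≡.refl
cnt-extend {L = suc L} {p} z≤n e rewrite e 0 z≤n = cnt-extend {0} {L} z≤n (λ i _ → e (suc i) z≤n)
cnt-extend {p = p} (s≤s le)    e = ≡.cong (bit (p 0) +_) (cnt-extend le (λ i le' → e (suc i) (s≤s le')))

cnt-split : ∀ m n (p : ℕ → Bool) → cnt (m + n) p ≡ cnt m p + cnt n (λ j → p (m + j))
cnt-split zero    n p = ≡.refl
cnt-split (suc m) n p = ≡.trans (≡.cong (bit (p 0) +_) (cnt-split m n (p ∘ suc))) (≡.sym (ℕₚ.+-assoc (bit (p 0)) _ _))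

cnt-true : ∀ d → cnt d (λ _ → true) ≡ d
cnt-true zero    = ≡.refl
cnt-true (suc d) = ≡.cong suc (cnt-true d)

cnt-≥ : ∀ d m a → cnt d (λ j → m <ᵇ suc (a + j)) ≡ (a + d) ∸ (m ⊔ a)
cnt-≥ d       zero    a       = ≡.trans (cnt-true d) (≡.sym (m+n∸m≡n a d))
cnt-≥ zero    (suc m) zero    = ≡.refl
cnt-≥ (suc d) (suc m) zero    = ≡.trans (cnt-≥ d m 0) (≡.cong (d ∸_) (ℕₚ.⊔-identityʳ m))
cnt-≥ d       (suc m) (suc a) = cnt-≥ d m a

-- With row bounds given as functions and the number of rows as a separate argument, the cells of a
-- trimmed partition and of its zero-padded form can be compared.
cellsOf : (f g : ℕ → ℕ) → ℕ → List (ℕ × ℕ)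
cellsOf f g L = concatMap (λ i → map (λ t → (i , g i + t)) (upTo (f i ∸ g i))) (upTo L)

cellsOf-cong : ∀ {f f' g g'} L → f ≗ f' → g ≗ g' → cellsOf f g L ≡ cellsOf f' g' L
cellsOf-cong {f} {f'} {g} {g'} L ef eg = concatMap-cong row (upTo L)
  where
  row : ∀ i → map (λ t → (i , g i + t)) (upTo (f i ∸ g i)) ≡ map (λ t → (i , g' i + t)) (upTo (f' i ∸ g' i))
  row i rewrite ef i | eg i = ≡.refl

cellsOf-extend : ∀ {f g K} r → (∀ i → K ≤ i → f i ≡ 0) → cellsOf f g (r + K) ≡ cellsOf f g K
cellsOf-extend         zero    e = ≡.refl
cellsOf-extend {f} {g} {K} (suc r) e = ≡.trans (≡.cong (concatMap row) (≡.sym (upTo-∷ʳ (r + K))))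
  (≡.trans (concatMap-++ row (upTo (r + K)) (r + K ∷ []))
    (≡.trans (≡.cong (cellsOf f g (r + K) ++_) last) (≡.trans (++-identityʳ _) (cellsOf-extend r e))))
  where
  row : ℕ → List (ℕ × ℕ)
  row i = map (λ t → (i , g i + t)) (upTo (f i ∸ g i))
  last : row (r + K) ++ [] ≡ []
  last rewrite e (r + K) (m≤n+m K r) | ℕₚ.0∸n≡0 (g (r + K)) = ≡.refl

∈-cells⁺ : ∀ {f g L i j} → i < L → g i ≤ j → j < f i → (i , j) ∈ cellsOf f g L
∈-cells⁺ {f} {g} {L} {i} {j} i<L g≤j j<f = ∈-concatMap⁺ (λ i → map (λ t → (i , g i + t)) (upTo (f i ∸ g i))) (go (∈-upTo⁺ i<L))
  where
  here-row : (i , j) ∈ map (λ t → (i , g i + t)) (upTo (f i ∸ g i))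
  here-row = ≡.subst (λ z → (i , z) ∈ map (λ t → (i , g i + t)) (upTo (f i ∸ g i))) (m+[n∸m]≡n g≤j)
               (∈-map⁺ (λ t → (i , g i + t)) (∈-upTo⁺ (ℕₚ.∸-monoˡ-< j<f g≤j)))
  go : ∀ {xs} → i ∈ xs → Any (λ i' → (i , j) ∈ map (λ t → (i' , g i' + t)) (upTo (f i' ∸ g i'))) xs
  go (here ≡.refl) = here here-row
  go (there p)     = there (go p)

∈-cells⁻ : ∀ {f g L i j} → (i , j) ∈ cellsOf f g L → i < L × g i ≤ j × j < f i
∈-cells⁻ {f} {g} {L} {i} {j} p = go (λ k k∈ → ∈-upTo⁻ k∈) (∈-concatMap⁻ (λ i → map (λ t → (i , g i + t)) (upTo (f i ∸ g i))) {xs = upTo L} p)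
  where
  go : ∀ {xs} → (∀ k → k ∈ xs → k < L) → Any (λ i' → (i , j) ∈ map (λ t → (i' , g i' + t)) (upTo (f i' ∸ g i'))) xs → i < L × g i ≤ j × j < f i
  go b (there q)     = go (λ k k∈ → b k (there k∈)) q
  go b (here {k} q) with ∈-map⁻ (λ t → (k , g k + t)) q
  ... | t , t∈ , ≡.refl = b k (here ≡.refl) , m≤m+n (g k) t , ℕₚ.≤-trans (ℕₚ.≤-reflexive (≡.sym (ℕₚ.+-suc (g k) t))) (bound (∈-upTo⁻ t∈))
    where
    bound : t < f k ∸ g k → g k + suc t ≤ f k
    bound lt = ≤-trans (ℕₚ.+-monoʳ-≤ (g k) lt) (≤-reflexive (m+[n∸m]≡n {g k} (<⇒≤ (ℕₚ.m∸n≢0⇒n<m (λ z → ℕₚ.n≮0 (≡.subst (t <_) z lt))))))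

∈⇒Any : ∀ {a p} {A : Set a} {P : A → Set p} {x xs} → x ∈ xs → P x → Any P xs
∈⇒Any (here ≡.refl) px = here px
∈⇒Any (there q)     px = there (∈⇒Any q px)

Any⇒∈ : ∀ {a p} {A : Set a} {P : A → Set p} {xs} → Any P xs → ∃ λ x → x ∈ xs × P x
Any⇒∈ (here px) = _ , here ≡.refl , px
Any⇒∈ (there q) with Any⇒∈ q
... | x , x∈ , px = x , there x∈ , px

row-nonempty : ∀ f g L i → i < L → any (λ x → proj₁ x ≡ᵇ i) (cellsOf f g L) ≡ (g i <ᵇ f i)
row-nonempty f g L i i<L = T-ext to from
  where
  to : T (any (λ x → proj₁ x ≡ᵇ i) (cellsOf f g L)) → T (g i <ᵇ f i)
  to t with Any⇒∈ (any⁻ (λ x → proj₁ x ≡ᵇ i) (cellsOf f g L) t)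
  ... | (i' , j) , x∈ , e with ℕₚ.≡ᵇ⇒≡ i' i e | ∈-cells⁻ {f} {g} {L} x∈
  ... | ≡.refl | _ , g≤j , j<f = ℕₚ.<⇒<ᵇ (≤-<-trans g≤j j<f)
  from : T (g i <ᵇ f i) → T (any (λ x → proj₁ x ≡ᵇ i) (cellsOf f g L))
  from t = any⁺ (λ x → proj₁ x ≡ᵇ i) (∈⇒Any (∈-cells⁺ {f} {g} i<L ≤-refl (ℕₚ.<ᵇ⇒< (g i) (f i) t)) (ℕₚ.≡⇒≡ᵇ i i ≡.refl))

-- Whether column j contains a cell, tested from the top row down, so that the count of columns can
-- follow the recursion on vectors.
hit : ℕ → (f g : ℕ → ℕ) → ℕ → Bool
hit zero    f g j = false
hit (suc L) f g j = ((g 0 <ᵇ suc j) ∧ (j <ᵇ f 0)) ∨ hit L (f ∘ suc) (g ∘ suc) j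

hit⁺ : ∀ L f g {i j} → i < L → g i ≤ j → j < f i → T (hit L f g j)
hit⁺ (suc L) f g {zero}  _        p q = Equivalence.from T-∨ (inj₁ (Equivalence.from T-∧ (ℕₚ.<⇒<ᵇ (s≤s p) , ℕₚ.<⇒<ᵇ q)))
hit⁺ (suc L) f g {suc i} (s≤s lt) p q = Equivalence.from T-∨ (inj₂ (hit⁺ L (f ∘ suc) (g ∘ suc) lt p q))

hit⁻ : ∀ L f g {j} → T (hit L f g j) → ∃ λ i → i < L × g i ≤ j × j < f i
hit⁻ (suc L) f g {j} t with Equivalence.to (T-∨ {(g 0 <ᵇ suc j) ∧ (j <ᵇ f 0)}) t
... | inj₁ t₁ with Equivalence.to (T-∧ {g 0 <ᵇ suc j}) t₁
...   | p , q = 0 , s≤s z≤n , ℕₚ.≤-pred (ℕₚ.<ᵇ⇒< (g 0) (suc j) p) , ℕₚ.<ᵇ⇒< j (f 0) q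
hit⁻ (suc L) f g {j} t | inj₂ t₂ with hit⁻ L (f ∘ suc) (g ∘ suc) t₂
...   | i , lt , p , q = suc i , s≤s lt , p , q

column-hit : ∀ f g L j → any (λ x → proj₂ x ≡ᵇ j) (cellsOf f g L) ≡ hit L f g j
column-hit f g L j = T-ext to from
  where
  to : T (any (λ x → proj₂ x ≡ᵇ j) (cellsOf f g L)) → T (hit L f g j)
  to t with Any⇒∈ (any⁻ (λ x → proj₂ x ≡ᵇ j) (cellsOf f g L) t)
  ... | (i , j') , x∈ , e with ℕₚ.≡ᵇ⇒≡ j' j e | ∈-cells⁻ {f} {g} {L} x∈
  ... | ≡.refl | i<L , g≤j , j<f = hit⁺ L f g i<L g≤j j<f
  from : T (hit L f g j) → T (any (λ x → proj₂ x ≡ᵇ j) (cellsOf f g L))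
  from t with hit⁻ L f g t
  ... | i , i<L , p , q = any⁺ (λ x → proj₂ x ≡ᵇ j) (∈⇒Any (∈-cells⁺ {f} {g} i<L p q) (ℕₚ.≡⇒≡ᵇ j j ≡.refl))

-- Counts the components by their lowest rows; the search of componentsAux finds their first cells.
rowEnd : (f g : ℕ → ℕ) → ℕ → ℕ
rowEnd f g i = if does (f (suc i) ≤? g i) then positive (f i ∸ g i) else 0

rowEnds : (f g : ℕ → ℕ) → ℕ → ℕ → ℕ
rowEnds f g i zero    = 0
rowEnds f g i (suc r) = rowEnd f g i + rowEnds f g (suc i) r

-- Connected components of a skew shape.

module Components (f g : ℕ → ℕ) (L : ℕ)
  (f-decr : ∀ i → f (suc i) ≤ f i) (g-decr : ∀ i → g (suc i) ≤ g i) where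

  cs : List (ℕ × ℕ)
  cs = cellsOf f g L

  -- A row as a run of cells peeled off from the left, the order in which `componentsAux` consumes
  -- them.
  seg : ℕ → ℕ → ℕ → List (ℕ × ℕ)
  seg i j zero    = []
  seg i j (suc k) = (i , j) ∷ seg i (suc j) k

  rowCells : ℕ → List (ℕ × ℕ)
  rowCells i = map (λ t → (i , g i + t)) (upTo (f i ∸ g i))

  rowCells≡seg : ∀ i → rowCells i ≡ seg i (g i) (f i ∸ g i)
  rowCells≡seg i = go (f i ∸ g i) (g i) id (λ _ → ≡.refl)
    where
    go : ∀ k j (s : ℕ → ℕ) → (∀ t → g i + s t ≡ j + t) → map (λ t → (i , g i + t)) (applyUpTo s k) ≡ seg i j k
    go zero    j s e = ≡.refl
    go (suc k) j s e = ≡.cong₂ _∷_ (≡.cong (i ,_) (≡.trans (e 0) (ℕₚ.+-identityʳ j))) (go k (suc j) (s ∘ suc) (λ t → ≡.trans (e (suc t)) (ℕₚ.+-suc j t)))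

  rowsFrom : ℕ → ℕ → List (ℕ × ℕ)
  rowsFrom i zero    = []
  rowsFrom i (suc r) = seg i (g i) (f i ∸ g i) ++ rowsFrom (suc i) r

  cs≡rowsFrom : cs ≡ rowsFrom 0 L
  cs≡rowsFrom = go L 0 id (λ _ → ≡.refl)
    where
    go : ∀ r i (s : ℕ → ℕ) → (∀ t → s t ≡ i + t) → concatMap rowCells (applyUpTo s r) ≡ rowsFrom i r
    go zero    i s e = ≡.refl
    go (suc r) i s e = ≡.cong₂ _++_ (≡.trans (≡.cong rowCells (≡.trans (e 0) (ℕₚ.+-identityʳ i))) (rowCells≡seg i))
                                    (go r (suc i) (s ∘ suc) (λ t → ≡.trans (e (suc t)) (ℕₚ.+-suc i t)))

  reach-suc : ∀ t u v → T (reach t cs u v) → T (reach (suc t) cs u v)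
  reach-suc t u v p = Equivalence.from T-∨ (inj₁ p)

  reach-mono : ∀ {t t'} u v → t ≤ t' → T (reach t cs u v) → T (reach t' cs u v)
  reach-mono {t' = zero}   u v z≤n p = p
  reach-mono {t' = suc t'} u v z≤n p = reach-suc t' u v (reach-mono {0} {t'} u v z≤n p)
  reach-mono {suc t} {suc t'} u v (s≤s le) p with Equivalence.to (T-∨ {reach t cs u v}) p
  ... | inj₁ q = reach-suc t' u v (reach-mono u v le q)
  ... | inj₂ q with Any⇒∈ (any⁻ (λ w → reach t cs u w ∧ adjacent w v) cs q)
  ...   | w , w∈ , r with Equivalence.to (T-∧ {reach t cs u w}) r
  ...     | r₁ , r₂ = Equivalence.from (T-∨ {reach t' cs u v}) (inj₂ (any⁺ (λ w → reach t' cs u w ∧ adjacent w v)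
                        (∈⇒Any w∈ (Equivalence.from T-∧ (reach-mono u w le r₁ , r₂)))))

  reach-step : ∀ t u w v → w ∈ cs → T (reach t cs u w) → T (adjacent w v) → T (reach (suc t) cs u v)
  reach-step t u w v w∈ p q = Equivalence.from (T-∨ {reach t cs u v}) (inj₂ (any⁺ (λ w → reach t cs u w ∧ adjacent w v)
    (∈⇒Any w∈ (Equivalence.from T-∧ (p , q)))))

  reach-refl : ∀ u → T (reach 0 cs u u)
  reach-refl (i , j) = Equivalence.from T-∧ (ℕₚ.≡⇒≡ᵇ i i ≡.refl , ℕₚ.≡⇒≡ᵇ j j ≡.refl)

  adj-right : ∀ i j → T (adjacent (i , j) (i , suc j))
  adj-right i j = Equivalence.from T-∨ (inj₁ (Equivalence.from T-∧ (ℕₚ.≡⇒≡ᵇ i i ≡.refl ,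
    Equivalence.from T-∨ (inj₁ (ℕₚ.≡⇒≡ᵇ j j ≡.refl)))))

  adj-left : ∀ i j → T (adjacent (i , suc j) (i , j))
  adj-left i j = Equivalence.from T-∨ (inj₁ (Equivalence.from T-∧ (ℕₚ.≡⇒≡ᵇ i i ≡.refl ,
    Equivalence.from (T-∨ {suc (suc j) ≡ᵇ j}) (inj₂ (ℕₚ.≡⇒≡ᵇ j j ≡.refl)))))

  adj-down : ∀ i j → T (adjacent (i , j) (suc i , j))
  adj-down i j = Equivalence.from (T-∨ {(i ≡ᵇ suc i) ∧ ((suc j ≡ᵇ j) ∨ (suc j ≡ᵇ j))}) (inj₂ (Equivalence.from T-∧ (ℕₚ.≡⇒≡ᵇ j j ≡.refl ,
    Equivalence.from T-∨ (inj₁ (ℕₚ.≡⇒≡ᵇ i i ≡.refl)))))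

  adj-cases : ∀ i j i' j' → T (adjacent (i , j) (i' , j')) → i' ≤ i ⊎ (j ≡ j' × i' ≡ suc i)
  adj-cases i j i' j' t with Equivalence.to (T-∨ {(i ≡ᵇ i') ∧ ((suc j ≡ᵇ j') ∨ (suc j' ≡ᵇ j))}) t
  ... | inj₁ p = inj₁ (≤-reflexive (≡.sym (ℕₚ.≡ᵇ⇒≡ i i' (proj₁ (Equivalence.to (T-∧ {i ≡ᵇ i'}) p)))))
  ... | inj₂ p with Equivalence.to (T-∧ {j ≡ᵇ j'}) p
  ...   | e , q with Equivalence.to (T-∨ {suc i ≡ᵇ i'}) q
  ...     | inj₁ r = inj₂ (ℕₚ.≡ᵇ⇒≡ j j' e , ≡.sym (ℕₚ.≡ᵇ⇒≡ (suc i) i' r))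
  ...     | inj₂ r = inj₁ (≤-trans (n≤1+n i') (≤-reflexive (ℕₚ.≡ᵇ⇒≡ (suc i') i r)))

  -- A path can leave the rows up to i only by stepping down from row i in some column j. Both cells
  -- would lie in the shape, giving g i ≤ j < f (i+1), against the hypothesis.
  no-cross : ∀ {i} → f (suc i) ≤ g i → ∀ t u v → v ∈ cs → proj₁ u < suc i → T (reach t cs u v) → proj₁ v < suc i
  no-cross sep zero (i₁ , j₁) (i₂ , j₂) v∈ lt p with ℕₚ.≡ᵇ⇒≡ i₁ i₂ (proj₁ (Equivalence.to (T-∧ {i₁ ≡ᵇ i₂}) p))
  ... | ≡.refl = lt
  no-cross {i} sep (suc t) u v v∈ lt p with Equivalence.to (T-∨ {reach t cs u v}) p
  ... | inj₁ q = no-cross sep t u v v∈ lt q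
  no-cross {i} sep (suc t) u (i₂ , j₂) v∈ lt p | inj₂ q with Any⇒∈ (any⁻ (λ w → reach t cs u w ∧ adjacent w (i₂ , j₂)) cs q)
  ...   | (i₁ , j₁) , w∈ , r with Equivalence.to (T-∧ {reach t cs u (i₁ , j₁)}) r
  ...     | r₁ , r₂ with no-cross sep t u (i₁ , j₁) w∈ lt r₁ | adj-cases i₁ j₁ i₂ j₂ r₂
  ...       | lt₁ | inj₁ le = ≤-<-trans le lt₁
  ...       | lt₁ | inj₂ (≡.refl , ≡.refl) with i₁ ≟ i
  ...         | no ne = s≤s (ℕₚ.≤∧≢⇒< (ℕₚ.≤-pred lt₁) ne)
  ...         | yes ≡.refl = ⊥-elim (<⇒≱ (proj₂ (proj₂ (∈-cells⁻ {f} {g} {L} v∈))) (≤-trans sep (proj₁ (proj₂ (∈-cells⁻ {f} {g} {L} w∈)))))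

  length-row : ∀ i → i < L → f i ∸ g i ≤ length cs
  length-row i i<L = ≤-trans (≤-reflexive (≡.trans (≡.sym (seg-length i (g i) (f i ∸ g i))) (≡.cong length (≡.sym (rowCells≡seg i))))) (go (∈-upTo⁺ i<L))
    where
    seg-length : ∀ i j k → length (seg i j k) ≡ k
    seg-length i j zero    = ≡.refl
    seg-length i j (suc k) = ≡.cong suc (seg-length i (suc j) k)
    go : ∀ {xs} → i ∈ xs → length (rowCells i) ≤ length (concatMap rowCells xs)
    go {x ∷ xs} (here ≡.refl) = ≤-trans (m≤m+n _ _) (≤-reflexive (≡.sym (length-++ (rowCells x))))
    go {x ∷ xs} (there p)     = ≤-trans (go p) (≤-trans (m≤n+m _ (length (rowCells x))) (≤-reflexive (≡.sym (length-++ (rowCells x)))))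

  length-pos : ∀ {v} → v ∈ cs → 1 ≤ length cs
  length-pos v∈ with cs
  length-pos (here _)  | _ ∷ _ = s≤s z≤n
  length-pos (there _) | _ ∷ _ = s≤s z≤n

  leftwards : ∀ i j k t u → i < L → g i ≤ j → k + j < f i → T (reach t cs u (i , k + j)) → T (reach (k + t) cs u (i , j))
  leftwards i j zero    t u i<L le lt p = p
  leftwards i j (suc k) t u i<L le lt p = ≡.subst (λ z → T (reach z cs u (i , j))) (ℕₚ.+-suc k t)
    (leftwards i j k (suc t) u i<L le (<⇒≤ lt)
      (reach-step t u (i , suc (k + j)) (i , k + j) (∈-cells⁺ {f} {g} i<L (≤-trans le (m≤n+m j (suc k))) lt) p (adj-left i (k + j))))

  -- Step down from the first cell of row i, then walk left to the first cell of row i+1. The path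
  -- has g i - g (i+1) + 1 steps, at most the number of cells of row i+1, so it fits into the
  -- `length cs` rounds allowed to `reach`.
  cross : ∀ i → suc i < L → g i < f (suc i) → T (reach (length cs) cs (i , g i) (suc i , g (suc i)))
  cross i lt sep = reach-mono (i , g i) (suc i , g (suc i)) bound
    (leftwards (suc i) (g (suc i)) k 1 (i , g i) lt ≤-refl (≡.subst (_< f (suc i)) (≡.sym k+) sep)
      (≡.subst (λ z → T (reach 1 cs (i , g i) (suc i , z))) (≡.sym k+)
        (reach-step 0 (i , g i) (i , g i) (suc i , g i) (∈-cells⁺ {f} {g} (<⇒≤ lt) ≤-refl (<-≤-trans sep (f-decr i))) (reach-refl (i , g i)) (adj-down i (g i)))))
    where
    k : ℕ
    k = g i ∸ g (suc i)
    k+ : k + g (suc i) ≡ g i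
    k+ = m∸n+n≡m (g-decr i)
    bound : k + 1 ≤ length cs
    bound = ≤-trans (≤-reflexive (ℕₚ.+-comm k 1)) (≤-trans (ℕₚ.∸-monoˡ-< sep (g-decr i)) (length-row (suc i) lt))

  -- The visited cells are controlled only as a set, namely all cells above row i: the scan asks
  -- merely whether some visited cell reaches the current one.
  record Seen (i : ℕ) (seen : List (ℕ × ℕ)) : Set where
    field
      above    : ∀ u → u ∈ seen → u ∈ cs × proj₁ u < i
      complete : ∀ u → u ∈ cs → proj₁ u < i → u ∈ seen

  -- It is 1 when the scan meets a new component at the first cell of row i: the row is nonempty and
  -- shares no column with the row above.
  start : ℕ → ℕ
  start zero    = positive (f 0 ∸ g 0)
  start (suc i) = if does (f (suc i) ≤? g i) then positive (f (suc i) ∸ g (suc i)) else 0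

  -- Each cell after the first of its row is adjacent to its left neighbour, which has just been
  -- visited, so it opens no component.
  componentsAux-tail : ∀ i j k seen rest → (i , j) ∈ seen → (∀ s → s ≤ k → (i , s + j) ∈ cs) →
    componentsAux cs seen (seg i (suc j) k ++ rest) ≡ componentsAux cs (seg i (suc j) k ʳ++ seen) rest
  componentsAux-tail i j zero    seen rest p q = ≡.refl
  componentsAux-tail i j (suc k) seen rest p q
    rewrite T⇒true (any⁺ (λ u → reach (length cs) cs u (i , suc j)) (∈⇒Any p (reach-mono (i , j) (i , suc j) (length-pos (q 0 z≤n))
      (reach-step 0 (i , j) (i , j) (i , suc j) (q 0 z≤n) (reach-refl (i , j)) (adj-right i j)))))
    = componentsAux-tail i (suc j) k ((i , suc j) ∷ seen) rest (here ≡.refl)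
        (λ s le → ≡.subst (λ z → (i , z) ∈ cs) (≡.sym (ℕₚ.+-suc s j)) (q (suc s) (s≤s le)))

  isolated : ∀ i seen → suc i < L → Seen (suc i) seen → f (suc i) ≤ g i → g (suc i) < f (suc i) →
             ¬ T (any (λ u → reach (length cs) cs u (suc i , g (suc i))) seen)
  isolated i seen lt S sep g<f t with Any⇒∈ (any⁻ (λ u → reach (length cs) cs u (suc i , g (suc i))) seen t)
  ... | u , u∈ , r = <-irrefl ≡.refl (no-cross sep (length cs) u (suc i , g (suc i)) (∈-cells⁺ {f} {g} lt ≤-refl g<f) (proj₂ (Seen.above S u u∈)) r)

  first-cell : ∀ i seen → i < L → Seen i seen → g i < f i →
    (if any (λ u → reach (length cs) cs u (i , g i)) seen then 0 else 1) ≡ start i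
  first-cell zero seen lt S g<f
    rewrite ¬T⇒false {any (λ u → reach (length cs) cs u (0 , g 0)) seen}
              (λ t → ℕₚ.n≮0 (proj₂ (Seen.above S _ (proj₁ (proj₂ (Any⇒∈ (any⁻ (λ u → reach (length cs) cs u (0 , g 0)) seen t)))))))
    with f 0 ∸ g 0 in eq
  ... | zero  = ⊥-elim (<⇒≱ g<f (ℕₚ.m∸n≡0⇒m≤n eq))
  ... | suc _ = ≡.refl
  first-cell (suc i) seen lt S g<f with f (suc i) ≤? g i
  ... | yes sep rewrite ¬T⇒false {any (λ u → reach (length cs) cs u (suc i , g (suc i))) seen} (isolated i seen lt S sep g<f) | T⇒true (ℕₚ.≤⇒≤ᵇ sep)
        with f (suc i) ∸ g (suc i) in eq
  ...   | zero  = ⊥-elim (<⇒≱ g<f (ℕₚ.m∸n≡0⇒m≤n eq))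
  ...   | suc _ = ≡.refl
  first-cell (suc i) seen lt S g<f | no ¬sep
    rewrite T⇒true (any⁺ (λ u → reach (length cs) cs u (suc i , g (suc i)))
              (∈⇒Any (Seen.complete S (i , g i) (∈-cells⁺ {f} {g} (<⇒≤ lt) ≤-refl (<-≤-trans (≰⇒> ¬sep) (f-decr i))) ≤-refl) (cross i lt (≰⇒> ¬sep))))
          | ¬T⇒false {f (suc i) ℕ.≤ᵇ g i} (λ t → ¬sep (ℕₚ.≤ᵇ⇒≤ _ _ t))
    = ≡.refl

  start-empty : ∀ i → f i ∸ g i ≡ 0 → start i ≡ 0
  start-empty zero    e rewrite e = ≡.refl
  start-empty (suc i) e with does (f (suc i) ≤? g i)
  ... | true  rewrite e = ≡.refl
  ... | false = ≡.refl

  row-step : ∀ i seen rest → i < L → Seen i seen →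
    componentsAux cs seen (seg i (g i) (f i ∸ g i) ++ rest) ≡ start i + componentsAux cs (seg i (g i) (f i ∸ g i) ʳ++ seen) rest
  row-step i seen rest lt S with f i ∸ g i in eq
  ... | zero  = ≡.cong (_+ componentsAux cs seen rest) (≡.sym (start-empty i eq))
  ... | suc k = ≡.cong₂ _+_ (first-cell i seen lt S (ℕₚ.m∸n≢0⇒n<m (λ z → ℕₚ.0≢1+n (≡.trans (≡.sym z) eq))))
                  (componentsAux-tail i (g i) k ((i , g i) ∷ seen) rest (here ≡.refl)
                    (λ s le → ∈-cells⁺ {f} {g} lt (m≤n+m (g i) s) (in-row s le)))
    where
    in-row : ∀ s → s ≤ k → s + g i < f i
    in-row s le = ≤-trans (ℕₚ.+-monoˡ-≤ (g i) (s≤s le)) (≤-reflexive (≡.trans (≡.cong (_+ g i) (≡.sym eq))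
      (m∸n+n≡m {f i} {g i} (<⇒≤ (ℕₚ.m∸n≢0⇒n<m (λ z → ℕₚ.0≢1+n (≡.trans (≡.sym z) eq)))))))

  ∈-ʳ++⁻ : ∀ {u : ℕ × ℕ} xs {ys} → u ∈ xs ʳ++ ys → u ∈ xs ⊎ u ∈ ys
  ∈-ʳ++⁻ []       p = inj₂ p
  ∈-ʳ++⁻ (x ∷ xs) p with ∈-ʳ++⁻ xs p
  ... | inj₁ q         = inj₁ (there q)
  ... | inj₂ (here e)  = inj₁ (here e)
  ... | inj₂ (there q) = inj₂ q

  ∈-ʳ++⁺ : ∀ {u : ℕ × ℕ} xs {ys} → u ∈ xs ⊎ u ∈ ys → u ∈ xs ʳ++ ys
  ∈-ʳ++⁺ []       (inj₂ q)         = q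
  ∈-ʳ++⁺ (x ∷ xs) (inj₁ (here e))  = ∈-ʳ++⁺ xs (inj₂ (here e))
  ∈-ʳ++⁺ (x ∷ xs) (inj₁ (there q)) = ∈-ʳ++⁺ xs (inj₁ q)
  ∈-ʳ++⁺ (x ∷ xs) (inj₂ q)         = ∈-ʳ++⁺ xs (inj₂ (there q))

  seg⁻ : ∀ {u} i j k → u ∈ seg i j k → ∃ λ s → s < k × u ≡ (i , s + j)
  seg⁻ i j (suc k) (here e)  = 0 , s≤s z≤n , e
  seg⁻ i j (suc k) (there p) with seg⁻ i (suc j) k p
  ... | s , lt , e = suc s , s≤s lt , ≡.trans e (≡.cong (i ,_) (ℕₚ.+-suc s j))

  seg⁺ : ∀ i j k s → s < k → (i , s + j) ∈ seg i j k
  seg⁺ i j (suc k) zero    _        = here ≡.refl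
  seg⁺ i j (suc k) (suc s) (s≤s lt) = there (≡.subst (λ z → (i , z) ∈ seg i (suc j) k) (ℕₚ.+-suc s j) (seg⁺ i (suc j) k s lt))

  Seen-suc : ∀ i seen → i < L → Seen i seen → Seen (suc i) (seg i (g i) (f i ∸ g i) ʳ++ seen)
  Seen-suc i seen lt S = record { above = up ; complete = all }
    where
    up : ∀ u → u ∈ seg i (g i) (f i ∸ g i) ʳ++ seen → u ∈ cs × proj₁ u < suc i
    up u p with ∈-ʳ++⁻ (seg i (g i) (f i ∸ g i)) p
    ... | inj₂ q = proj₁ (Seen.above S u q) , ℕₚ.m<n⇒m<1+n (proj₂ (Seen.above S u q))
    ... | inj₁ q with seg⁻ i (g i) (f i ∸ g i) q
    ...   | s , s<k , ≡.refl = ∈-cells⁺ {f} {g} lt (m≤n+m (g i) s)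
                (≤-trans (ℕₚ.+-monoˡ-≤ (g i) s<k) (≤-reflexive (m∸n+n≡m {f i} {g i} (<⇒≤ (ℕₚ.m∸n≢0⇒n<m (λ z → ℕₚ.n≮0 (≡.subst (s <_) z s<k))))))) , ≤-refl
    all : ∀ u → u ∈ cs → proj₁ u < suc i → u ∈ seg i (g i) (f i ∸ g i) ʳ++ seen
    all (i' , j) u∈ lt' with i' ≟ i
    ... | no ne = ∈-ʳ++⁺ (seg i (g i) (f i ∸ g i)) (inj₂ (Seen.complete S (i' , j) u∈ (ℕₚ.≤∧≢⇒< (ℕₚ.≤-pred lt') ne)))
    ... | yes ≡.refl with ∈-cells⁻ {f} {g} {L} u∈
    ...   | _ , g≤j , j<f = ∈-ʳ++⁺ (seg i (g i) (f i ∸ g i)) (inj₁ (≡.subst (λ z → (i , z) ∈ seg i (g i) (f i ∸ g i)) (m∸n+n≡m g≤j)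
                              (seg⁺ i (g i) (f i ∸ g i) (j ∸ g i) (ℕₚ.∸-monoˡ-< j<f g≤j))))

  starts : ℕ → ℕ → ℕ
  starts i zero    = 0
  starts i (suc r) = start i + starts (suc i) r

  componentsAux-rows : ∀ i r seen → i + r ≡ L → Seen i seen → componentsAux cs seen (rowsFrom i r) ≡ starts i r
  componentsAux-rows i zero    seen e S = ≡.refl
  componentsAux-rows i (suc r) seen e S = ≡.trans (row-step i seen (rowsFrom (suc i) r) lt S)
    (≡.cong (start i +_) (componentsAux-rows (suc i) r _ (≡.trans (≡.sym (ℕₚ.+-suc i r)) e) (Seen-suc i seen lt S)))
    where
    lt : i < L
    lt = ≤-trans (≤-trans (m≤m+n (suc i) r) (≤-reflexive (≡.sym (ℕₚ.+-suc i r)))) (≤-reflexive e)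

  end : ℕ → ℕ
  end = rowEnd f g

  ends : ℕ → ℕ → ℕ
  ends = rowEnds f g

  -- It is 1 when rows i and i+1 share a column. A nonempty row either ends its component or is
  -- linked downwards, and either starts one in the scan or is linked upwards; this yields the next
  -- two equations.
  link : ℕ → ℕ
  link i = if does (f (suc i) ≤? g i) then 0 else 1

  end+link : ∀ i → positive (f i ∸ g i) ≡ end i + link i
  end+link i with f (suc i) ≤? g i
  ... | yes le rewrite T⇒true (ℕₚ.≤⇒≤ᵇ le) = ≡.sym (ℕₚ.+-identityʳ _)
  ... | no gt  rewrite ¬T⇒false {f (suc i) ℕ.≤ᵇ g i} (λ t → gt (ℕₚ.≤ᵇ⇒≤ _ _ t)) with f i ∸ g i in eq
  ...   | zero  = ⊥-elim (gt (≤-trans (f-decr i) (ℕₚ.m∸n≡0⇒m≤n eq)))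
  ...   | suc _ = ≡.refl

  start+link : ∀ i → start (suc i) + link i ≡ positive (f (suc i) ∸ g (suc i))
  start+link i with f (suc i) ≤? g i
  ... | yes le rewrite T⇒true (ℕₚ.≤⇒≤ᵇ le) = ℕₚ.+-identityʳ _
  ... | no gt  rewrite ¬T⇒false {f (suc i) ℕ.≤ᵇ g i} (λ t → gt (ℕₚ.≤ᵇ⇒≤ _ _ t)) with f (suc i) ∸ g (suc i) in eq
  ...   | zero  = ⊥-elim (gt (≤-trans (ℕₚ.m∸n≡0⇒m≤n eq) (g-decr i)))
  ...   | suc _ = ≡.refl

  link-end : ∀ i → f (suc i) ≡ 0 → link i ≡ 0
  link-end i e rewrite e = ≡.refl

  -- In each row the start and end indicators differ by the links above and below it. Summed over
  -- the rows these differences telescope, and there is no link past the last row because f vanishes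
  -- there.
  shift-starts : ∀ i r → f (suc i + r) ≡ 0 → starts (suc i) r + link i ≡ ends (suc i) r
  shift-starts i zero    e = link-end i (≡.trans (≡.cong f (≡.sym (ℕₚ.+-identityʳ (suc i)))) e)
  shift-starts i (suc r) e = begin
    start (suc i) + starts (2 + i) r + link i       ≡⟨ ≡.cong (_+ link i) (ℕₚ.+-comm (start (suc i)) _) ⟩
    starts (2 + i) r + start (suc i) + link i       ≡⟨ ℕₚ.+-assoc (starts (2 + i) r) _ _ ⟩
    starts (2 + i) r + (start (suc i) + link i)     ≡⟨ ≡.cong (starts (2 + i) r +_) (≡.trans (start+link i) (end+link (suc i))) ⟩
    starts (2 + i) r + (end (suc i) + link (suc i)) ≡⟨ ≡.cong (starts (2 + i) r +_) (ℕₚ.+-comm (end (suc i)) _) ⟩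
    starts (2 + i) r + (link (suc i) + end (suc i)) ≡⟨ ℕₚ.+-assoc (starts (2 + i) r) _ _ ⟨
    starts (2 + i) r + link (suc i) + end (suc i)   ≡⟨ ≡.cong (_+ end (suc i)) (shift-starts (suc i) r (≡.trans (≡.cong f (≡.sym (ℕₚ.+-suc (suc i) r))) e)) ⟩
    ends (2 + i) r + end (suc i)                    ≡⟨ ℕₚ.+-comm _ (end (suc i)) ⟩
    end (suc i) + ends (2 + i) r                    ∎
    where open ≡.≡-Reasoning

  components : f L ≡ 0 → componentsAux cs [] cs ≡ ends 0 L
  components e = ≡.trans (≡.cong (componentsAux cs []) cs≡rowsFrom)
    (≡.trans (componentsAux-rows 0 L [] ≡.refl (record { above = λ _ () ; complete = λ _ _ () })) (total L e))
    where
    total : ∀ L → f L ≡ 0 → starts 0 L ≡ ends 0 L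
    total zero    e = ≡.refl
    total (suc r) e = begin
      start 0 + starts 1 r              ≡⟨ ≡.cong (_+ starts 1 r) (end+link 0) ⟩
      end 0 + link 0 + starts 1 r       ≡⟨ ℕₚ.+-assoc (end 0) _ _ ⟩
      end 0 + (link 0 + starts 1 r)     ≡⟨ ≡.cong (end 0 +_) (≡.trans (ℕₚ.+-comm (link 0) _) (shift-starts 0 r e)) ⟩
      end 0 + ends 1 r                  ∎
      where open ≡.≡-Reasoning

-- Partitions as zero-padded vectors.

-- Prepending a part to an already trimmed list: a zero is dropped exactly when nothing follows it.
-- This expresses `trim` recursively on its own results.
tcons : ℕ → List ℕ → List ℕ
tcons x []       = if x ≡ᵇ 0 then [] else x ∷ []
tcons x (y ∷ ys) = x ∷ y ∷ ys

trim-∷ : ∀ x xs → trim (x ∷ xs) ≡ tcons x (trim xs)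
trim-∷ x xs with trim xs
... | []    = ≡.refl
... | _ ∷ _ = ≡.refl

at-tcons-0 : ∀ x ys → at (tcons x ys) 0 ≡ x
at-tcons-0 zero    []      = ≡.refl
at-tcons-0 (suc x) []      = ≡.refl
at-tcons-0 x       (_ ∷ _) = ≡.refl

at-tcons-suc : ∀ x ys i → at (tcons x ys) (suc i) ≡ at ys i
at-tcons-suc zero    []      i = ≡.refl
at-tcons-suc (suc x) []      i = ≡.refl
at-tcons-suc x       (_ ∷ _) i = ≡.refl

at-trim : ∀ xs → at (trim xs) ≗ at xs
at-trim []       i       = ≡.refl
at-trim (x ∷ xs) zero    = ≡.trans (≡.cong (λ ys → at ys 0) (trim-∷ x xs)) (at-tcons-0 x (trim xs))
at-trim (x ∷ xs) (suc i) = ≡.trans (≡.cong (λ ys → at ys (suc i)) (trim-∷ x xs)) (≡.trans (at-tcons-suc x (trim xs) i) (at-trim xs i))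

length-tcons : ∀ x ys → length (tcons x ys) ≤ suc (length ys)
length-tcons zero    []      = z≤n
length-tcons (suc x) []      = ≤-refl
length-tcons x       (_ ∷ _) = ≤-refl

length-trim : ∀ xs → length (trim xs) ≤ length xs
length-trim []       = z≤n
length-trim (x ∷ xs) = ≤-trans (≤-reflexive (≡.cong length (trim-∷ x xs))) (≤-trans (length-tcons x (trim xs)) (s≤s (length-trim xs)))

sum-tcons : ∀ x ys → sum (tcons x ys) ≡ x + sum ys
sum-tcons zero    []      = ≡.refl
sum-tcons (suc x) []      = ≡.refl
sum-tcons x       (_ ∷ _) = ≡.refl

at-length : ∀ xs i → length xs ≤ i → at xs i ≡ 0
at-length []       i       _        = ≡.refl
at-length (x ∷ xs) (suc i) (s≤s le) = at-length xs i le

headOr0≡at : ∀ xs → headOr0 xs ≡ at xs 0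
headOr0≡at []      = ≡.refl
headOr0≡at (_ ∷ _) = ≡.refl

-- The bridge between the vectors of the Cauchy argument and the trimmed lists over which the
-- polynomials are defined.
shape : ∀ {n} → Vec ℕ n → List ℕ
shape v = trim (toList v)

part : ∀ {n} → Vec ℕ n → ℕ → ℕ
part v = at (toList v)

part-0 : ∀ {n} (v : Vec ℕ n) → part v 0 ≡ hd v
part-0 []      = ≡.refl
part-0 (x ∷ v) = ≡.refl

part-length : ∀ {n} (v : Vec ℕ n) i → n ≤ i → part v i ≡ 0
part-length []      i       _        = ≡.refl
part-length (x ∷ v) (suc i) (s≤s le) = part-length v i le

at-shape : ∀ {n} (v : Vec ℕ n) → at (shape v) ≗ part v
at-shape v = at-trim (toList v)

length-toList : ∀ {n} (v : Vec ℕ n) → length (toList v) ≡ n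
length-toList []      = ≡.refl
length-toList (x ∷ v) = ≡.cong suc (length-toList v)

length-shape : ∀ {n} (v : Vec ℕ n) → length (shape v) ≤ n
length-shape v = ≤-trans (length-trim (toList v)) (≤-reflexive (length-toList v))

sum-shape : ∀ {n} (v : Vec ℕ n) → sum (shape v) ≡ sumV v
sum-shape []      = ≡.refl
sum-shape (x ∷ v) = ≡.trans (≡.cong sum (trim-∷ x (toList v))) (≡.trans (sum-tcons x (shape v)) (≡.cong (x +_) (sum-shape v)))

part-decr : ∀ {n} (v : Vec ℕ n) → Decr v → ∀ i → part v (suc i) ≤ part v i
part-decr []      _       i       = z≤n
part-decr (x ∷ v) (h , d) zero    = ≤-trans (≤-reflexive (part-0 v)) h
part-decr (x ∷ v) (h , d) (suc i) = part-decr v d i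

part≤hd : ∀ {n} (v : Vec ℕ n) → Decr v → ∀ i → part v i ≤ hd v
part≤hd v d zero    = ≤-reflexive (part-0 v)
part≤hd v d (suc i) = ≤-trans (part-decr v d i) (part≤hd v d i)

skewCells-shape : ∀ {n} (κ ν : Vec ℕ n) → skewCells (shape κ) (shape ν) ≡ cellsOf (part κ) (part ν) n
skewCells-shape {n} κ ν = begin
  cellsOf (at (shape κ)) (at (shape ν)) k        ≡⟨ cellsOf-extend (n ∸ k) (λ i le → at-length (shape κ) i le) ⟨
  cellsOf (at (shape κ)) (at (shape ν)) (n ∸ k + k) ≡⟨ ≡.cong (cellsOf (at (shape κ)) (at (shape ν))) (m∸n+n≡m (length-shape κ)) ⟩
  cellsOf (at (shape κ)) (at (shape ν)) n        ≡⟨ cellsOf-cong n (at-shape κ) (at-shape ν) ⟩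
  cellsOf (part κ) (part ν) n                    ∎
  where
  open ≡.≡-Reasoning
  k : ℕ
  k = length (shape κ)

-- Local contributions: every column is charged to the lowest row that meets it, every component to
-- its lowest row.
rowsV colsV compsV : ∀ {n} → Vec ℕ n → Vec ℕ n → ℕ
rowsV  []      []      = 0
rowsV  (l ∷ κ) (m ∷ ν) = positive (l ∸ m) + rowsV κ ν
colsV  []      []      = 0
colsV  (l ∷ κ) (m ∷ ν) = (l ∸ (m ⊔ hd κ)) + colsV κ ν
compsV []      []      = 0
compsV (l ∷ κ) (m ∷ ν) = (if does (hd κ ≤? m) then positive (l ∸ m) else 0) + compsV κ ν

bit-< : ∀ m l → bit (m <ᵇ l) ≡ positive (l ∸ m)
bit-< m       zero    = ≡.cong positive (≡.sym (ℕₚ.0∸n≡0 m))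
bit-< zero    (suc l) = ≡.refl
bit-< (suc m) (suc l) = bit-< m l

rBar-shape : ∀ {n} (μ : Vec ℕ n) κ → rBar (shape μ) (shape κ) ≡ cornerCount μ κ
rBar-shape {n} μ κ = begin
  rBar (shape μ) (shape κ)                                          ≡⟨ countB≡cnt _ (length (shape μ)) ⟩
  cnt (length (shape μ)) (λ i → at (shape κ) (suc i) <ᵇ at (shape μ) i)
    ≡⟨ cnt-extend (length-shape μ) (λ i le → ≡.cong (at (shape κ) (suc i) <ᵇ_) (at-length (shape μ) i le)) ⟩
  cnt n (λ i → at (shape κ) (suc i) <ᵇ at (shape μ) i)
    ≡⟨ cnt-cong n (λ i _ → ≡.cong₂ _<ᵇ_ (at-shape κ (suc i)) (at-shape μ i)) ⟩
  cnt n (λ i → part κ (suc i) <ᵇ part μ i)                          ≡⟨ go μ κ ⟩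
  cornerCount μ κ                                                   ∎
  where
  open ≡.≡-Reasoning
  go : ∀ {n} (μ : Vec ℕ n) (κ : Vec ℕ (suc n)) → cnt n (λ i → part κ (suc i) <ᵇ part μ i) ≡ cornerCount μ κ
  go []      κ       = ≡.refl
  go (m ∷ μ) (l ∷ κ) = ≡.cong₂ _+_ (≡.trans (bit-< (part κ 0) m) (≡.cong (λ z → positive (m ∸ z)) (part-0 κ))) (go μ κ)

nRows-shape : ∀ {n} (κ ν : Vec ℕ n) → nRows (shape κ) (shape ν) ≡ rowsV κ ν
nRows-shape {n} κ ν = begin
  nRows (shape κ) (shape ν)                                         ≡⟨ countB≡cnt _ (length (shape κ)) ⟩
  cnt (length (shape κ)) (λ i → any (λ x → proj₁ x ≡ᵇ i) (skewCells (shape κ) (shape ν)))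
    ≡⟨ cnt-cong (length (shape κ)) (λ i lt → ≡.trans (row-nonempty (at (shape κ)) (at (shape ν)) (length (shape κ)) i lt)
         (≡.cong₂ _<ᵇ_ (at-shape ν i) (at-shape κ i))) ⟩
  cnt (length (shape κ)) (λ i → part ν i <ᵇ part κ i)
    ≡⟨ cnt-extend (length-shape κ) (λ i le → ≡.cong (part ν i <ᵇ_) (≡.trans (≡.sym (at-shape κ i)) (at-length (shape κ) i le))) ⟩
  cnt n (λ i → part ν i <ᵇ part κ i)                                ≡⟨ go κ ν ⟩
  rowsV κ ν                                                         ∎
  where
  open ≡.≡-Reasoning
  go : ∀ {n} (κ ν : Vec ℕ n) → cnt n (λ i → part ν i <ᵇ part κ i) ≡ rowsV κ ν
  go []      []      = ≡.refl
  go (l ∷ κ) (m ∷ ν) = ≡.cong₂ _+_ (bit-< m l) (go κ ν)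

-- A column left of `hd κ` met by the first row is also met by the second, because ν is decreasing,
-- so it is counted further down. Columns from `hd κ` on can only be met by the first row.
cols-count : ∀ {n} (κ ν : Vec ℕ n) → Decr κ → Decr ν → cnt (hd κ) (hit n (part κ) (part ν)) ≡ colsV κ ν
cols-count []      []      _       _       = ≡.refl
cols-count {suc n} (l ∷ κ) (m ∷ ν) (hκ , dκ) (hν , dν) = begin
  cnt l h                                             ≡⟨ ≡.cong (λ z → cnt z h) (m+[n∸m]≡n hκ) ⟨
  cnt (hd κ + (l ∸ hd κ)) h                           ≡⟨ cnt-split (hd κ) (l ∸ hd κ) h ⟩
  cnt (hd κ) h + cnt (l ∸ hd κ) (λ j → h (hd κ + j))  ≡⟨ ≡.cong₂ _+_ (≡.trans (cnt-cong (hd κ) low) (cols-count κ ν dκ dν)) (≡.trans (cnt-cong (l ∸ hd κ) high) (cnt-≥ (l ∸ hd κ) m (hd κ))) ⟩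
  colsV κ ν + (hd κ + (l ∸ hd κ) ∸ (m ⊔ hd κ))        ≡⟨ ≡.cong (λ z → colsV κ ν + (z ∸ (m ⊔ hd κ))) (m+[n∸m]≡n hκ) ⟩
  colsV κ ν + (l ∸ (m ⊔ hd κ))                        ≡⟨ ℕₚ.+-comm (colsV κ ν) _ ⟩
  (l ∸ (m ⊔ hd κ)) + colsV κ ν                        ∎
  where
  open ≡.≡-Reasoning
  h : ℕ → Bool
  h = hit (suc n) (part (l ∷ κ)) (part (m ∷ ν))
  first-hit : ∀ {n} (κ ν : Vec ℕ n) {j} → hd ν ≤ j → j < hd κ → T (hit n (part κ) (part ν) j)
  first-hit {suc n} (x ∷ κ) (y ∷ ν) p q = hit⁺ (suc n) (part (x ∷ κ)) (part (y ∷ ν)) {0} (s≤s z≤n) p q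
  low : ∀ j → j < hd κ → h j ≡ hit n (part κ) (part ν) j
  low j lt = T-ext to (λ t → Equivalence.from (T-∨ {(m <ᵇ suc j) ∧ (j <ᵇ l)}) (inj₂ t))
    where
    to : T (h j) → T (hit n (part κ) (part ν) j)
    to t with Equivalence.to (T-∨ {(m <ᵇ suc j) ∧ (j <ᵇ l)}) t
    ... | inj₂ q = q
    ... | inj₁ q = first-hit κ ν (≤-trans hν (ℕₚ.≤-pred (ℕₚ.<ᵇ⇒< m (suc j) (proj₁ (Equivalence.to (T-∧ {m <ᵇ suc j}) q))))) lt
  high : ∀ j → j < l ∸ hd κ → h (hd κ + j) ≡ (m <ᵇ suc (hd κ + j))
  high j lt = T-ext to (λ t → Equivalence.from T-∨ (inj₁ (Equivalence.from (T-∧ {m <ᵇ suc (hd κ + j)}) (t , ℕₚ.<⇒<ᵇ bound))))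
    where
    bound : hd κ + j < l
    bound = ≤-trans (≤-reflexive (≡.sym (ℕₚ.+-suc (hd κ) j))) (≤-trans (ℕₚ.+-monoʳ-≤ (hd κ) lt) (≤-reflexive (m+[n∸m]≡n hκ)))
    to : T (h (hd κ + j)) → T (m <ᵇ suc (hd κ + j))
    to t with Equivalence.to (T-∨ {(m <ᵇ suc (hd κ + j)) ∧ (hd κ + j <ᵇ l)}) t
    ... | inj₁ q = proj₁ (Equivalence.to (T-∧ {m <ᵇ suc (hd κ + j)}) q)
    ... | inj₂ q with hit⁻ n (part κ) (part ν) q
    ...   | i , _ , _ , lt' = ⊥-elim (<⇒≱ lt' (≤-trans (part≤hd κ dκ i) (m≤m+n (hd κ) j)))

nCols-shape : ∀ {n} (κ ν : Vec ℕ n) → Decr κ → Decr ν → nCols (shape κ) (shape ν) ≡ colsV κ ν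
nCols-shape {n} κ ν dκ dν = begin
  nCols (shape κ) (shape ν)                                         ≡⟨ countB≡cnt _ (headOr0 (shape κ)) ⟩
  cnt (headOr0 (shape κ)) (λ j → any (λ x → proj₂ x ≡ᵇ j) (skewCells (shape κ) (shape ν)))
    ≡⟨ ≡.cong₂ (λ z cs → cnt z (λ j → any (λ x → proj₂ x ≡ᵇ j) cs)) (≡.trans (headOr0≡at (shape κ)) (≡.trans (at-shape κ 0) (part-0 κ))) (skewCells-shape κ ν) ⟩
  cnt (hd κ) (λ j → any (λ x → proj₂ x ≡ᵇ j) (cellsOf (part κ) (part ν) n))
    ≡⟨ cnt-cong (hd κ) (λ j _ → column-hit (part κ) (part ν) n j) ⟩
  cnt (hd κ) (hit n (part κ) (part ν))                              ≡⟨ cols-count κ ν dκ dν ⟩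
  colsV κ ν                                                         ∎
  where open ≡.≡-Reasoning

nComps-shape : ∀ {n} (κ ν : Vec ℕ n) → Decr κ → Decr ν → nComps (shape κ) (shape ν) ≡ compsV κ ν
nComps-shape {n} κ ν dκ dν = begin
  nComps (shape κ) (shape ν)                     ≡⟨ ≡.cong (λ cs → componentsAux cs [] cs) (skewCells-shape κ ν) ⟩
  componentsAux _ [] (cellsOf (part κ) (part ν) n) ≡⟨ Components.components (part κ) (part ν) n (part-decr κ dκ) (part-decr ν dν) (part-length κ n ≤-refl) ⟩
  rowEnds (part κ) (part ν) 0 n                  ≡⟨ go κ ν ⟩
  compsV κ ν                                     ∎
  where
  open ≡.≡-Reasoning
  shift : ∀ f g i r → rowEnds f g (suc i) r ≡ rowEnds (f ∘ suc) (g ∘ suc) i r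
  shift f g i zero    = ≡.refl
  shift f g i (suc r) = ≡.cong (rowEnd f g (suc i) +_) (shift f g (suc i) r)
  go : ∀ {n} (κ ν : Vec ℕ n) → rowEnds (part κ) (part ν) 0 n ≡ compsV κ ν
  go []      []      = ≡.refl
  go {suc n} (l ∷ κ) (m ∷ ν) = ≡.cong₂ _+_ (≡.cong (λ z → if does (z ≤? m) then positive (l ∸ m) else 0) (part-0 κ))
                                 (≡.trans (shift (part (l ∷ κ)) (part (m ∷ ν)) 0 n) (go κ ν))

-- The weight of a skew shape as a monomial in its statistics.

module SkewExponents {c ℓ} (R : CommutativeRing c ℓ) (β q p y : CommutativeRing.Carrier R) where
  open Sums R
  open SkewWeight R β q p y

  monomial : ℕ → ℕ → ℕ → ℕ → A
  monomial s r c k = (pow β (r ∸ k) *R pow q ((s + k) ∸ (r + c))) *R (pow y k *R pow p (c ∸ k))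

  -- These inequalities make the truncated subtractions in `monomial` honest; then the exponents are
  -- additive and the monomial is multiplicative over rows.
  record Valid (s r c k : ℕ) : Set where
    field
      k≤r : k ≤ r
      k≤c : k ≤ c
      rc≤ : r + c ≤ s + k

  +-interchange : ∀ a b x z → (a + b) + (x + z) ≡ (a + x) + (b + z)
  +-interchange a b x z = ≡.trans (ℕₚ.+-assoc a b (x + z)) (≡.trans (≡.cong (a +_)
    (≡.trans (≡.sym (ℕₚ.+-assoc b x z)) (≡.trans (≡.cong (_+ z) (ℕₚ.+-comm b x)) (ℕₚ.+-assoc x b z)))) (≡.sym (ℕₚ.+-assoc a x (b + z))))

  Valid-+ : ∀ {s r c k s' r' c' k'} → Valid s r c k → Valid s' r' c' k' → Valid (s + s') (r + r') (c + c') (k + k')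
  Valid-+ {s} {r} {c} {k} {s'} {r'} {c'} {k'} v v' = record
    { k≤r = ℕₚ.+-mono-≤ (Valid.k≤r v) (Valid.k≤r v')
    ; k≤c = ℕₚ.+-mono-≤ (Valid.k≤c v) (Valid.k≤c v')
    ; rc≤ = ≤-trans (≤-reflexive (+-interchange r r' c c')) (≤-trans (ℕₚ.+-mono-≤ (Valid.rc≤ v) (Valid.rc≤ v')) (≤-reflexive (+-interchange s k s' k'))) }

  monomial-+ : ∀ {s r c k s' r' c' k'} → Valid s r c k → Valid s' r' c' k' →
               monomial (s + s') (r + r') (c + c') (k + k') ≈ monomial s r c k *R monomial s' r' c' k'
  monomial-+ {s} {r} {c} {k} {s'} {r'} {c'} {k'} v v' = begin
    monomial (s + s') (r + r') (c + c') (k + k')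
      ≈⟨ *-cong (*-cong (trans (reflexive (≡.cong (pow β) (∸-+-∸ (Valid.k≤r v) (Valid.k≤r v')))) (pow-+ β (r ∸ k) (r' ∸ k')))
                        (trans (reflexive (≡.cong (pow q) (≡.trans (≡.cong₂ _∸_ (+-interchange s s' k k') (+-interchange r r' c c')) (∸-+-∸ (Valid.rc≤ v) (Valid.rc≤ v')))))
                               (pow-+ q ((s + k) ∸ (r + c)) ((s' + k') ∸ (r' + c')))))
                (*-cong (pow-+ y k k') (trans (reflexive (≡.cong (pow p) (∸-+-∸ (Valid.k≤c v) (Valid.k≤c v')))) (pow-+ p (c ∸ k) (c' ∸ k')))) ⟩
    ((pow β (r ∸ k) *R pow β (r' ∸ k')) *R (pow q ((s + k) ∸ (r + c)) *R pow q ((s' + k') ∸ (r' + c')))) *R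
    ((pow y k *R pow y k') *R (pow p (c ∸ k) *R pow p (c' ∸ k')))
      ≈⟨ solve 8 (λ a a' b b' c c' d d' → ((a ⊗ a') ⊗ (b ⊗ b')) ⊗ ((c ⊗ c') ⊗ (d ⊗ d')) := ((a ⊗ b) ⊗ (c ⊗ d)) ⊗ ((a' ⊗ b') ⊗ (c' ⊗ d'))) refl _ _ _ _ _ _ _ _ ⟩
    monomial s r c k *R monomial s' r' c' k' ∎

  comp : ℕ → ℕ → ℕ → ℕ
  comp l m l' = if does (l' ≤? m) then positive (l ∸ m) else 0

  row-low-monomial : ∀ i → u i ≈ monomial i (positive i) i (positive i) × Valid i (positive i) i (positive i)
  row-low-monomial zero    = solve 0 (con 1 := (con 1 ⊗ con 1) ⊗ (con 1 ⊗ con 1)) refl , record { k≤r = z≤n ; k≤c = z≤n ; rc≤ = z≤n }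
  row-low-monomial (suc i) =
    (begin
      y *R pow p i                                     ≈⟨ solve 2 (λ y p → y ⊗ p := (con 1 ⊗ con 1) ⊗ ((y ⊗ con 1) ⊗ p)) refl y (pow p i) ⟩
      (1# *R 1#) *R ((y *R 1#) *R pow p i)             ≡⟨ ≡.cong (λ z → (1# *R pow q z) *R ((y *R 1#) *R pow p i)) (≡.trans (≡.cong (_∸ suc i) (ℕₚ.+-comm i 1)) (n∸n≡0 (suc i))) ⟨
      monomial (suc i) 1 (suc i) 1                     ∎) ,
    record { k≤r = ≤-refl ; k≤c = s≤s z≤n ; rc≤ = s≤s (≤-reflexive (ℕₚ.+-comm 1 i)) }

  row-high-monomial : ∀ i d → β *R (pow q i *R pow p d) ≈ monomial (suc i + d) 1 d 0 × Valid (suc i + d) 1 d 0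
  row-high-monomial i d =
    (begin
      β *R (pow q i *R pow p d)                        ≈⟨ solve 3 (λ b q p → b ⊗ (q ⊗ p) := ((b ⊗ con 1) ⊗ q) ⊗ (con 1 ⊗ p)) refl β _ _ ⟩
      ((β *R 1#) *R pow q i) *R (1# *R pow p d)        ≡⟨ ≡.cong (λ z → ((β *R 1#) *R pow q z) *R (1# *R pow p d)) (≡.trans (≡.cong (_∸ d) (ℕₚ.+-identityʳ (i + d))) (m+n∸n≡m i d)) ⟨
      monomial (suc i + d) 1 d 0                       ∎) ,
    record { k≤r = z≤n ; k≤c = z≤n ; rc≤ = s≤s (≤-trans (m≤n+m d i) (≤-reflexive (≡.sym (ℕₚ.+-identityʳ (i + d))))) }

  row-monomial : ∀ {l m l'} → m ≤ l → l' ≤ l →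
    row l m l' ≈ monomial (l ∸ m) (positive (l ∸ m)) (l ∸ (m ⊔ l')) (comp l m l') × Valid (l ∸ m) (positive (l ∸ m)) (l ∸ (m ⊔ l')) (comp l m l')
  row-monomial {l} {m} {l'} m≤l l'≤l with l' ≤? m
  ... | yes l'≤m rewrite T⇒true (ℕₚ.≤⇒≤ᵇ l'≤m) | ℕₚ.m≥n⇒m⊔n≡m l'≤m = row-low-monomial (l ∸ m)
  ... | no l'≰m with split< (≰⇒> l'≰m) | split≤ l'≤l
  ...   | i , e | d , e' rewrite ¬T⇒false {l' ℕ.≤ᵇ m} (λ t → l'≰m (ℕₚ.≤ᵇ⇒≤ _ _ t)) | ℕₚ.m≤n⇒m⊔n≡n (<⇒≤ (≰⇒> l'≰m))
                               | ∸-from m (chain m e' e) | ∸-from l' e' | ∸-from (suc m) (≡.trans e (ℕₚ.+-suc m i)) = row-high-monomial i d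

  Sub-sum : ∀ {n} (ν κ : Vec ℕ n) → Sub ν κ → sumV ν ≤ sumV κ
  Sub-sum []      []      _         = z≤n
  Sub-sum (m ∷ ν) (l ∷ κ) (m≤l , s) = ℕₚ.+-mono-≤ m≤l (Sub-sum ν κ s)

  -- Validity is proved along with the formula, since adjoining a row by `monomial-+` requires it
  -- for the rows below.
  b-monomial : ∀ {n} (κ ν : Vec ℕ n) → Decr κ → Sub ν κ →
    b κ ν ≈ monomial (sumV κ ∸ sumV ν) (rowsV κ ν) (colsV κ ν) (compsV κ ν) × Valid (sumV κ ∸ sumV ν) (rowsV κ ν) (colsV κ ν) (compsV κ ν)
  b-monomial []      []      _       _ = row-low-monomial 0
  b-monomial (l ∷ κ) (m ∷ ν) (h , d) (m≤l , s) with b-monomial κ ν d s | row-monomial {l} {m} {hd κ} m≤l h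
  ... | e , v | e' , v' rewrite ∸-+-∸ m≤l (Sub-sum ν κ s) =
    trans (*-cong (trans (I*-yes (m ≤? l) m≤l) (trans (I*-yes (hd κ ≤? l) h) e')) e) (sym (monomial-+ v' v)) , Valid-+ v' v

-- Enumerations of partitions as sums over cubes.

tail : List ℕ → List ℕ
tail []       = []
tail (_ ∷ xs) = xs

at-tail : ∀ xs i → at (tail xs) i ≡ at xs (suc i)
at-tail []       i = ≡.refl
at-tail (_ ∷ xs) i = ≡.refl

-- The condition describing the output of `subBounded k xs` after padding with zeros: parts bounded
-- by their predecessor, initially k, and by the parts of `xs`.
SubB : ∀ {n} → ℕ → Vec ℕ n → List ℕ → Set
SubB k []      xs = ⊤
SubB k (x ∷ v) xs = x ≤ k × x ≤ at xs 0 × SubB x v (tail xs)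

SubB? : ∀ {n} k (v : Vec ℕ n) xs → Dec (SubB k v xs)
SubB? k []      xs = yes tt
SubB? k (x ∷ v) xs = (x ≤? k) ×-dec ((x ≤? at xs 0) ×-dec SubB? x v (tail xs))

SubB⇒Decr : ∀ {n} k (v : Vec ℕ n) xs → SubB k v xs → hd v ≤ k × Decr v
SubB⇒Decr k []      xs _           = z≤n , tt
SubB⇒Decr k (x ∷ v) xs (p , _ , s) = p , SubB⇒Decr x v (tail xs) s

SubB⇒part : ∀ {n} k (v : Vec ℕ n) xs → SubB k v xs → ∀ i → part v i ≤ at xs i
SubB⇒part k []      xs _           i       = z≤n
SubB⇒part k (x ∷ v) xs (_ , q , s) zero    = q
SubB⇒part k (x ∷ v) xs (_ , q , s) (suc i) = ≤-trans (SubB⇒part x v (tail xs) s i) (≤-reflexive (at-tail xs i))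

Decr⇒SubB : ∀ {n} k (v : Vec ℕ n) xs → hd v ≤ k → Decr v → (∀ i → part v i ≤ at xs i) → SubB k v xs
Decr⇒SubB k []      xs _ _       _ = tt
Decr⇒SubB k (x ∷ v) xs p (h , d) q = p , q 0 , Decr⇒SubB x v (tail xs) h d (λ i → ≤-trans (q (suc i)) (≤-reflexive (≡.sym (at-tail xs i))))

part⇒Sub : ∀ {n} (v κ : Vec ℕ n) → (∀ i → part v i ≤ part κ i) → Sub v κ
part⇒Sub []      []      _ = tt
part⇒Sub (x ∷ v) (l ∷ κ) q = q 0 , part⇒Sub v κ (q ∘ suc)

Sub⇒part : ∀ {n} (v κ : Vec ℕ n) → Sub v κ → ∀ i → part v i ≤ part κ i
Sub⇒part []      []      _       i       = z≤n
Sub⇒part (x ∷ v) (l ∷ κ) (p , s) zero    = p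
Sub⇒part (x ∷ v) (l ∷ κ) (p , s) (suc i) = Sub⇒part v κ s i

tcons-≢0 : ∀ {t ys i} → at ys i ≢ 0 → at (tcons t ys) (suc i) ≢ 0
tcons-≢0 {t} {ys} {i} ne e = ne (≡.trans (≡.sym (at-tcons-suc t ys i)) e)

headOr0-shape : ∀ {n} (κ : Vec ℕ n) → headOr0 (shape κ) ≡ hd κ
headOr0-shape κ = ≡.trans (headOr0≡at (shape κ)) (≡.trans (at-shape κ 0) (part-0 κ))

module ListSums {c ℓ} (R : CommutativeRing c ℓ) (N : ℕ) where
  open Sums R
  open Cubes R N

  I-× : ∀ {P Q : Set} (d : Dec P) (d' : Dec Q) → I (d ×-dec d') ≈ I d *R I d'
  I-× d d' with does d
  ... | true  = sym (*-identityˡ _)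
  ... | false = sym (zeroˡ _)

  Σᴸ-range : ∀ lo hi (f : ℕ → A) → Σᴸ (map f (range lo hi)) ≈ ∑ (suc (hi ∸ lo)) (λ j → f (lo + j))
  Σᴸ-range lo hi f = trans (Σᴸ-map (upTo (suc (hi ∸ lo))) f (lo +_)) (∑-upTo (suc (hi ∸ lo)) (λ j → f (lo + j)) id)

  strips : List ℕ → (List ℕ → A) → A
  strips lam F = Σᴸ (map F (map trim (hsRaw lam)))

  strips-∷ : ∀ l ls F → strips (l ∷ ls) F ≈ ∑ (suc (l ∸ headOr0 ls)) (λ j → strips ls (F ∘ tcons (headOr0 ls + j)))
  strips-∷ l ls F = begin
    Σᴸ (map F (map trim (hsRaw (l ∷ ls))))
      ≈⟨ Σᴸ-map (hsRaw (l ∷ ls)) F trim ⟩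
    Σᴸ (map (F ∘ trim) (hsRaw (l ∷ ls)))
      ≈⟨ Σᴸ-concatMap (range (headOr0 ls) l) (F ∘ trim) (λ t → map (t ∷_) (hsRaw ls)) ⟩
    Σᴸ (map (λ t → Σᴸ (map (F ∘ trim) (map (t ∷_) (hsRaw ls)))) (range (headOr0 ls) l))
      ≈⟨ Σᴸ-cong (range (headOr0 ls) l) (λ t → trans (Σᴸ-map (hsRaw ls) (F ∘ trim) (t ∷_))
           (trans (Σᴸ-cong (hsRaw ls) (λ μ → reflexive (≡.cong F (trim-∷ t μ)))) (sym (Σᴸ-map (hsRaw ls) (F ∘ tcons t) trim)))) ⟩
    Σᴸ (map (λ t → strips ls (F ∘ tcons t)) (range (headOr0 ls) l))
      ≈⟨ Σᴸ-range (headOr0 ls) l (λ t → strips ls (F ∘ tcons t)) ⟩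
    ∑ (suc (l ∸ headOr0 ls)) (λ j → strips ls (F ∘ tcons (headOr0 ls + j))) ∎

  strips-tcons : ∀ l ls F → strips (tcons l ls) F ≈ ∑ (suc (l ∸ headOr0 ls)) (λ j → strips ls (F ∘ tcons (headOr0 ls + j)))
  strips-tcons zero    []       F = sym (+-identityʳ _)
  strips-tcons (suc l) []       F = strips-∷ (suc l) [] F
  strips-tcons l       (y ∷ ys) F = strips-∷ l (y ∷ ys) F

  strips-shape : ∀ {n} l (κ : Vec ℕ n) F → strips (shape (l ∷ κ)) F ≈ ∑ (suc (l ∸ hd κ)) (λ j → strips (shape κ) (F ∘ tcons (hd κ + j)))
  strips-shape l κ F = trans (reflexive (≡.cong (λ z → strips z F) (trim-∷ l (toList κ)))) (trans (strips-tcons l (shape κ) F)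
    (reflexive (≡.cong (λ z → ∑ (suc (l ∸ z)) (λ j → strips (shape κ) (F ∘ tcons (z + j)))) (headOr0-shape κ))))

  -- A partition inside κ may have n + 1 parts, one more than a vector of length n can hold;
  -- `vanish` disposes of these, and for G it holds by `Gr-vanish`.
  strips-cube : ∀ n (κ : Vec ℕ (suc n)) F → Decr κ → Bounded κ → (∀ xs → at xs n ≢ 0 → F xs ≈ 0#) →
                strips (shape κ) F ≈ cube n (λ μ → I (Inter? μ κ) *R F (shape μ))
  strips-cube zero (l ∷ []) F d b vanish = begin
    strips (shape (l ∷ [])) F                      ≈⟨ strips-shape l [] F ⟩
    ∑ (suc l) (λ j → F (tcons j []) +R 0#)         ≈⟨ ∑-single (suc l) 0 (s≤s z≤n) other ⟩
    F [] +R 0#                                     ≈⟨ +-identityʳ _ ⟩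
    F []                                           ≈⟨ *-identityˡ _ ⟨
    1# *R F []                                     ∎
    where
    other : ∀ j → j < suc l → j ≢ 0 → F (tcons j []) +R 0# ≈ 0#
    other j _ ne = trans (+-identityʳ _) (vanish (tcons j []) (λ e → ne (≡.trans (≡.sym (at-tcons-0 j [])) e)))
  strips-cube (suc n) (l ∷ κ) F (h , d) (l<N , b) vanish = begin
    strips (shape (l ∷ κ)) F
      ≈⟨ strips-shape l κ F ⟩
    ∑ (suc (l ∸ hd κ)) (λ j → strips (shape κ) (F ∘ tcons (hd κ + j)))
      ≈⟨ ∑-cong (suc (l ∸ hd κ)) (λ j → strips-cube n κ (F ∘ tcons (hd κ + j)) d b (λ xs ne → vanish _ (tcons-≢0 {hd κ + j} {xs} ne))) ⟩
    ∑ (suc (l ∸ hd κ)) (λ j → C (hd κ + j))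
      ≈⟨ ∑-cong< (suc (l ∸ hd κ)) {λ j → C (hd κ + j)} (λ { j (s≤s le) → sym (trans (I*-yes (hd κ + j ≤? l) (inner j le)) (I*-yes (hd κ ≤? hd κ + j) (m≤m+n (hd κ) j))) }) ⟩
    ∑ (suc (l ∸ hd κ)) (λ j → I (hd κ + j ≤? l) *R (I (hd κ ≤? hd κ + j) *R C (hd κ + j)))
      ≈⟨ ∑-window (hd κ) (suc (l ∸ hd κ)) (≤-trans (≤-reflexive top) l<N)
           (λ m lt → *-zeroʳ (I*-no (hd κ ≤? m) (<⇒≱ lt))) (λ m le → I*-no (m ≤? l) (<⇒≱ (≤-trans (≤-reflexive (≡.sym top)) le))) ⟨
    ∑ N (λ m → I (m ≤? l) *R (I (hd κ ≤? m) *R C m))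
      ≈⟨ ∑-cong N (λ m → trans (sym (*-assoc (I (m ≤? l)) (I (hd κ ≤? m)) (C m))) (trans (cube-*ˡ n (I (m ≤? l) *R I (hd κ ≤? m)) _) (cube-cong n (term m)))) ⟩
    cube (suc n) (λ μ → I (Inter? μ (l ∷ κ)) *R F (shape μ)) ∎
    where
    C : ℕ → A
    C m = cube n (λ μ → I (Inter? μ κ) *R F (tcons m (shape μ)))
    inner : ∀ j → j ≤ l ∸ hd κ → hd κ + j ≤ l
    inner j le = ≤-trans (ℕₚ.+-monoʳ-≤ (hd κ) le) (≤-reflexive (m+[n∸m]≡n h))
    top : hd κ + suc (l ∸ hd κ) ≡ suc l
    top = ≡.trans (ℕₚ.+-suc (hd κ) (l ∸ hd κ)) (≡.cong suc (m+[n∸m]≡n h))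
    term : ∀ m μ → (I (m ≤? l) *R I (hd κ ≤? m)) *R (I (Inter? μ κ) *R F (tcons m (shape μ))) ≈ I (Inter? (m ∷ μ) (l ∷ κ)) *R F (shape (m ∷ μ))
    term m μ = begin
      (I (m ≤? l) *R I (hd κ ≤? m)) *R (I (Inter? μ κ) *R F (tcons m (shape μ)))
        ≈⟨ solve 4 (λ a b c x → (a ⊗ b) ⊗ (c ⊗ x) := (a ⊗ (b ⊗ c)) ⊗ x) refl _ _ _ _ ⟩
      (I (m ≤? l) *R (I (hd κ ≤? m) *R I (Inter? μ κ))) *R F (tcons m (shape μ))
        ≈⟨ *-cong (trans (I-× (m ≤? l) ((hd κ ≤? m) ×-dec Inter? μ κ)) (*-congˡ (I-× (hd κ ≤? m) (Inter? μ κ)))) (reflexive (≡.cong F (trim-∷ m (toList μ)))) ⟨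
      I (Inter? (m ∷ μ) (l ∷ κ)) *R F (shape (m ∷ μ)) ∎

  subs : ℕ → List ℕ → (List ℕ → A) → A
  subs k lam F = Σᴸ (map F (subBounded k lam))

  subs-∷ : ∀ k l ls F → subs k (l ∷ ls) F ≈ F [] +R ∑ (k ⊓ l) (λ j → subs (suc j) ls (F ∘ (suc j ∷_)))
  subs-∷ k l ls F = +-congˡ (begin
    Σᴸ (map F (concatMap (λ j → map (suc j ∷_) (subBounded (suc j) ls)) (upTo (k ⊓ l))))
      ≈⟨ Σᴸ-concatMap (upTo (k ⊓ l)) F (λ j → map (suc j ∷_) (subBounded (suc j) ls)) ⟩
    Σᴸ (map (λ j → Σᴸ (map F (map (suc j ∷_) (subBounded (suc j) ls)))) (upTo (k ⊓ l)))
      ≈⟨ Σᴸ-cong (upTo (k ⊓ l)) (λ j → Σᴸ-map (subBounded (suc j) ls) F (suc j ∷_)) ⟩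
    Σᴸ (map (λ j → subs (suc j) ls (F ∘ (suc j ∷_))) (upTo (k ⊓ l)))
      ≈⟨ ∑-upTo (k ⊓ l) (λ j → subs (suc j) ls (F ∘ (suc j ∷_))) id ⟩
    ∑ (k ⊓ l) (λ j → subs (suc j) ls (F ∘ (suc j ∷_))) ∎)

  subs-0 : ∀ ls F → subs 0 ls F ≈ F []
  subs-0 []       F = +-identityʳ _
  subs-0 (l ∷ ls) F = +-identityʳ _

  tcons-suc : ∀ j ys → tcons (suc j) ys ≡ suc j ∷ ys
  tcons-suc j []      = ≡.refl
  tcons-suc j (_ ∷ _) = ≡.refl

  subs-step : ∀ k lam F → subs k lam F ≈ F [] +R ∑ (k ⊓ at lam 0) (λ j → subs (suc j) (tail lam) (F ∘ tcons (suc j)))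
  subs-step k []       F = trans (+-congˡ (sym (∑-zero (k ⊓ 0) (λ j lt → ⊥-elim (ℕₚ.n≮0 (≤-trans lt (ℕₚ.m⊓n≤n k 0))))))) refl
  subs-step k (l ∷ ls) F = trans (subs-∷ k l ls F) (+-congˡ (∑-cong (k ⊓ l) (λ j → Σᴸ-cong (subBounded (suc j) ls) (λ μ → reflexive (≡.cong F (≡.sym (tcons-suc j μ)))))))

  -- The two-sided form of `vanish` covers both applications: for `gr` the bounding shape itself has
  -- no part beyond n, and in the final sum F vanishes on longer partitions.
  subs-cube : ∀ n k lam F → k < N → (∀ xs → at xs n ≢ 0 → at lam n ≢ 0 → F xs ≈ 0#) →
              subs k lam F ≈ cube n (λ v → I (SubB? k v lam) *R F (shape v))
  subs-cube zero k lam F k<N vanish = begin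
    subs k lam F
      ≈⟨ subs-step k lam F ⟩
    F [] +R ∑ (k ⊓ at lam 0) (λ j → subs (suc j) (tail lam) (F ∘ tcons (suc j)))
      ≈⟨ +-congˡ (∑-zero (k ⊓ at lam 0) (λ j lt → zeros-Σ (subBounded (suc j) (tail lam)) (λ μ → vanish (tcons (suc j) μ)
           (λ e → ℕₚ.0≢1+n (≡.trans (≡.sym e) (at-tcons-0 (suc j) μ)))
           (λ e → ℕₚ.n≮0 (≤-trans lt (≤-trans (ℕₚ.m⊓n≤n k _) (≤-reflexive e))))))) ⟩
    F [] +R 0#
      ≈⟨ +-identityʳ _ ⟩
    F []
      ≈⟨ *-identityˡ _ ⟨
    1# *R F [] ∎
    where
    zeros-Σ : ∀ (xs : List (List ℕ)) {f} → (∀ x → f x ≈ 0#) → Σᴸ (map f xs) ≈ 0#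
    zeros-Σ []       e = refl
    zeros-Σ (x ∷ xs) e = trans (+-cong (e x) (zeros-Σ xs e)) (+-identityˡ _)
  subs-cube (suc n) k lam F k<N vanish = begin
    subs k lam F
      ≈⟨ subs-step k lam F ⟩
    F [] +R ∑ (k ⊓ l) (λ j → subs (suc j) (tail lam) (F ∘ tcons (suc j)))
      -- The empty partition becomes the term with first part 0, after which all parts obey one
      -- formula.
      ≈⟨ +-congʳ (subs-0 (tail lam) (F ∘ tcons 0)) ⟨
    ∑ (suc (k ⊓ l)) (λ j → subs j (tail lam) (F ∘ tcons j))
      ≈⟨ ∑-cong< (suc (k ⊓ l)) (λ { j (s≤s le) → subs-cube n j (tail lam) (F ∘ tcons j) (≤-<-trans (≤-trans le (ℕₚ.m⊓n≤m k l)) k<N)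
           (λ xs ne ne' → vanish _ (tcons-≢0 {j} {xs} ne) (λ e → ne' (≡.trans (at-tail lam n) e))) }) ⟩
    ∑ (suc (k ⊓ l)) C
      ≈⟨ ∑-cong< (suc (k ⊓ l)) {C} (λ { j (s≤s le) → sym (trans (I*-yes (j ≤? k) (≤-trans le (ℕₚ.m⊓n≤m k l))) (I*-yes (j ≤? l) (≤-trans le (ℕₚ.m⊓n≤n k l)))) }) ⟩
    ∑ (suc (k ⊓ l)) (λ j → I (j ≤? k) *R (I (j ≤? l) *R C j))
      ≈⟨ ∑-window 0 (suc (k ⊓ l)) (≤-trans (s≤s (ℕₚ.m⊓n≤m k l)) k<N) (λ _ ()) above ⟨
    ∑ N (λ j → I (j ≤? k) *R (I (j ≤? l) *R C j))
      ≈⟨ ∑-cong N (λ m → trans (sym (*-assoc (I (m ≤? k)) (I (m ≤? l)) (C m))) (trans (cube-*ˡ n (I (m ≤? k) *R I (m ≤? l)) _) (cube-cong n (term m)))) ⟩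
    cube (suc n) (λ v → I (SubB? k v lam) *R F (shape v)) ∎
    where
    l : ℕ
    l = at lam 0
    C : ℕ → A
    C j = cube n (λ v → I (SubB? j v (tail lam)) *R F (tcons j (shape v)))
    above : ∀ j → suc (k ⊓ l) ≤ j → I (j ≤? k) *R (I (j ≤? l) *R C j) ≈ 0#
    above j lt with j ≤? k | j ≤? l
    ... | no ¬p | _     = I*-no (j ≤? k) ¬p
    ... | yes _ | no ¬q = *-zeroʳ (I*-no (j ≤? l) ¬q)
    ... | yes p | yes q = ⊥-elim (<⇒≱ lt (ℕₚ.⊓-glb p q))
    term : ∀ m v → (I (m ≤? k) *R I (m ≤? l)) *R (I (SubB? m v (tail lam)) *R F (tcons m (shape v))) ≈ I (SubB? k (m ∷ v) lam) *R F (shape (m ∷ v))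
    term m v = begin
      (I (m ≤? k) *R I (m ≤? l)) *R (I (SubB? m v (tail lam)) *R F (tcons m (shape v)))
        ≈⟨ solve 4 (λ a b c x → (a ⊗ b) ⊗ (c ⊗ x) := (a ⊗ (b ⊗ c)) ⊗ x) refl _ _ _ _ ⟩
      (I (m ≤? k) *R (I (m ≤? l) *R I (SubB? m v (tail lam)))) *R F (tcons m (shape v))
        ≈⟨ *-cong (trans (I-× (m ≤? k) ((m ≤? l) ×-dec SubB? m v (tail lam))) (*-congˡ (I-× (m ≤? l) (SubB? m v (tail lam))))) (reflexive (≡.cong F (trim-∷ m (toList v)))) ⟨
      I (SubB? k (m ∷ v) lam) *R F (shape (m ∷ v)) ∎

-- Exponent boxes and products of multivariate series.

allZero⁺ : ∀ k {e : Fin k → ℕ} → (∀ i → e i ≡ 0) → allZero k e ≡ true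
allZero⁺ zero    z = ≡.refl
allZero⁺ (suc k) z rewrite z fz = allZero⁺ k (z ∘ fs)

allZero⁻ : ∀ k {e : Fin k → ℕ} → allZero k e ≡ true → ∀ i → e i ≡ 0
allZero⁻ (suc k) {e} z fz     with e fz
... | zero = ≡.refl
allZero⁻ (suc k) {e} z (fs i) with e fz
... | zero = allZero⁻ k z i

allZero-cong : ∀ k {e e' : Fin k → ℕ} → e ≗ e' → allZero k e ≡ allZero k e'
allZero-cong zero    eq = ≡.refl
allZero-cong (suc k) eq = ≡.cong₂ _∧_ (≡.cong (_≡ᵇ 0) (eq fz)) (allZero-cong k (eq ∘ fs))

_≗?_ : ∀ {k} (d e : Fin k → ℕ) → Dec (d ≗ e)
_≗?_ {zero}  d e = yes (λ ())
_≗?_ {suc k} d e with d fz ≟ e fz | (d ∘ fs) ≗? (e ∘ fs)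
... | yes p | yes q = yes (λ { fz → p ; (fs i) → q i })
... | no ¬p | _     = no (λ eq → ¬p (eq fz))
... | yes _ | no ¬q = no (λ eq → ¬q (eq ∘ fs))

module Boxes {c ℓ} (R : CommutativeRing c ℓ) where
  open Sums R
  open Series R hiding (Σᴸ; pow)

  boxSum : ∀ k → (Fin k → ℕ) → PS k → A
  boxSum k e F = Σᴸ (map F (boxes k e))

  boxSum-suc : ∀ k e F → boxSum (suc k) e F ≈ boxSum k (e ∘ fs) (λ d → ∑ (suc (e fz)) (λ t → F (cons t d)))
  boxSum-suc k e F = trans (Σᴸ-concatMap (boxes k (e ∘ fs)) F (λ d → map (λ t → cons t d) (upTo (suc (e fz)))))
    (Σᴸ-cong (boxes k (e ∘ fs)) (λ d → trans (Σᴸ-map (upTo (suc (e fz))) F (λ t → cons t d)) (∑-upTo (suc (e fz)) (λ t → F (cons t d)) id)))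

  boxSum-cong : ∀ k e {F F' : PS k} → (∀ d → (∀ i → d i ≤ e i) → F d ≈ F' d) → boxSum k e F ≈ boxSum k e F'
  boxSum-cong zero    e eq = +-congʳ (eq (λ ()) (λ ()))
  boxSum-cong (suc k) e {F} {F'} eq = trans (boxSum-suc k e F) (trans (boxSum-cong k (e ∘ fs) (λ d d≤ → ∑-cong< (suc (e fz))
    (λ { t (s≤s t≤) → eq (cons t d) (λ { fz → t≤ ; (fs i) → d≤ i }) }))) (sym (boxSum-suc k e F')))

  boxSum-zero : ∀ k e {F : PS k} → (∀ d → (∀ i → d i ≤ e i) → F d ≈ 0#) → boxSum k e F ≈ 0#
  boxSum-zero zero    e eq = trans (+-identityʳ _) (eq (λ ()) (λ ()))
  boxSum-zero (suc k) e {F} eq = trans (boxSum-suc k e F) (boxSum-zero k (e ∘ fs) (λ d d≤ → ∑-zero (suc (e fz))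
    (λ { t (s≤s t≤) → eq (cons t d) (λ { fz → t≤ ; (fs i) → d≤ i }) })))

  boxSum-single : ∀ k e {F : PS k} {x} d₀ → (∀ i → d₀ i ≤ e i) → (∀ d → d ≗ d₀ → F d ≈ x) →
                  (∀ d → (∀ i → d i ≤ e i) → ¬ d ≗ d₀ → F d ≈ 0#) → boxSum k e F ≈ x
  boxSum-single zero    e d₀ d₀≤ at-d₀ off = trans (+-identityʳ _) (at-d₀ (λ ()) (λ ()))
  boxSum-single (suc k) e {F} {x} d₀ d₀≤ at-d₀ off = trans (boxSum-suc k e F) (boxSum-single k (e ∘ fs) (d₀ ∘ fs) (d₀≤ ∘ fs)
    (λ d eq → trans (∑-single (suc (e fz)) {λ t → F (cons t d)} (d₀ fz) (s≤s (d₀≤ fz)) (λ { t (s≤s t≤) ne →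
       off (cons t d) (λ { fz → t≤ ; (fs i) → ≤-trans (≤-reflexive (eq i)) (d₀≤ (fs i)) }) (λ eq' → ne (eq' fz)) })) (at-d₀ (cons (d₀ fz) d) (λ { fz → ≡.refl ; (fs i) → eq i })))
    (λ d d≤ ne → ∑-zero (suc (e fz)) (λ { t (s≤s t≤) → off (cons t d) (λ { fz → t≤ ; (fs i) → d≤ i }) (λ eq → ne (eq ∘ fs)) })))

  -- Exponents are functions and are compared only pointwise, so each series must be shown to
  -- respect this relation before its exponent may be rewritten.
  Resp : ∀ {k} → PS k → Set ℓ
  Resp {k} f = ∀ {d e : Fin k → ℕ} → d ≗ e → f d ≈ f e

  snoc-ext : ∀ n {d d' : Fin (suc n) → ℕ} → (∀ i → d (inject₁ i) ≡ d' (inject₁ i)) → d (fromℕ n) ≡ d' (fromℕ n) → d ≗ d'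
  snoc-ext zero    i l fz     = l
  snoc-ext (suc n) i l fz     = i fz
  snoc-ext (suc n) i l (fs j) = snoc-ext n (i ∘ fs) l j

  snoc : ∀ n → (Fin n → ℕ) → ℕ → Fin (suc n) → ℕ
  snoc zero    d x _      = x
  snoc (suc n) d x fz     = d fz
  snoc (suc n) d x (fs i) = snoc n (d ∘ fs) x i

  snoc-inject₁ : ∀ n d x i → snoc n d x (inject₁ i) ≡ d i
  snoc-inject₁ (suc n) d x fz     = ≡.refl
  snoc-inject₁ (suc n) d x (fs i) = snoc-inject₁ n (d ∘ fs) x i

  snoc-last : ∀ n d x → snoc n d x (fromℕ n) ≡ x
  snoc-last zero    d x = ≡.refl
  snoc-last (suc n) d x = snoc-last n (d ∘ fs) x

  snoc-≤ : ∀ n d x (e : Fin (suc n) → ℕ) → (∀ i → d i ≤ e (inject₁ i)) → x ≤ e (fromℕ n) → ∀ i → snoc n d x i ≤ e i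
  snoc-≤ zero    d x e p q fz     = q
  snoc-≤ (suc n) d x e p q fz     = p fz
  snoc-≤ (suc n) d x e p q (fs i) = snoc-≤ n (d ∘ fs) x (e ∘ fs) (p ∘ fs) q i

  if-true : ∀ {x y : A} {t} → t ≡ true → (if t then x else y) ≈ x
  if-true ≡.refl = refl

  if-false : ∀ {x y : A} {t} → t ≡ false → (if t then x else y) ≈ y
  if-false ≡.refl = refl

  ≡ᵇ0⁺ : ∀ {x} → x ≡ 0 → (x ≡ᵇ 0) ≡ true
  ≡ᵇ0⁺ ≡.refl = ≡.refl

  ≡ᵇ0⁻ : ∀ {x} → (x ≡ᵇ 0) ≡ true → x ≡ 0
  ≡ᵇ0⁻ {zero} _ = ≡.refl

  ∸-zero⇒≡ : ∀ {x y} → x ≤ y → y ∸ x ≡ 0 → x ≡ y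
  ∸-zero⇒≡ le z = ≤-antisym le (ℕₚ.m∸n≡0⇒m≤n z)

  -- The supports leave a single term of the convolution: the first factor takes all exponents
  -- except the last one, the second factor takes the last.
  ext-⋆-inLast : ∀ {n} (f : PS n) u e → Resp f → (ext f ⋆ inLast u) e ≈ f (e ∘ inject₁) *R u (e (fromℕ n))
  ext-⋆-inLast {n} f u e resp = boxSum-single (suc n) e d₀ (snoc-≤ n (e ∘ inject₁) 0 e (λ i → ≤-refl) z≤n) on off
    where
    d₀ : Fin (suc n) → ℕ
    d₀ = snoc n (e ∘ inject₁) 0
    on : ∀ d → d ≗ d₀ → ext f d *R inLast u (λ i → e i ∸ d i) ≈ f (e ∘ inject₁) *R u (e (fromℕ n))
    on d eq = *-cong
      (trans (if-true (≡ᵇ0⁺ (≡.trans (eq (fromℕ n)) (snoc-last n (e ∘ inject₁) 0)))) (resp (λ i → d-init i)))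
      (trans (if-true (allZero⁺ n (λ i → ≡.trans (≡.cong (e (inject₁ i) ∸_) (d-init i)) (n∸n≡0 (e (inject₁ i))))))
             (reflexive (≡.cong (λ z → u (e (fromℕ n) ∸ z)) (≡.trans (eq (fromℕ n)) (snoc-last n (e ∘ inject₁) 0)))))
      where
      d-init : ∀ i → d (inject₁ i) ≡ e (inject₁ i)
      d-init i = ≡.trans (eq (inject₁ i)) (snoc-inject₁ n (e ∘ inject₁) 0 i)
    off : ∀ d → (∀ i → d i ≤ e i) → ¬ d ≗ d₀ → ext f d *R inLast u (λ i → e i ∸ d i) ≈ 0#
    off d d≤ ne with d (fromℕ n) ≡ᵇ 0 in eq₁ | allZero n ((λ i → e i ∸ d i) ∘ inject₁) in eq₂
    ... | false | _     = zeroˡ _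
    ... | true  | false = zeroʳ _
    ... | true  | true  = ⊥-elim (ne (snoc-ext n
      (λ i → ≡.trans (∸-zero⇒≡ (d≤ (inject₁ i)) (allZero⁻ n eq₂ i)) (≡.sym (snoc-inject₁ n (e ∘ inject₁) 0 i)))
      (≡.trans (≡ᵇ0⁻ eq₁) (≡.sym (snoc-last n (e ∘ inject₁) 0)))))

  embL-⋆-embR : ∀ {m n} (f : PS m) (g : PS n) e → Resp f → Resp g →
                (embL n f ⋆ embR m g) e ≈ f (λ i → e (i ↑ˡ n)) *R g (λ j → e (m ↑ʳ j))
  embL-⋆-embR {m} {n} f g e rf rg = boxSum-single (m + n) e d₀ d₀≤ on off
    where
    d₀ : Fin (m + n) → ℕ
    d₀ l with splitAt m l
    ... | inj₁ i = e (i ↑ˡ n)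
    ... | inj₂ j = 0
    d₀-L : ∀ i → d₀ (i ↑ˡ n) ≡ e (i ↑ˡ n)
    d₀-L i rewrite splitAt-↑ˡ m i n = ≡.refl
    d₀-R : ∀ j → d₀ (m ↑ʳ j) ≡ 0
    d₀-R j rewrite splitAt-↑ʳ m n j = ≡.refl
    split-ext : ∀ {d : Fin (m + n) → ℕ} → (∀ i → d (i ↑ˡ n) ≡ e (i ↑ˡ n)) → (∀ j → d (m ↑ʳ j) ≡ 0) → d ≗ d₀
    split-ext {d} p q l with splitAt m l in eq
    ... | inj₁ i = ≡.subst (λ z → d z ≡ e (i ↑ˡ n)) (splitAt⁻¹-↑ˡ eq) (p i)
    ... | inj₂ j = ≡.subst (λ z → d z ≡ 0) (splitAt⁻¹-↑ʳ eq) (q j)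
    d₀≤ : ∀ l → d₀ l ≤ e l
    d₀≤ l with splitAt m l in eq
    ... | inj₁ i = ≤-reflexive (≡.cong e (splitAt⁻¹-↑ˡ eq))
    ... | inj₂ j = z≤n
    on : ∀ d → d ≗ d₀ → embL n f d *R embR m g (λ i → e i ∸ d i) ≈ f (λ i → e (i ↑ˡ n)) *R g (λ j → e (m ↑ʳ j))
    on d eq = *-cong
      (trans (if-true (allZero⁺ n (λ j → ≡.trans (eq (m ↑ʳ j)) (d₀-R j)))) (rf (λ i → ≡.trans (eq (i ↑ˡ n)) (d₀-L i))))
      (trans (if-true (allZero⁺ m (λ i → ≡.trans (≡.cong (e (i ↑ˡ n) ∸_) (≡.trans (eq (i ↑ˡ n)) (d₀-L i))) (n∸n≡0 (e (i ↑ˡ n))))))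
             (rg (λ j → ≡.cong (e (m ↑ʳ j) ∸_) (≡.trans (eq (m ↑ʳ j)) (d₀-R j)))))
    off : ∀ d → (∀ i → d i ≤ e i) → ¬ d ≗ d₀ → embL n f d *R embR m g (λ i → e i ∸ d i) ≈ 0#
    off d d≤ ne with allZero n (λ j → d (m ↑ʳ j)) in eq₁ | allZero m (λ i → e (i ↑ˡ n) ∸ d (i ↑ˡ n)) in eq₂
    ... | false | _     = zeroˡ _
    ... | true  | false = zeroʳ _
    ... | true  | true  = ⊥-elim (ne (split-ext (λ i → ∸-zero⇒≡ (d≤ (i ↑ˡ n)) (allZero⁻ m eq₂ i)) (allZero⁻ n eq₁)))

-- Gr and gr split off the last variable, so exponents are read from the last to the first.
exponents : ∀ {n} → (Fin n → ℕ) → Vec ℕ n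
exponents e = tabulate (λ i → e (opposite i))

hsRaw-≥ : ∀ lam {μ} → μ ∈ hsRaw lam → ∀ i → at lam (suc i) ≤ at μ i
hsRaw-≥ []       (here ≡.refl) i = z≤n
hsRaw-≥ (l ∷ ls) {μ} μ∈ i with Any⇒∈ (∈-concatMap⁻ (λ t → map (t ∷_) (hsRaw ls)) {xs = range (headOr0 ls) l} μ∈)
... | t , t∈ , p with ∈-map⁻ (t ∷_) p | ∈-map⁻ (headOr0 ls +_) t∈
hsRaw-≥ (l ∷ ls) μ∈ zero    | t , t∈ , p | μ' , μ'∈ , ≡.refl | j , _ , ≡.refl = ≤-trans (≤-reflexive (≡.sym (headOr0≡at ls))) (m≤m+n (headOr0 ls) j)
hsRaw-≥ (l ∷ ls) μ∈ (suc i) | t , t∈ , p | μ' , μ'∈ , ≡.refl | _ = hsRaw-≥ ls μ'∈ i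

∷≢[] : ∀ {x} {xs : List ℕ} → ¬ (_≡_ {A = List ℕ} (x ∷ xs) [])
∷≢[] ()

shape-zeros : ∀ {n} (v : Vec ℕ n) → Sub v (zeros n) → shape v ≡ []
shape-zeros []         _       = ≡.refl
shape-zeros (zero ∷ v) (_ , s) = ≡.trans (trim-∷ 0 (toList v)) (≡.cong (tcons 0) (shape-zeros v s))

shape-[] : ∀ {n} (v : Vec ℕ n) → shape v ≡ [] → Sub v (zeros n)
shape-[] {n} v e = part⇒Sub v (zeros n) (λ i → ≤-trans (≤-reflexive (≡.trans (≡.sym (at-shape v i)) (≡.cong (λ z → at z i) e))) z≤n)

-- Coefficients of the two families of polynomials.

module Coefficients {c ℓ} (R : CommutativeRing c ℓ) (α β : CommutativeRing.Carrier R) where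
  open Sums R
  open PowerSeries R
  open Boxes R
  -- The bound 0 is arbitrary: these three series do not depend on it.
  open SkewCoefficients R α β 0 using (tᵘ; ρᵘ; sᵘ)
  private module 𝕌 = Sums series

  Gr' : ∀ n → List ℕ → PS n
  Gr' = Gr (-R α) (-R β)

  gr' : ∀ n → List ℕ → PS n
  gr' = gr α β

  Σᴸ-zero∈ : ∀ {b} {B : Set b} (xs : List B) {f : B → A} → (∀ x → x ∈ xs → f x ≈ 0#) → Σᴸ (map f xs) ≈ 0#
  Σᴸ-zero∈ []       e = refl
  Σᴸ-zero∈ (x ∷ xs) e = trans (+-cong (e x (here ≡.refl)) (Σᴸ-zero∈ xs (λ z z∈ → e z (there z∈)))) (+-identityˡ _)

  stripSeries : List ℕ → List ℕ → U
  stripSeries lam mu = powᵘ tᵘ (sum lam ∸ sum mu) ·ᵘ powᵘ ρᵘ (rBar mu lam)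

  skewSeries : List ℕ → List ℕ → U
  skewSeries lam mu = constᵘ (pow β (nRows lam mu ∸ nComps lam mu) *R pow (α +R β) ((sum lam ∸ sum mu + nComps lam mu) ∸ (nRows lam mu + nCols lam mu)))
                      ·ᵘ (powᵘ Xᵘ (nComps lam mu) ·ᵘ powᵘ (linᵘ α 1#) (nCols lam mu ∸ nComps lam mu))

  -- Proved together with `Gr-suc`: evaluating the product for n + 1 variables presupposes that the
  -- series in n variables respects pointwise equality.
  Gr-resp : ∀ n lam → Resp (Gr' n lam)
  Gr-suc : ∀ n lam e → Gr' (suc n) lam e ≈ Σᴸ (map (λ mu → Gr' n mu (e ∘ inject₁) *R stripSeries lam mu (e (fromℕ n))) (horizontalStrips lam))

  Gr-suc n lam e = trans (Σᴸ-map (horizontalStrips lam) (λ f → f e) (λ mu → ext (Gr' n mu) ⋆ inLast (stripSeries lam mu)))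
    (Σᴸ-cong (horizontalStrips lam) (λ mu → ext-⋆-inLast (Gr' n mu) (stripSeries lam mu) e (Gr-resp n mu)))

  Gr-resp zero    []      eq = refl
  Gr-resp zero    (_ ∷ _) eq = refl
  Gr-resp (suc n) lam {d} {e} eq = trans (Gr-suc n lam d) (trans
    (Σᴸ-cong (horizontalStrips lam) (λ mu → *-cong (Gr-resp n mu (λ i → eq (inject₁ i))) (reflexive (≡.cong (stripSeries lam mu) (eq (fromℕ n))))))
    (sym (Gr-suc n lam e)))

  gr-resp : ∀ n lam → Resp (gr' n lam)
  gr-suc : ∀ n lam e → gr' (suc n) lam e ≈ Σᴸ (map (λ mu → gr' n mu (e ∘ inject₁) *R skewSeries lam mu (e (fromℕ n))) (subPartitions lam))

  gr-suc n lam e = trans (Σᴸ-map (subPartitions lam) (λ f → f e) (λ mu → ext (gr' n mu) ⋆ inLast (skewSeries lam mu)))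
    (Σᴸ-cong (subPartitions lam) (λ mu → ext-⋆-inLast (gr' n mu) (skewSeries lam mu) e (gr-resp n mu)))

  gr-resp zero    []      eq = refl
  gr-resp zero    (_ ∷ _) eq = refl
  gr-resp (suc n) lam {d} {e} eq = trans (gr-suc n lam d) (trans
    (Σᴸ-cong (subPartitions lam) (λ mu → *-cong (gr-resp n mu (λ i → eq (inject₁ i))) (reflexive (≡.cong (skewSeries lam mu) (eq (fromℕ n))))))
    (sym (gr-suc n lam e)))

  -- In a horizontal strip μ_i ≥ λ_{i+1}, so one variable removes at most one part.
  Gr-vanish : ∀ n lam e → at lam n ≢ 0 → Gr' n lam e ≈ 0#
  Gr-vanish zero    []      e ne = ⊥-elim (ne ≡.refl)
  Gr-vanish zero    (_ ∷ _) e ne = refl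
  Gr-vanish (suc n) lam     e ne = trans (Gr-suc n lam e) (Σᴸ-zero∈ (horizontalStrips lam) term)
    where
    term : ∀ mu → mu ∈ horizontalStrips lam → Gr' n mu (e ∘ inject₁) *R stripSeries lam mu (e (fromℕ n)) ≈ 0#
    term mu mu∈ with ∈-map⁻ trim mu∈
    ... | ν , ν∈ , ≡.refl = *-zeroˡ (Gr-vanish n (trim ν) (e ∘ inject₁) (λ z → ne (ℕₚ.n≤0⇒n≡0
                              (≤-trans (hsRaw-≥ lam ν∈ n) (≤-reflexive (≡.trans (≡.sym (at-trim ν n)) z))))))

  stripSeries-order : ∀ lam mu i → i < sum lam ∸ sum mu → stripSeries lam mu i ≈ 0#
  stripSeries-order lam mu i lt = trans (·ᵘ-cong {g = powᵘ ρᵘ (rBar mu lam)} (powᵘ-pow tᵘ (sum lam ∸ sum mu)) (λ _ → refl) i)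
    (order-pow tᵘ (sum lam ∸ sum mu) (powᵘ ρᵘ (rBar mu lam)) (X-·-zero sᵘ) i lt)

  Gr-order : ∀ n lam e → sumV (exponents e) < sum lam → Gr' n lam e ≈ 0#
  Gr-order zero    (_ ∷ _) e lt = refl
  Gr-order (suc n) lam     e lt = trans (Gr-suc n lam e) (Σᴸ-zero∈ (horizontalStrips lam) (λ mu _ → term mu))
    where
    term : ∀ mu → Gr' n mu (e ∘ inject₁) *R stripSeries lam mu (e (fromℕ n)) ≈ 0#
    term mu with sumV (exponents (e ∘ inject₁)) <? sum mu
    ... | yes lt' = *-zeroˡ (Gr-order n mu (e ∘ inject₁) lt')
    ... | no ge   = *-zeroʳ (stripSeries-order lam mu (e (fromℕ n)) (ℕₚ.m+n≤o⇒m≤o∸n (suc (e (fromℕ n)))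
                      (≤-trans (ℕₚ.+-monoʳ-≤ (suc (e (fromℕ n))) (≮⇒≥ ge)) lt)))

  module _ (N : ℕ) where
    open Cubes R N
    open Complete R
    open ListSums R N
    open VecCauchy R α β N
    open SkewCoefficients R α β N using (a; b)
    private
      module SF = StripFacts series tᵘ ρᵘ
      module KF = SkewFacts series (constᵘ β) (constᵘ (α +R β)) (linᵘ α 1#) Xᵘ
      module SE = SkewExponents series (constᵘ β) (constᵘ (α +R β)) (linᵘ α 1#) Xᵘ
      module CH = HomLemmas (Embeddings.const-hom R)
      module C = Homomorphism (Embeddings.const-hom R)

    a-stripSeries : ∀ {n} (μ : Vec ℕ n) κ → Inter μ κ → stripSeries (shape κ) (shape μ) ≈ᵘ a μ κ
    a-stripSeries μ κ int i rewrite sum-shape κ | sum-shape μ | rBar-shape μ κ = trans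
      (·ᵘ-cong (powᵘ-pow tᵘ (sumV κ ∸ sumV μ)) (powᵘ-pow ρᵘ (cornerCount μ κ)) i) (sym (SF.a-yes μ κ int i))

    Gr≈G : ∀ n (κ : Vec ℕ n) e → Decr κ → Bounded κ → Gr' n (shape κ) e ≈ G κ (exponents e)
    Gr≈G zero    []  e d bd = refl
    Gr≈G (suc n) κ   e d bd = begin
      Gr' (suc n) (shape κ) e
        ≈⟨ Gr-suc n (shape κ) e ⟩
      strips (shape κ) F
        ≈⟨ strips-cube n κ F d bd (λ xs ne → *-zeroˡ (Gr-vanish n xs (e ∘ inject₁) ne)) ⟩
      cube n (λ μ → I (Inter? μ κ) *R F (shape μ))
        ≈⟨ cube-cong< n term ⟩
      cube n (λ μ → G μ (exponents (e ∘ inject₁)) *R a μ κ (e (fromℕ n))) ∎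
      where
      F : List ℕ → A
      F mu = Gr' n mu (e ∘ inject₁) *R stripSeries (shape κ) mu (e (fromℕ n))
      term : ∀ μ → Bounded μ → I (Inter? μ κ) *R F (shape μ) ≈ G μ (exponents (e ∘ inject₁)) *R a μ κ (e (fromℕ n))
      term μ bμ with Inter? μ κ
      ... | yes int = trans (*-identityˡ _) (*-cong (Gr≈G n μ (e ∘ inject₁) (Inter⇒Decrˡ μ κ int) bμ) (a-stripSeries μ κ int (e (fromℕ n))))
      ... | no ¬int = trans (zeroˡ _) (sym (*-zeroʳ (SF.a-no μ κ ¬int (e (fromℕ n)))))

    b-skewSeries : ∀ {n} (κ ν : Vec ℕ n) → Decr κ → Decr ν → Sub ν κ → skewSeries (shape κ) (shape ν) ≈ᵘ b κ ν
    b-skewSeries κ ν dκ dν s i rewrite sum-shape κ | sum-shape ν | nRows-shape κ ν | nCols-shape κ ν dκ dν | nComps-shape κ ν dκ dν = trans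
      (·ᵘ-cong (𝕌.trans (C.φ-* _ _) (·ᵘ-cong (CH.φ-pow (rowsV κ ν ∸ compsV κ ν) (𝕌.refl {constᵘ β})) (CH.φ-pow ((sumV κ ∸ sumV ν + compsV κ ν) ∸ (rowsV κ ν + colsV κ ν)) (𝕌.refl {constᵘ (α +R β)}))))
               (·ᵘ-cong (powᵘ-pow Xᵘ (compsV κ ν)) (powᵘ-pow (linᵘ α 1#) (colsV κ ν ∸ compsV κ ν))) i)
      (sym (proj₁ (SE.b-monomial κ ν dκ s) i))

    hd<N : ∀ {n} (κ : Vec ℕ n) → 0 < N → Bounded κ → hd κ < N
    hd<N []      0<N _       = 0<N
    hd<N (x ∷ κ) _   (p , _) = p

    -- The recursion for `gr` enumerates partitions inside κ, that for `g` runs over the whole cube;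
    -- outside the enumeration either `g ν` vanishes, as ν is not decreasing, or `b κ ν` does, as ν
    -- is not contained in κ.
    gr≈g : ∀ {n} k (κ : Vec ℕ n) e → 0 < N → Decr κ → Bounded κ → gr' k (shape κ) e ≈ g κ (exponents e)
    gr≈g {n} zero κ e 0<N d bd with shape κ in eq | Sub? κ (zeros n)
    ... | []    | yes s = refl
    ... | []    | no ¬s = ⊥-elim (¬s (shape-[] κ eq))
    ... | _ ∷ _ | yes s = ⊥-elim (∷≢[] (≡.trans (≡.sym eq) (shape-zeros κ s)))
    ... | _ ∷ _ | no ¬s = refl
    gr≈g {n} (suc k) κ e 0<N d bd = begin
      gr' (suc k) (shape κ) e
        ≈⟨ gr-suc k (shape κ) e ⟩
      subs (headOr0 (shape κ)) (shape κ) F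
        ≡⟨ ≡.cong (λ z → subs z (shape κ) F) (headOr0-shape κ) ⟩
      subs (hd κ) (shape κ) F
        ≈⟨ subs-cube n (hd κ) (shape κ) F (hd<N κ 0<N bd) (λ xs _ ne → ⊥-elim (ne (≡.trans (at-shape κ n) (part-length κ n ≤-refl)))) ⟩
      cube n (λ ν → I (SubB? (hd κ) ν (shape κ)) *R F (shape ν))
        ≈⟨ cube-cong< n term ⟩
      cube n (λ ν → b κ ν (e (fromℕ k)) *R g ν (exponents (e ∘ inject₁))) ∎
      where
      F : List ℕ → A
      F mu = gr' k mu (e ∘ inject₁) *R skewSeries (shape κ) mu (e (fromℕ k))
      term : ∀ ν → Bounded ν → I (SubB? (hd κ) ν (shape κ)) *R F (shape ν) ≈ b κ ν (e (fromℕ k)) *R g ν (exponents (e ∘ inject₁))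
      term ν bν with SubB? (hd κ) ν (shape κ)
      ... | yes s = trans (*-identityˡ _) (trans (*-cong (gr≈g k ν (e ∘ inject₁) 0<N dν bν) (b-skewSeries κ ν d dν sub (e (fromℕ k)))) (*-comm _ _))
        where
        dν : Decr ν
        dν = proj₂ (SubB⇒Decr (hd κ) ν (shape κ) s)
        sub : Sub ν κ
        sub = part⇒Sub ν κ (λ i → ≤-trans (SubB⇒part (hd κ) ν (shape κ) s i) (≤-reflexive (at-shape κ i)))
      ... | no ¬s with Decr? ν | Sub? ν κ
      ...   | no ¬d | _      = trans (zeroˡ _) (sym (*-zeroʳ (g-no-Decr ν (exponents (e ∘ inject₁)) ¬d)))
      ...   | yes _ | no ¬s' = trans (zeroˡ _) (sym (*-zeroˡ (KF.b-no-Sub κ ν ¬s' (e (fromℕ k)))))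
      ...   | yes dν | yes sub = ⊥-elim (¬s (Decr⇒SubB (hd κ) ν (shape κ) (Sub-hd ν κ sub) dν
                (λ i → ≤-trans (Sub⇒part ν κ sub i) (≤-reflexive (≡.sym (at-shape κ i))))))

-- Reordering products of multivariate series.

boxes-cong : ∀ k {d e : Fin k → ℕ} → d ≗ e → boxes k d ≡ boxes k e
boxes-cong zero    eq = ≡.refl
boxes-cong (suc k) eq = ≡.cong₂ (λ x xs → concatMap (λ d → map (λ t → cons t d) (upTo (suc x))) xs) (eq fz) (boxes-cong k (eq ∘ fs))

module Nested {c ℓ} (R : CommutativeRing c ℓ) where
  open Sums R
  open PowerSeries R
  open Boxes R
  private
    module B' = Boxes series
    module S' = Series series

  ⋆-cong : ∀ {k} (f : PS k) {g g' : PS k} e → (∀ d → g d ≈ g' d) → (f ⋆ g) e ≈ (f ⋆ g') e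
  ⋆-cong {k} f e eq = Σᴸ-cong (boxes k e) (λ d → *-congˡ (eq _))

  ⋆-resp : ∀ {k} (f g : PS k) → Resp g → Resp (f ⋆ g)
  ⋆-resp {k} f g rg {d} {e} eq = trans (Σᴸ-cong (boxes k d) (λ d' → *-congˡ (rg (λ i → ≡.cong (_∸ d' i) (eq i)))))
    (reflexive (≡.cong (λ xs → Σᴸ (map (λ d' → f d' *R g (λ i → e i ∸ d' i)) xs)) (boxes-cong k eq)))

  -- PS (suc k) over R is PS k over R[[x]], which reduces the laws of ⋆ to those of rings.
  nest : ∀ {k} → PS (suc k) → S'.PS k
  nest f d t = f (cons t d)

  nest-⋆ : ∀ {k} (f g : PS (suc k)) e → Resp g → (f ⋆ g) e ≈ (nest f S'.⋆ nest g) (e ∘ fs) (e fz)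
  nest-⋆ {k} f g e rg = begin
    boxSum (suc k) e (λ d → f d *R g (λ i → e i ∸ d i))
      ≈⟨ boxSum-suc k e (λ d → f d *R g (λ i → e i ∸ d i)) ⟩
    boxSum k (e ∘ fs) (λ d → ∑ (suc (e fz)) (λ t → f (cons t d) *R g (λ i → e i ∸ cons t d i)))
      ≈⟨ boxSum-cong k (e ∘ fs) (λ d _ → trans (∑-cong (suc (e fz)) (λ t → *-congˡ {f (cons t d)} (rg {λ i → e i ∸ cons t d i} {cons (e fz ∸ t) (λ i → e (fs i) ∸ d i)} (λ { fz → ≡.refl ; (fs i) → ≡.refl }))))
           (sym (·ᵘ-∑ (nest f d) (nest g (λ i → e (fs i) ∸ d i)) (e fz)))) ⟩
    boxSum k (e ∘ fs) (λ d → (nest f d ·ᵘ nest g (λ i → e (fs i) ∸ d i)) (e fz))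
      ≈⟨ coeff-Σᴸ (boxes k (e ∘ fs)) (λ d → nest f d ·ᵘ nest g (λ i → e (fs i) ∸ d i)) (e fz) ⟨
    (nest f S'.⋆ nest g) (e ∘ fs) (e fz) ∎

  nest-resp : ∀ {k} {f : PS (suc k)} → Resp f → B'.Resp (nest f)
  nest-resp rf eq t = rf (λ { fz → ≡.refl ; (fs i) → eq i })

-- Left commutativity is what reordering a `foldr` of products requires. The ring is quantified
-- inside the induction on k, because one variable is absorbed into the coefficients at each step.
⋆-left-comm : ∀ k {c ℓ} (R : CommutativeRing c ℓ) (f g h : Series.PS R k) → Boxes.Resp R h → ∀ e →
  CommutativeRing._≈_ R (Series._⋆_ R f (Series._⋆_ R g h) e) (Series._⋆_ R g (Series._⋆_ R f h) e)
⋆-left-comm zero R f g h rh e =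
  solve 3 (λ f g h → (f ⊗ ((g ⊗ h) ⊕ con 0)) ⊕ con 0 := (g ⊗ ((f ⊗ h) ⊕ con 0)) ⊕ con 0) refl _ _ _
  where open Sums R
⋆-left-comm (suc k) R f g h rh e = begin
  (f ⋆ (g ⋆ h)) e                                            ≈⟨ nest-⋆ f (g ⋆ h) e (⋆-resp g h rh) ⟩
  (nest f S'.⋆ nest (g ⋆ h)) (e ∘ fs) (e fz)                 ≈⟨ N'.⋆-cong (nest f) (e ∘ fs) (λ d t → nest-⋆ g h (cons t d) rh) (e fz) ⟩
  (nest f S'.⋆ (nest g S'.⋆ nest h)) (e ∘ fs) (e fz)         ≈⟨ ⋆-left-comm k series (nest f) (nest g) (nest h) (nest-resp rh) (e ∘ fs) (e fz) ⟩
  (nest g S'.⋆ (nest f S'.⋆ nest h)) (e ∘ fs) (e fz)         ≈⟨ N'.⋆-cong (nest g) (e ∘ fs) (λ d t → nest-⋆ f h (cons t d) rh) (e fz) ⟨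
  (nest g S'.⋆ nest (f ⋆ h)) (e ∘ fs) (e fz)                 ≈⟨ nest-⋆ g (f ⋆ h) e (⋆-resp f h rh) ⟨
  (g ⋆ (f ⋆ h)) e                                            ∎
  where
  open Sums R
  open PowerSeries R
  open Nested R
  module S' = Series series
  module N' = Nested series

-- Reindexing the grid of factors.

fins : ∀ n → List (Fin n)
fins zero    = []
fins (suc n) = fz ∷ map fs (fins n)

tabulate≡map-fins : ∀ {a} {B : Set a} n (f : Fin n → B) → List.tabulate f ≡ map f (fins n)
tabulate≡map-fins zero    f = ≡.refl
tabulate≡map-fins (suc n) f = ≡.cong (f fz ∷_) (≡.trans (tabulate≡map-fins n (f ∘ fs)) (map-∘ (fins n)))

allFin≡fins : ∀ n → allFin n ≡ fins n
allFin≡fins n = ≡.trans (tabulate≡map-fins n id) (map-id-local (fins n))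
  where
  map-id-local : ∀ (xs : List (Fin n)) → map id xs ≡ xs
  map-id-local []       = ≡.refl
  map-id-local (x ∷ xs) = ≡.cong (x ∷_) (map-id-local xs)

fins-∷ʳ : ∀ n → map inject₁ (fins n) ++ fromℕ n ∷ [] ≡ fins (suc n)
fins-∷ʳ zero    = ≡.refl
fins-∷ʳ (suc n) = ≡.cong (fz ∷_) (≡.trans (≡.cong (_++ fs (fromℕ n) ∷ []) (≡.trans (≡.sym (map-∘ (fins n))) (map-∘ (fins n))))
  (≡.trans (≡.sym (map-++ fs (map inject₁ (fins n)) (fromℕ n ∷ []))) (≡.cong (map fs) (fins-∷ʳ n))))

fins-opposite : ∀ n → fins n ↭ map opposite (fins n)
fins-opposite zero    = ↭.refl
fins-opposite (suc n) = ↭.trans (↭.↭-reflexive (≡.sym (fins-∷ʳ n))) (↭.trans (↭ₚ.++-comm (map inject₁ (fins n)) (fromℕ n ∷ []))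
  (↭.prep (fromℕ n) (↭.trans (↭ₚ.map⁺ inject₁ (fins-opposite n)) (↭.↭-reflexive (≡.trans (≡.sym (map-∘ (fins n))) (map-∘ (fins n)))))))

concatMap-↭ : ∀ {a b} {A : Set a} {B : Set b} (f : A → List B) {xs ys} → xs ↭ ys → concatMap f xs ↭ concatMap f ys
concatMap-↭ f ↭.refl         = ↭.refl
concatMap-↭ f (↭.prep x p)   = ↭ₚ.++⁺ˡ (f x) (concatMap-↭ f p)
concatMap-↭ f (↭.swap x y p) = ↭.trans (↭ₚ.shifts (f x) (f y)) (↭ₚ.++⁺ˡ (f y) (↭ₚ.++⁺ˡ (f x) (concatMap-↭ f p)))
concatMap-↭ f (↭.trans p q)  = ↭.trans (concatMap-↭ f p) (concatMap-↭ f q)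

concatMap-↭′ : ∀ {a b} {A : Set a} {B : Set b} {f g : A → List B} → (∀ x → f x ↭ g x) → ∀ xs → concatMap f xs ↭ concatMap g xs
concatMap-↭′ e []       = ↭.refl
concatMap-↭′ e (x ∷ xs) = ↭ₚ.++⁺ (e x) (concatMap-↭′ e xs)

grid : ∀ {m n} {B : Set} → (Fin m → Fin n → B) → List B
grid {m} {n} f = concatMap (λ i → map (f i) (fins n)) (fins m)

-- Exponents are read from the last variable to the first; this relists the factors of the Cauchy
-- product accordingly.
grid-opposite : ∀ {m n} {B : Set} (f : Fin m → Fin n → B) → grid f ↭ grid (λ i j → f (opposite i) (opposite j))
grid-opposite {m} {n} f = ↭.trans (concatMap-↭ (λ i → map (f i) (fins n)) (fins-opposite m))
  (↭.trans (↭.↭-reflexive (concatMap-map (λ i → map (f i) (fins n)) opposite (fins m)))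
    (concatMap-↭′ (λ i → ↭.trans (↭ₚ.map⁺ (f (opposite i)) (fins-opposite n)) (↭.↭-reflexive (≡.sym (map-∘ (fins n))))) (fins m)))

-- Coefficients of the Cauchy product.

-- For p ≠ q, the exponent of the t-th power of the product of the two variables: the monomials of
-- the geometric series `geoPair p q`.
doubleton : ∀ {k} → Fin k → Fin k → ℕ → Fin k → ℕ
doubleton p q t l = if does (l ≟F p) ∨ does (l ≟F q) then t else 0

doubleton-p : ∀ {k} (p q : Fin k) t → doubleton p q t p ≡ t
doubleton-p p q t with p ≟F p
... | yes _ = ≡.refl
... | no ne = ⊥-elim (ne ≡.refl)

doubleton-q : ∀ {k} (p q : Fin k) t → doubleton p q t q ≡ t
doubleton-q p q t with q ≟F p | q ≟F q
... | yes _ | _     = ≡.refl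
... | no _  | yes _ = ≡.refl
... | no _  | no ne = ⊥-elim (ne ≡.refl)

doubleton-other : ∀ {k} (p q : Fin k) t l → l ≢ p → l ≢ q → doubleton p q t l ≡ 0
doubleton-other p q t l np nq with l ≟F p | l ≟F q
... | yes e | _     = ⊥-elim (np e)
... | no _  | yes e = ⊥-elim (nq e)
... | no _  | no _  = ≡.refl

module CauchyProduct {c ℓ} (R : CommutativeRing c ℓ) where
  open Sums R
  open Series R hiding (Σᴸ; pow)
  open Boxes R
  open Nested R
  open Complete R

  oneS-resp : ∀ {k} → Resp (oneS {k})
  oneS-resp {k} eq = reflexive (≡.cong (λ t → if t then 1# else 0#) (allZero-cong k eq))

  product : ∀ {k} → List (Fin k × Fin k) → PS k
  product = foldr (λ pq F → geoPair (proj₁ pq) (proj₂ pq) ⋆ F) oneS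

  product-resp : ∀ {k} (L : List (Fin k × Fin k)) → Resp (product L)
  product-resp []            = oneS-resp
  product-resp ((p , q) ∷ L) = ⋆-resp (geoPair p q) (product L) (product-resp L)

  product-↭ : ∀ {k} {L L' : List (Fin k × Fin k)} → L ↭ L' → ∀ e → product L e ≈ product L' e
  product-↭ ↭.refl e = refl
  product-↭ (↭.prep (p , q) π) e = ⋆-cong (geoPair p q) e (product-↭ π)
  product-↭ {k} {_} {_ ∷ _ ∷ L'} (↭.swap (p , q) (r , s) π) e = trans (⋆-cong (geoPair p q) e (λ d → ⋆-cong (geoPair r s) d (product-↭ π)))
    (⋆-left-comm k R (geoPair p q) (geoPair r s) (product L') (product-resp L') e)
  product-↭ (↭.trans π π') e = trans (product-↭ π e) (product-↭ π' e)

  cauchyProd-product : ∀ m n → cauchyProd m n ≡ product (grid {m} {n} (λ i j → (i ↑ˡ n , m ↑ʳ j)))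
  cauchyProd-product m n = ≡.trans (≡.cong₂ (λ xs ys → foldr _⋆_ oneS (concatMap (λ i → map (λ j → geoPair (i ↑ˡ n) (m ↑ʳ j)) ys) xs)) (allFin≡fins m) (allFin≡fins n))
    (≡.trans (≡.cong (foldr _⋆_ oneS) (≡.sym (≡.trans (map-concatMap gp (λ i → map (λ j → (i ↑ˡ n , m ↑ʳ j)) (fins n)) (fins m))
        (concatMap-cong (λ i → ≡.sym (map-∘ (fins n))) (fins m)))))
      (foldr-map _⋆_ gp oneS (grid (λ i j → (i ↑ˡ n , m ↑ʳ j)))))
    where
    gp : Fin (m + n) × Fin (m + n) → PS (m + n)
    gp pq = geoPair (proj₁ pq) (proj₂ pq)

  geoPair-on : ∀ {k} (p q : Fin k) {d} t → d ≗ doubleton p q t → geoPair p q d ≈ 1#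
  geoPair-on {k} p q {d} t eq = if-true (≡.cong₂ _∧_ (T⇒true (ℕₚ.≡⇒≡ᵇ (d p) (d q) (≡.trans (eq p) (≡.trans (doubleton-p p q t) (≡.sym (≡.trans (eq q) (doubleton-q p q t)))))))
    (allZero⁺ k (λ l → other l)))
    where
    other : ∀ l → (if does (l ≟F p) ∨ does (l ≟F q) then 0 else d l) ≡ 0
    other l with does (l ≟F p) ∨ does (l ≟F q) in e
    ... | true  = ≡.refl
    ... | false = ≡.trans (eq l) (≡.cong (λ z → if z then t else 0) e)

  geoPair-off : ∀ {k} (p q : Fin k) {d} → ¬ d ≗ doubleton p q (d p) → geoPair p q d ≈ 0#
  geoPair-off {k} p q {d} ne with d p ≡ᵇ d q in e₁ | allZero k (λ l → if does (l ≟F p) ∨ does (l ≟F q) then 0 else d l) in e₂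
  ... | false | _     = refl
  ... | true  | false = refl
  ... | true  | true  = ⊥-elim (ne on)
    where
    on : d ≗ doubleton p q (d p)
    on l with l ≟F p | l ≟F q | allZero⁻ k e₂ l
    ... | yes ≡.refl | _          | _ = ≡.refl
    ... | no _       | yes ≡.refl | _ = ≡.sym (ℕₚ.≡ᵇ⇒≡ (d p) (d q) (Equivalence.from T-≡ e₁))
    ... | no _       | no _       | z = z

  boxSum-∑ : ∀ {k} e n (F : ℕ → PS k) → boxSum k e (λ d → ∑ n (λ t → F t d)) ≈ ∑ n (λ t → boxSum k e (F t))
  boxSum-∑ {k} e n F = go (boxes k e)
    where
    go : ∀ (xs : List (Fin k → ℕ)) → Σᴸ (map (λ d → ∑ n (λ t → F t d)) xs) ≈ ∑ n (λ t → Σᴸ (map (F t) xs))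
    go []       = sym (∑-zero n (λ _ _ → refl))
    go (x ∷ xs) = trans (+-congˡ (go xs)) (sym (∑-+ n (λ t → F t x) (λ t → Σᴸ (map (F t) xs))))

  -- Indicators of the exponents `doubleton p q t` turn the box sum into a double sum; after
  -- interchanging, each t leaves one exponent, which lies in the box when t is at most both
  -- entries.
  geoPair-⋆ : ∀ {k} (p q : Fin k) (F : PS k) → Resp F → ∀ e →
    (geoPair p q ⋆ F) e ≈ ∑ (suc (e p)) (λ t → I (t ≤? e q) *R F (λ l → e l ∸ doubleton p q t l))
  geoPair-⋆ {k} p q F rF e = begin
    boxSum k e (λ d → geoPair p q d *R F (λ l → e l ∸ d l))
      ≈⟨ boxSum-cong k e spread ⟩
    boxSum k e (λ d → ∑ (suc (e p)) (λ t → I (d ≗? doubleton p q t) *R Y t))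
      ≈⟨ boxSum-∑ e (suc (e p)) (λ t d → I (d ≗? doubleton p q t) *R Y t) ⟩
    ∑ (suc (e p)) (λ t → boxSum k e (λ d → I (d ≗? doubleton p q t) *R Y t))
      ≈⟨ ∑-cong< (suc (e p)) (λ { t (s≤s t≤) → collect t t≤ }) ⟩
    ∑ (suc (e p)) (λ t → I (t ≤? e q) *R Y t) ∎
    where
    Y : ℕ → A
    Y t = F (λ l → e l ∸ doubleton p q t l)
    spread : ∀ d → (∀ i → d i ≤ e i) → geoPair p q d *R F (λ l → e l ∸ d l) ≈ ∑ (suc (e p)) (λ t → I (d ≗? doubleton p q t) *R Y t)
    spread d d≤ with d ≗? doubleton p q (d p)
    ... | yes eq = begin
      geoPair p q d *R F (λ l → e l ∸ d l)     ≈⟨ *-cong (trans (geoPair-on p q (d p) eq) (sym (I-yes (d ≗? doubleton p q (d p)) eq))) (rF (λ l → ≡.cong (e l ∸_) (eq l))) ⟩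
      I (d ≗? doubleton p q (d p)) *R Y (d p)  ≈⟨ ∑-single (suc (e p)) {λ t → I (d ≗? doubleton p q t) *R Y t} (d p) (s≤s (d≤ p))
                                                    (λ t _ ne → I*-no (d ≗? doubleton p q t) (λ eq' → ne (≡.sym (≡.trans (eq' p) (doubleton-p p q t))))) ⟨
      ∑ (suc (e p)) (λ t → I (d ≗? doubleton p q t) *R Y t) ∎
    ... | no ne = trans (*-zeroˡ (geoPair-off p q ne)) (sym (∑-zero (suc (e p)) (λ t _ → I*-no (d ≗? doubleton p q t) {Y t}
                    (λ eq → ne (λ l → ≡.trans (eq l) (≡.cong (λ z → doubleton p q z l) (≡.sym (≡.trans (eq p) (doubleton-p p q t)))))))))
    collect : ∀ t → t ≤ e p → boxSum k e (λ d → I (d ≗? doubleton p q t) *R Y t) ≈ I (t ≤? e q) *R Y t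
    collect t t≤ with t ≤? e q
    ... | yes t≤q = boxSum-single k e (doubleton p q t) inBox (λ d eq → *-congʳ (trans (I-yes (d ≗? doubleton p q t) eq) (sym (I-yes (t ≤? e q) t≤q)))) (λ d _ ne → I*-no (d ≗? doubleton p q t) ne)
      where
      inBox : ∀ l → doubleton p q t l ≤ e l
      inBox l with l ≟F p | l ≟F q
      ... | yes ≡.refl | _          = t≤
      ... | no _       | yes ≡.refl = t≤q
      ... | no _       | no _       = z≤n
    ... | no t≰q = trans (boxSum-zero k e (λ d d≤ → I*-no (d ≗? doubleton p q t)
                     (λ eq → t≰q (≤-trans (≤-reflexive (≡.sym (≡.trans (eq q) (doubleton-q p q t)))) (d≤ q))))) (sym (I*-no (t ≤? e q) t≰q))

opposite-injective : ∀ {n} {i j : Fin n} → opposite i ≡ opposite j → i ≡ j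
opposite-injective {i = i} {j} e = ≡.trans (≡.sym (opposite-involutive i)) (≡.trans (≡.cong opposite e) (opposite-involutive j))

↑ˡ≢↑ʳ : ∀ {m n} (i : Fin m) (j : Fin n) → i ↑ˡ n ≢ m ↑ʳ j
↑ˡ≢↑ʳ {suc m} fz     j ()
↑ˡ≢↑ʳ {suc m} (fs i) j e = ↑ˡ≢↑ʳ i j (fs-inj e)
  where
  fs-inj : ∀ {k} {x y : Fin k} → fs x ≡ fs y → x ≡ y
  fs-inj ≡.refl = ≡.refl

tabulate-updateAt : ∀ {n} (f g : Fin n → ℕ) i t → g i ≡ f i ∸ t → (∀ j → j ≢ i → g j ≡ f j) →
                    tabulate g ≡ updateAt (tabulate f) i (_∸ t)
tabulate-updateAt f g fz     t e e' = ≡.cong₂ _∷_ e (tabulate-cong (λ j → e' (fs j) (λ ())))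
tabulate-updateAt f g (fs i) t e e' = ≡.cong₂ _∷_ (e' fz (λ ()))
  (tabulate-updateAt (f ∘ fs) (g ∘ fs) i t e (λ j ne → e' (fs j) (λ { ≡.refl → ne ≡.refl })))

module CauchyProductCoefficients {c ℓ} (R : CommutativeRing c ℓ) where
  open Sums R
  open Series R hiding (Σᴸ; pow)
  open Boxes R
  open Complete R
  open CauchyProduct R

  Fun : ℕ → ℕ → Set c
  Fun m n = Vec ℕ m → Vec ℕ n → A

  -- Multiplication by 1/(1 - x_i y_j), acting on coefficients indexed by the vectors d and e.
  shiftSum : ∀ {m n} → Fin m → Fin n → Fun m n → Fun m n
  shiftSum i j F d e = ∑ (suc (lookup d i)) (λ t → I (t ≤? lookup e j) *R F (updateAt d i (_∸ t)) (updateAt e j (_∸ t)))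

  shiftSum-zero : ∀ {m n} i j {F : Fun m n} d e → (∀ d e → F d e ≈ 0#) → shiftSum i j F d e ≈ 0#
  shiftSum-zero i j d e eq = ∑-zero (suc (lookup d i)) (λ t _ → *-zeroʳ {I (t ≤? lookup e j)} (eq (updateAt d i (_∸ t)) (updateAt e j (_∸ t))))

  shiftSums : ∀ {m n} → List (Fin m × Fin n) → Fun m n → Fun m n
  shiftSums L F = foldr (λ ij → shiftSum (proj₁ ij) (proj₂ ij)) F L

  shiftSums-zero : ∀ {m n} L {F : Fun m n} → (∀ d e → F d e ≈ 0#) → ∀ d e → shiftSums L F d e ≈ 0#
  shiftSums-zero []            eq d e = eq d e
  shiftSums-zero ((i , j) ∷ L) eq d e = shiftSum-zero i j d e (shiftSums-zero L eq)

  shiftSums-++ : ∀ {m n} L L' (F : Fun m n) → shiftSums (L ++ L') F ≡ shiftSums L (shiftSums L' F)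
  shiftSums-++ []            L' F = ≡.refl
  shiftSums-++ ((i , j) ∷ L) L' F = ≡.cong (shiftSum i j) (shiftSums-++ L L' F)

  shiftSums-fs : ∀ {m n} (L : List (Fin m × Fin n)) (F : Fun (suc m) n) x d e →
    shiftSums (map (λ ij → (fs (proj₁ ij) , proj₂ ij)) L) F (x ∷ d) e ≈ shiftSums L (λ d e → F (x ∷ d) e) d e
  shiftSums-fs []            F x d e = refl
  shiftSums-fs ((i , j) ∷ L) F x d e = ∑-cong (suc (lookup d i)) (λ t → *-congˡ {I (t ≤? lookup e j)} (shiftSums-fs L F x (updateAt d i (_∸ t)) (updateAt e j (_∸ t))))

  origin : ∀ {m n} → Fun m n
  origin d e = δ d *R δ e

  shiftSums-fsʳ : ∀ {m n} (L : List (Fin n)) (F : Fun (suc m) (suc n)) d y e →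
    shiftSums (map (λ j → (fz , fs j)) L) F d (y ∷ e) ≈ shiftSums (map (fz ,_) L) (λ d e → F d (y ∷ e)) d e
  shiftSums-fsʳ []      F d y e = refl
  shiftSums-fsʳ (j ∷ L) F d y e = ∑-cong (suc (lookup d fz)) (λ t → *-congˡ {I (t ≤? lookup e j)} (shiftSums-fsʳ L F (updateAt d fz (_∸ t)) y (updateAt e j (_∸ t))))

  -- Here t is the whole amount taken from the first y-exponent, whereas the recursion of `H` takes
  -- it one unit at a time.
  H-∷ : ∀ {n} x y (F : Vec ℕ (suc n) → A) e → ∑ (suc x) (λ t → I (t ≤? y) *R H (x ∸ t) (λ e' → F ((y ∸ t) ∷ e')) e) ≈ H x F (y ∷ e)
  H-∷ zero    y       F e = trans (+-identityʳ _) (I*-yes (0 ≤? y) z≤n)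
  H-∷ (suc x) zero    F e = trans (+-cong (I*-yes (0 ≤? 0) z≤n) (∑-zero (suc x) (λ t _ → zeroˡ (H (x ∸ t) (λ e' → F (0 ∷ e')) e)))) (+-identityʳ _)
  H-∷ (suc x) (suc y) F e = +-cong (I*-yes (0 ≤? suc y) z≤n)
    (trans (∑-cong (suc x) (λ t → *-congʳ {H (x ∸ t) (λ e' → F ((y ∸ t) ∷ e')) e} (I-suc t))) (H-∷ x y F e))
    where
    I-suc : ∀ t → I (suc t ≤? suc y) ≈ I (t ≤? y)
    I-suc zero    = refl
    I-suc (suc t) = refl

  -- Since `K` is supported where the first x-exponent is 0, the shifts in that variable must add up
  -- to x, each lowering one y-exponent; this is the sum that defines `H x`.
  row-H : ∀ {m} n (K : Fun (suc m) n) (F : Vec ℕ n → A) d → (∀ e → K (0 ∷ d) e ≈ F e) → (∀ x e → K (suc x ∷ d) e ≈ 0#) →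
          ∀ x e → shiftSums (map (fz ,_) (fins n)) K (x ∷ d) e ≈ H x F e
  row-H zero    K F d k₀ k₁ zero    [] = k₀ []
  row-H zero    K F d k₀ k₁ (suc x) [] = k₁ x []
  row-H (suc n) K F d k₀ k₁ x (y ∷ e) = begin
    ∑ (suc x) (λ t → I (t ≤? y) *R shiftSums (map (fz ,_) (map fs (fins n))) K ((x ∸ t) ∷ d) ((y ∸ t) ∷ e))
      ≈⟨ ∑-cong (suc x) (λ t → *-congˡ {I (t ≤? y)} (begin
           shiftSums (map (fz ,_) (map fs (fins n))) K ((x ∸ t) ∷ d) ((y ∸ t) ∷ e)
             ≡⟨ ≡.cong (λ L → shiftSums L K ((x ∸ t) ∷ d) ((y ∸ t) ∷ e)) (map-∘ (fins n)) ⟨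
           shiftSums (map (λ j → (fz , fs j)) (fins n)) K ((x ∸ t) ∷ d) ((y ∸ t) ∷ e)
             ≈⟨ shiftSums-fsʳ (fins n) K ((x ∸ t) ∷ d) (y ∸ t) e ⟩
           shiftSums (map (fz ,_) (fins n)) (λ d e → K d ((y ∸ t) ∷ e)) ((x ∸ t) ∷ d) e
             ≈⟨ row-H n (λ d e → K d ((y ∸ t) ∷ e)) (λ e' → F ((y ∸ t) ∷ e')) d (λ e → k₀ ((y ∸ t) ∷ e)) (λ x e → k₁ x ((y ∸ t) ∷ e)) (x ∸ t) e ⟩
           H (x ∸ t) (λ e' → F ((y ∸ t) ∷ e')) e ∎)) ⟩
    ∑ (suc x) (λ t → I (t ≤? y) *R H (x ∸ t) (λ e' → F ((y ∸ t) ∷ e')) e)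
      ≈⟨ H-∷ x y F e ⟩
    H x F (y ∷ e) ∎

  index : ∀ m n → List (Fin m × Fin n)
  index m n = grid (λ i j → (i , j))

  index-suc : ∀ m n → index (suc m) n ≡ map (fz ,_) (fins n) ++ map (λ ij → (fs (proj₁ ij) , proj₂ ij)) (index m n)
  index-suc m n = ≡.cong (map (fz ,_) (fins n) ++_) (≡.trans (concatMap-map (λ i → map (i ,_) (fins n)) fs (fins m))
    (≡.sym (≡.trans (map-concatMap (λ ij → (fs (proj₁ ij) , proj₂ ij)) (λ i → map (i ,_) (fins n)) (fins m))
      (concatMap-cong (λ i → ≡.sym (map-∘ (fins n))) (fins m)))))

  -- In the row-major list the factors of the first x-variable are outermost. They act on a series
  -- free of that variable, as `row-H` demands, and the remaining factors are treated by induction.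
  shiftSums-W : ∀ {m n} (d : Vec ℕ m) (e : Vec ℕ n) → shiftSums (index m n) origin d e ≈ W d e
  shiftSums-W []      e = *-identityˡ _
  shiftSums-W {suc m} {n} (x ∷ d) e = begin
    shiftSums (index (suc m) n) origin (x ∷ d) e
      ≡⟨ ≡.cong (λ L → shiftSums L origin (x ∷ d) e) (index-suc m n) ⟩
    shiftSums (map (fz ,_) (fins n) ++ rest) origin (x ∷ d) e
      ≡⟨ ≡.cong (λ F → F (x ∷ d) e) (shiftSums-++ (map (fz ,_) (fins n)) rest origin) ⟩
    shiftSums (map (fz ,_) (fins n)) (shiftSums rest origin) (x ∷ d) e
      ≈⟨ row-H n (shiftSums rest origin) (W d) d
           (λ e → trans (shiftSums-fs (index m n) origin 0 d e) (shiftSums-W d e))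
           (λ x e → trans (shiftSums-fs (index m n) origin (suc x) d e) (shiftSums-zero (index m n) (λ d e → zeroˡ (δ e)) d e)) x e ⟩
    H x (W d) e ∎
    where
    rest : List (Fin (suc m) × Fin n)
    rest = map (λ ij → (fs (proj₁ ij) , proj₂ ij)) (index m n)

  Sub-tabulate⁻ : ∀ n (f : Fin n → ℕ) → Sub (tabulate f) (zeros n) → ∀ i → f i ≡ 0
  Sub-tabulate⁻ (suc n) f (p , s) fz     = ℕₚ.n≤0⇒n≡0 p
  Sub-tabulate⁻ (suc n) f (p , s) (fs i) = Sub-tabulate⁻ n (f ∘ fs) s i

  Sub-tabulate⁺ : ∀ n (f : Fin n → ℕ) → (∀ i → f i ≡ 0) → Sub (tabulate f) (zeros n)
  Sub-tabulate⁺ zero    f z = tt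
  Sub-tabulate⁺ (suc n) f z = ≤-reflexive (z fz) , Sub-tabulate⁺ n (f ∘ fs) (z ∘ fs)

  module _ (m n : ℕ) where
    ιˡ : Fin m → Fin (m + n)
    ιˡ i = opposite i ↑ˡ n

    ιʳ : Fin n → Fin (m + n)
    ιʳ j = m ↑ʳ opposite j

    xs : (Fin (m + n) → ℕ) → Vec ℕ m
    xs e = tabulate (e ∘ ιˡ)

    ys : (Fin (m + n) → ℕ) → Vec ℕ n
    ys e = tabulate (e ∘ ιʳ)

    oneS-origin : ∀ e → oneS {m + n} e ≈ origin (xs e) (ys e)
    oneS-origin e with Sub? (xs e) (zeros m) | Sub? (ys e) (zeros n)
    ... | no ¬x | _     = trans (if-false (¬T⇒false (λ t → ¬x (Sub-tabulate⁺ m (e ∘ ιˡ) (λ i → allZero⁻ (m + n) (T⇒true t) (ιˡ i)))))) (sym (zeroˡ _))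
    ... | yes _ | no ¬y = trans (if-false (¬T⇒false (λ t → ¬y (Sub-tabulate⁺ n (e ∘ ιʳ) (λ j → allZero⁻ (m + n) (T⇒true t) (ιʳ j)))))) (sym (zeroʳ _))
    ... | yes x | yes y = trans (if-true (allZero⁺ (m + n) all)) (sym (*-identityˡ _))
      where
      left : ∀ i → e (i ↑ˡ n) ≡ 0
      left i = ≡.trans (≡.cong (λ z → e (z ↑ˡ n)) (≡.sym (opposite-involutive i))) (Sub-tabulate⁻ m (e ∘ ιˡ) x (opposite i))
      right : ∀ j → e (m ↑ʳ j) ≡ 0
      right j = ≡.trans (≡.cong (λ z → e (m ↑ʳ z)) (≡.sym (opposite-involutive j))) (Sub-tabulate⁻ n (e ∘ ιʳ) y (opposite j))
      all : ∀ l → e l ≡ 0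
      all l with splitAt m l in eq
      ... | inj₁ i = ≡.trans (≡.cong e (≡.sym (splitAt⁻¹-↑ˡ eq))) (left i)
      ... | inj₂ j = ≡.trans (≡.cong e (≡.sym (splitAt⁻¹-↑ʳ eq))) (right j)

    pair : Fin m × Fin n → Fin (m + n) × Fin (m + n)
    pair ij = (ιˡ (proj₁ ij) , ιʳ (proj₂ ij))

    product-shiftSums : ∀ L e → product (map pair L) e ≈ shiftSums L origin (xs e) (ys e)
    product-shiftSums []            e = oneS-origin e
    product-shiftSums ((i , j) ∷ L) e = begin
      (geoPair (ιˡ i) (ιʳ j) ⋆ product (map pair L)) e
        ≈⟨ geoPair-⋆ (ιˡ i) (ιʳ j) (product (map pair L)) (product-resp (map pair L)) e ⟩
      ∑ (suc (e (ιˡ i))) (λ t → I (t ≤? e (ιʳ j)) *R product (map pair L) (e' t))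
        ≈⟨ ∑-cong (suc (e (ιˡ i))) (λ t → *-congˡ {I (t ≤? e (ιʳ j))} (trans (product-shiftSums L (e' t))
             (reflexive (≡.cong₂ (shiftSums L origin) (xs-update t) (ys-update t))))) ⟩
      ∑ (suc (e (ιˡ i))) (λ t → I (t ≤? e (ιʳ j)) *R shiftSums L origin (updateAt (xs e) i (_∸ t)) (updateAt (ys e) j (_∸ t)))
        ≡⟨ ≡.cong₂ (λ x y → ∑ (suc x) (λ t → I (t ≤? y) *R shiftSums L origin (updateAt (xs e) i (_∸ t)) (updateAt (ys e) j (_∸ t))))
             (lookup∘tabulate (e ∘ ιˡ) i) (lookup∘tabulate (e ∘ ιʳ) j) ⟨
      shiftSums ((i , j) ∷ L) origin (xs e) (ys e) ∎
      where
      e' : ℕ → Fin (m + n) → ℕ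
      e' t l = e l ∸ doubleton (ιˡ i) (ιʳ j) t l
      xs-update : ∀ t → xs (e' t) ≡ updateAt (xs e) i (_∸ t)
      xs-update t = tabulate-updateAt (e ∘ ιˡ) (e' t ∘ ιˡ) i t (≡.cong (e (ιˡ i) ∸_) (doubleton-p (ιˡ i) (ιʳ j) t))
        (λ k ne → ≡.cong (e (ιˡ k) ∸_) (doubleton-other (ιˡ i) (ιʳ j) t (ιˡ k)
          (λ eq → ne (opposite-injective (↑ˡ-injective n (opposite k) (opposite i) eq))) (↑ˡ≢↑ʳ (opposite k) (opposite j))))
      ys-update : ∀ t → ys (e' t) ≡ updateAt (ys e) j (_∸ t)
      ys-update t = tabulate-updateAt (e ∘ ιʳ) (e' t ∘ ιʳ) j t (≡.cong (e (ιʳ j) ∸_) (doubleton-q (ιˡ i) (ιʳ j) t))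
        (λ k ne → ≡.cong (e (ιʳ k) ∸_) (doubleton-other (ιˡ i) (ιʳ j) t (ιʳ k)
          (λ eq → ↑ˡ≢↑ʳ (opposite i) (opposite k) (≡.sym eq)) (λ eq → ne (opposite-injective (↑ʳ-injective m (opposite k) (opposite j) eq)))))

    cauchyProd-W : ∀ e → cauchyProd m n e ≈ W (xs e) (ys e)
    cauchyProd-W e = begin
      cauchyProd m n e
        ≡⟨ ≡.cong (λ F → F e) (cauchyProd-product m n) ⟩
      product (grid {m} {n} (λ i j → (i ↑ˡ n , m ↑ʳ j))) e
        ≈⟨ product-↭ (grid-opposite {m} {n} (λ i j → (i ↑ˡ n , m ↑ʳ j))) e ⟩
      product (grid {m} {n} (λ i j → (ιˡ i , ιʳ j))) e
        ≡⟨ ≡.cong (λ L → product L e) (≡.trans (map-concatMap pair (λ i → map (i ,_) (fins n)) (fins m)) (concatMap-cong (λ i → ≡.sym (map-∘ (fins n))) (fins m))) ⟨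
      product (map pair (index m n)) e
        ≈⟨ product-shiftSums (index m n) e ⟩
      shiftSums (index m n) origin (xs e) (ys e)
        ≈⟨ shiftSums-W (xs e) (ys e) ⟩
      W (xs e) (ys e) ∎

-- Assembly: from truncated sums to the Cauchy product.

module Theorem {c ℓ} (R : CommutativeRing c ℓ) (α β : CommutativeRing.Carrier R) (m n : ℕ) (e : Fin (m + n) → ℕ) where
  open Sums R
  open Series R hiding (Σᴸ; pow)
  open Boxes R
  open Complete R
  open Coefficients R α β
  open CauchyProductCoefficients R

  eˡ : Fin m → ℕ
  eˡ i = e (i ↑ˡ n)

  eʳ : Fin n → ℕ
  eʳ j = e (m ↑ʳ j)

  F : List ℕ → A
  F lam = Gr' m lam eˡ *R gr' n lam eʳ

  at-replicate : ∀ k x i → i < k → at (replicate k x) i ≡ x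
  at-replicate (suc k) x zero    _        = ≡.refl
  at-replicate (suc k) x (suc i) (s≤s lt) = at-replicate k x i lt

  filter-Σ : ∀ (p : List ℕ → Bool) L → (∀ x → p x ≡ false → F x ≈ 0#) → Σᴸ (map F (filterᵇ p L)) ≈ Σᴸ (map F L)
  filter-Σ p []      z = refl
  filter-Σ p (x ∷ L) z with p x in eq
  ... | true  = +-congˡ (filter-Σ p L z)
  ... | false = trans (filter-Σ p L z) (sym (trans (+-congʳ (z x eq)) (+-identityˡ _)))

  -- N ≥ m leaves room for all partitions with up to m parts, since the enumeration stops at N
  -- parts. N at least the total x-degree makes every partition discarded for its size contribute 0,
  -- by `Gr-order`.
  bound : ℕ
  bound = m + sumV (exponents eˡ)

  cauchy : ∀ N → bound ≤ N → lhsTrunc α β m n N e ≈ cauchyProd m n e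
  cauchy N le = begin
    lhsTrunc α β m n N e
      ≈⟨ Σᴸ-map (partitionsUpTo N) (λ f → f e) (λ lam → embL n (Gr' m lam) ⋆ embR m (gr' n lam)) ⟩
    Σᴸ (map (λ lam → (embL n (Gr' m lam) ⋆ embR m (gr' n lam)) e) (partitionsUpTo N))
      ≈⟨ Σᴸ-cong (partitionsUpTo N) (λ lam → embL-⋆-embR (Gr' m lam) (gr' n lam) e (Gr-resp m lam) (gr-resp n lam)) ⟩
    Σᴸ (map F (partitionsUpTo N))
      ≈⟨ filter-Σ (λ lam → sum lam <ᵇ suc N) (subBounded N (replicate N N)) (λ lam eq → *-zeroˡ (Gr-order m lam eˡ (large lam eq))) ⟩
    subs N (replicate N N) F
      ≈⟨ subs-cube m N (replicate N N) F ≤-refl (λ lam ne _ → *-zeroˡ (Gr-vanish m lam eˡ ne)) ⟩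
    cube m (λ v → I (SubB? N v (replicate N N)) *R F (shape v))
      ≈⟨ cube-cong< m term ⟩
    cube m (λ v → G v (exponents eˡ) *R g v (exponents eʳ))
      ≈⟨ vec-cauchy (exponents eˡ) (exponents eʳ) (s≤s (≤-trans (m≤n+m _ m) le)) ⟩
    W (exponents eˡ) (exponents eʳ)
      ≈⟨ cauchyProd-W m n e ⟨
    cauchyProd m n e ∎
    where
    -- The side is N + 1 because entries of a cube stay strictly below its side, while parts equal
    -- to N are enumerated.
    open Cubes R (suc N)
    open ListSums R (suc N)
    open VecCauchy R α β (suc N)
    large : ∀ lam → (sum lam <ᵇ suc N) ≡ false → sumV (exponents eˡ) < sum lam
    large lam eq = ≤-<-trans (≤-trans (m≤n+m _ m) le) (≰⇒> (λ le' → ≡.subst T eq (ℕₚ.<⇒<ᵇ (s≤s le'))))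
    part≤ : ∀ {k} (v : Vec ℕ k) → Bounded v → ∀ i → part v i ≤ N
    part≤ []      _             i       = z≤n
    part≤ (x ∷ v) (s≤s p , _)   zero    = p
    part≤ (x ∷ v) (_ , b)       (suc i) = part≤ v b i
    in-box : ∀ (v : Vec ℕ m) → Bounded v → ∀ i → part v i ≤ at (replicate N N) i
    in-box v b i with i <? N
    ... | yes lt = ≤-trans (part≤ v b i) (≤-reflexive (≡.sym (at-replicate N N i lt)))
    ... | no ge  = ≤-trans (≤-reflexive (part-length v i (≤-trans (≤-trans (m≤m+n m _) le) (≮⇒≥ ge)))) z≤n
    term : ∀ v → Bounded v → I (SubB? N v (replicate N N)) *R F (shape v) ≈ G v (exponents eˡ) *R g v (exponents eʳ)
    term v b with Decr? v
    ... | yes d = trans (I*-yes (SubB? N v (replicate N N)) (Decr⇒SubB N v (replicate N N) (≤-trans (≤-reflexive (≡.sym (part-0 v))) (part≤ v b 0)) d (in-box v b)))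
                        (*-cong (Gr≈G (suc N) m v eˡ d b) (gr≈g (suc N) n v eʳ (s≤s z≤n) d b))
    ... | no ¬d = trans (I*-no (SubB? N v (replicate N N)) (λ s → ¬d (proj₂ (SubB⇒Decr N v (replicate N N) s)))) (sym (*-zeroˡ (G-no-Decr v (exponents eˡ) ¬d)))

theorem6p2 : ∀ {c ℓ} (R : CommutativeRing c ℓ) (α β : CommutativeRing.Carrier R) (m n : ℕ)
    (e : Fin (m + n) → ℕ) →
    ∃ λ N₀ → ∀ N → N₀ ≤ N →
    CommutativeRing._≈_ R (Series.lhsTrunc R α β m n N e) (Series.cauchyProd R m n e)
theorem6p2 R α β m n e = Theorem.bound R α β m n e , Theorem.cauchy R α β m n e
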